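{- Let $R$ be a commutative $\mathbb{Q}$-algebra, let $m\ge 1$ be an integer, $n=2m$, and let $A\in\mathrm{Mat}(n,R)$ be skew-symmetric. Let $J\in\mathrm{Mat}(n,R)$ be the block-diagonal matrix with $m$ diagonal blocks equal to $\begin{pmatrix}0&1\\-1&0\end{pmatrix}$. Set $c_0=1$ and define matrices $N_1,\dots,N_m\in\mathrm{Mat}(n,R)$ and elements $c_1,\dots,c_m\in R$ recursively by $$N_1=-J,\qquad c_k=\tfrac{1}{2k}\,\mathrm{tr}(AN_k)\quad (1\le k\le m),\qquad N_{k+1}=JAN_k-c_k\,J\quad (1\le k\le m-1).$$ Then, in $R[t]$, $$\mathrm{pf}(tJ+A)=\sum_{j=0}^{m}c_{m-j}\,t^j .$$ In particular $c_m=\mathrm{pf}(A)$. Moreover $N_m=\mathrm{Padj}(A)$ and $A\,N_m=\mathrm{pf}(A)\cdot I$. Consequently, if $\beta\ge 2$ is such that two $n\times n$-matrices over $R$ can be multiplied at cost $O(n^\beta)$, then this recursion computes the Pfaffian of a skew-symmetric $n\times n$-matrix over $R$ ($n$ even) at cost $O(n^{\beta+1})$, and the only divisions it uses are divisions by the nonzero integers $2k$, $1\le k\le m$ (no divisions by matrix entries).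
   Context: A matrix $A$ is skew-symmetric if $A^\top=-A$. (Over a $\mathbb{Q}$-algebra this forces zero diagonal.) $I$ is the $n\times n$ identity matrix. Pfaffian: for a commutative $\mathbb{Q}$-algebra $S$ (here $S=R$ or $S=R[t]$) and a skew-symmetric matrix $A=(a_{ij})\in\mathrm{Mat}(n,S)$ with $n=2m$, $$\mathrm{pf}(A)=\sum_P \mathrm{sign}(P)\,a_{i_1j_1}\cdots a_{i_mj_m},$$ where the sum is over all perfect matchings $P$ of $\{1,\dots,n\}$, i.e. partitions $\{1,\dots,n\}=\{i_1,j_1\}\sqcup\cdots\sqcup\{i_m,j_m\}$ into two-element sets, written with $i_k<j_k$, and $\mathrm{sign}(P)$ is the sign of the permutation sending $(1,2,\dots,n-1,n)$ to $(i_1,j_1,\dots,i_m,j_m)$. The Pfaffian of the empty ($0\times0$) matrix is $1$. Pfaff-adjugate: for $i\ne j$ let $A\langle i,j\rangle$ be the skew-symmetric $(n-2)\times(n-2)$-matrix obtained from $A$ by removing the $i$-th and $j$-th rows and columns. Then $\mathrm{Padj}(A)=(b_{ij})\in\mathrm{Mat}(n,S)$ is defined by $b_{ii}=0$, $b_{ij}=(-1)^{i+j}\,\mathrm{pf}(A\langle i,j\rangle)$ if $i<j$, and $b_{ij}=(-1)^{i+j+1}\,\mathrm{pf}(A\langle i,j\rangle)$ if $i>j$. Cost means the number of arithmetic operations in $R$: additions, subtractions, multiplications, and divisions by nonzero integers. -}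

module Defs where

open import Algebra.Bundles using (CommutativeRing; RawRing)
open import Algebra.Morphism.Structures using (module RingMorphisms)
open import Data.Empty using (⊥)
open import Data.Fin.Base using (Fin; zero; suc; toℕ; punchIn; punchOut)
open import Data.Fin.Properties as Fin using (<-cmp)
open import Data.Integer.Base as ℤ using (ℤ; +_)
open import Data.List.Base as List
  using (List; []; _∷_; [_]; map; concatMap; foldr; filter; length; allFin; cartesianProduct)
open import Data.Nat.Base as ℕ using (ℕ; zero; suc)
open import Data.Nat.ListAction using (sum)
open import Data.Product.Base using (∃-syntax; _×_; _,_; uncurry)
open import Data.Rational.Base as ℚ using (ℚ; 1/_)
open import Data.Rational.Literals using (fromℤ)
import Data.Rational.Properties as ℚ
open import Data.Sum.Base as Sum using (_⊎_; inj₁; inj₂)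
open import Data.Unit.Base using (⊤; tt)
open import Data.Vec.Base as Vec using (Vec; []; _∷_; lookup; removeAt)
open import Function.Base using (_∘_)
open import Level using (Level; _⊔_) renaming (suc to lsuc)
open import Relation.Binary.Definitions using (tri<; tri≈; tri>)
open import Relation.Binary.PropositionalEquality using (_≡_; _≢_; sym; trans; subst)

private
  variable
    c ℓ : Level

------------------------------------------------------------------------
-- Commutative ℚ-algebras

record CommutativeℚAlgebra c ℓ : Set (lsuc (c ⊔ ℓ)) where
  infixl 7 _÷_
  field
    commutativeRing : CommutativeRing c ℓ
  open CommutativeRing commutativeRing public
  open RingMorphisms ℚ.+-*-rawRing rawRing using (IsRingHomomorphism)
  field
    fromℚ              : ℚ → Carrier
    isRingHomomorphism : IsRingHomomorphism fromℚ

  _÷_ : Carrier → (d : ℤ) → .{{ℤ.NonZero d}} → Carrier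
  x ÷ d = fromℚ (1/ fromℤ d) * x

------------------------------------------------------------------------
-- Perfect matchings

-- All perfect matchings of the entries of a vector, each written as a
-- list of pairs.  The first entry is paired with any one of the others
-- and what is left is matched recursively.  Starting from an increasing
-- vector, every pair (i , j) produced has i < j.

matchings : ∀ {a} {X : Set a} {n} → Vec X n → List (List (X × X))
matchings []           = [ [] ]
matchings (x ∷ [])     = []
matchings (x ∷ y ∷ zs) =
  concatMap (λ k → map ((x , lookup (y ∷ zs) k) ∷_) (matchings (removeAt (y ∷ zs) k)))
            (allFin _)

-- (i₁ , j₁) ∷ (i₂ , j₂) ∷ …  ↦  i₁ , j₁ , i₂ , j₂ , …
word : ∀ {a} {X : Set a} → List (X × X) → List X
word = concatMap λ (i , j) → i ∷ j ∷ []

inversions : ∀ {n} → List (Fin n) → ℕ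
inversions []       = 0
inversions (x ∷ xs) = length (filter (Fin._<? x) xs) ℕ.+ inversions xs

------------------------------------------------------------------------
-- Matrices and Pfaffians; only the ring operations are needed

module Matrix (S : RawRing c ℓ) where

  open RawRing S
  open import Algebra.Definitions.RawSemiring rawSemiring public
    using (_^_) renaming (sum to Σ[_])

  infixl 6 _+ᴹ_ _-ᴹ_
  infixl 7 _*ᴹ_ _·ᴹ_
  infix  8 -ᴹ_
  infix  4 _≈ᴹ_

  Mat : ℕ → Set c
  Mat n = Fin n → Fin n → Carrier

  _≈ᴹ_ : ∀ {n} → Mat n → Mat n → Set ℓ
  A ≈ᴹ B = ∀ i j → A i j ≈ B i j

  _+ᴹ_ _-ᴹ_ _*ᴹ_ : ∀ {n} → Mat n → Mat n → Mat n
  (A +ᴹ B) i j = A i j + B i j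
  (A -ᴹ B) i j = A i j + - B i j
  (A *ᴹ B) i j = Σ[ (λ k → A i k * B k j) ]

  -ᴹ_ : ∀ {n} → Mat n → Mat n
  (-ᴹ A) i j = - A i j

  _·ᴹ_ : ∀ {n} → Carrier → Mat n → Mat n
  (x ·ᴹ A) i j = x * A i j

  0ᴹ : ∀ {n} → Mat n
  0ᴹ _ _ = 0#

  1ᴹ : ∀ {n} → Mat n
  1ᴹ zero    zero    = 1#
  1ᴹ zero    (suc j) = 0#
  1ᴹ (suc i) zero    = 0#
  1ᴹ (suc i) (suc j) = 1ᴹ i j

  tr : ∀ {n} → Mat n → Carrier
  tr A = Σ[ (λ i → A i i) ]

  SkewSymmetric : ∀ {n} → Mat n → Set ℓ
  SkewSymmetric A = ∀ i j → A j i ≈ - A i j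

  J : ∀ m → Mat (m ℕ.* 2)
  J (suc m) zero          (suc zero)    = 1#
  J (suc m) (suc zero)    zero          = - 1#
  J (suc m) (suc (suc i)) (suc (suc j)) = J m i j
  J (suc m) _             _             = 0#

  -- The sign of a permutation, given by its list of values.
  sign : ∀ {n} → List (Fin n) → Carrier
  sign w = (- 1#) ^ inversions w

  term : ∀ {n} → Mat n → List (Fin n × Fin n) → Carrier
  term A P = sign (word P) * foldr _*_ 1# (map (uncurry A) P)

  -- For odd n there are no perfect matchings, so pf A is 0#.
  pf : ∀ {n} → Mat n → Carrier
  pf {n} A = foldr _+_ 0# (map (term A) (matchings (Vec.allFin n)))

  -- punchIn i ∘ punchIn (punchOut i≢j) is the increasing enumeration of
  -- the indices different from i and j.
  delete : ∀ {n} (i j : Fin (suc (suc n))) → i ≢ j → Mat (suc (suc n)) → Mat n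
  delete i j i≢j A k l = A (ι k) (ι l)
    where ι = punchIn i ∘ punchIn (punchOut i≢j)

  -- The parity of i + j does not depend on whether indices start at 0 or 1.
  Padj : ∀ {n} → Mat n → Mat n
  Padj {suc zero}    A i j = 0#
  Padj {suc (suc n)} A i j with <-cmp i j
  ... | tri< _ i≢j _ = (- 1#) ^ (toℕ i ℕ.+ toℕ j)         * pf (delete i j i≢j A)
  ... | tri≈ _ _   _ = 0#
  ... | tri> _ i≢j _ = (- 1#) ^ (toℕ i ℕ.+ toℕ j ℕ.+ 1) * pf (delete i j i≢j A)

------------------------------------------------------------------------
-- The polynomial ring in one variable

-- A polynomial is a list of coefficients, constant term first.  Equality
-- is coefficientwise, so that trailing zeros do not matter.

module Polynomial (R : RawRing c ℓ) where

  open RawRing R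

  coeff : List Carrier → ℕ → Carrier
  coeff []      _       = 0#
  coeff (a ∷ p) zero    = a
  coeff (a ∷ p) (suc k) = coeff p k

  addₚ : List Carrier → List Carrier → List Carrier
  addₚ []      q       = q
  addₚ (a ∷ p) []      = a ∷ p
  addₚ (a ∷ p) (b ∷ q) = a + b ∷ addₚ p q

  mulₚ : List Carrier → List Carrier → List Carrier
  mulₚ []      q = []
  mulₚ (a ∷ p) q = addₚ (map (a *_) q) (0# ∷ mulₚ p q)

  R[t] : RawRing c ℓ
  R[t] = record
    { Carrier = List Carrier
    ; _≈_     = λ p q → ∀ k → coeff p k ≈ coeff q k
    ; _+_     = addₚ
    ; _*_     = mulₚ
    ; -_      = map -_
    ; 0#      = []
    ; 1#      = [ 1# ]
    }

  C : Carrier → List Carrier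
  C a = [ a ]

  t : List Carrier
  t = 0# ∷ 1# ∷ []

------------------------------------------------------------------------
-- The recursion

module Recursion (R : CommutativeℚAlgebra c ℓ) where

  open CommutativeℚAlgebra R
  open Matrix rawRing

  module _ (m : ℕ) (A : Mat (m ℕ.* 2)) where

    -- N is only meant for positive indices; N 0 is a dummy value.
    mutual
      N : ℕ → Mat (m ℕ.* 2)
      N zero          = 0ᴹ
      N (suc zero)    = -ᴹ J m
      N (suc (suc k)) = J m *ᴹ (A *ᴹ N (suc k)) -ᴹ (coef (suc k) ·ᴹ J m)

      coef : ℕ → Carrier
      coef zero    = 1#
      coef (suc k) = tr (A *ᴹ N (suc k)) ÷ (+ (2 ℕ.* suc k))

------------------------------------------------------------------------
-- Arithmetic programs and their cost

-- The registers of a program are grouped into scalars and matrices.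

infixr 5 _⊞_

data Shape : Set where
  scalar : Shape
  mat    : ℕ → Shape
  _⊞_    : Shape → Shape → Shape

Reg : Shape → Set
Reg scalar  = ⊤
Reg (mat n) = Fin n × Fin n
Reg (s ⊞ t) = Reg s ⊎ Reg t

registers : (s : Shape) → List (Reg s)
registers scalar  = [ tt ]
registers (mat n) = cartesianProduct (allFin n) (allFin n)
registers (s ⊞ t) = map inj₁ (registers s) List.++ map inj₂ (registers t)

module Programs (R : CommutativeℚAlgebra c ℓ) where

  open CommutativeℚAlgebra R
  open Matrix rawRing

  data Op (I : Set) : Set c where
    copy        : I → Op I
    const       : Carrier → Op I
    add sub mul : I → I → Op I
    div         : I → (d : ℤ) → .{{ℤ.NonZero d}} → Op I

  -- A straight-line program, arranged in layers: a layer fills each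
  -- register of a new register file by one operation on the old one.

  infixr 4 _⨾_

  data Program : Shape → Shape → Set c where
    halt : ∀ {s} → Program s s
    _⨾_  : ∀ {s t u} → (Reg t → Op (Reg s)) → Program t u → Program s u

  eval : ∀ {I : Set} → (I → Carrier) → Op I → Carrier
  eval ρ (copy x)  = ρ x
  eval ρ (const r) = r
  eval ρ (add x y) = ρ x + ρ y
  eval ρ (sub x y) = ρ x - ρ y
  eval ρ (mul x y) = ρ x * ρ y
  eval ρ (div x d) = ρ x ÷ d

  run : ∀ {s t} → Program s t → (Reg s → Carrier) → (Reg t → Carrier)
  run halt    ρ = ρ
  run (f ⨾ p) ρ = run p (eval ρ ∘ f)

  -- Moving data and loading constants is free; an arithmetic operation
  -- costs 1.

  opCost : ∀ {I : Set} → Op I → ℕ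
  opCost (copy _)  = 0
  opCost (const _) = 0
  opCost (add _ _) = 1
  opCost (sub _ _) = 1
  opCost (mul _ _) = 1
  opCost (div _ _) = 1

  cost : ∀ {s t} → Program s t → ℕ
  cost halt              = 0
  cost (_⨾_ {t = t} f p) = sum (map (opCost ∘ f) (registers t)) ℕ.+ cost p

  opDivisors : ∀ {I : Set} → Op I → List ℤ
  opDivisors (div _ d) = [ d ]
  opDivisors _         = []

  divisors : ∀ {s t} → Program s t → List ℤ
  divisors halt              = []
  divisors (_⨾_ {t = t} f p) =
    concatMap (opDivisors ∘ f) (registers t) List.++ divisors p

  infixr 4 _then_

  _then_ : ∀ {s t u} → Program s t → Program t u → Program s u
  halt    then q = q
  (f ⨾ p) then q = f ⨾ (p then q)

  weaken : ∀ {I K : Set} → Op I → Op (K ⊎ I)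
  weaken (copy x)  = copy (inj₂ x)
  weaken (const r) = const r
  weaken (add x y) = add (inj₂ x) (inj₂ y)
  weaken (sub x y) = sub (inj₂ x) (inj₂ y)
  weaken (mul x y) = mul (inj₂ x) (inj₂ y)
  weaken (div x d) = div (inj₂ x) d

  -- Run a program on the right component, leaving the left one unchanged.
  keep : ∀ {r s t} → Program s t → Program (r ⊞ s) (r ⊞ t)
  keep halt    = halt
  keep (f ⨾ p) = Sum.[ (λ x → copy (inj₁ x)) , (λ y → weaken (f y)) ] ⨾ keep p

  record MatrixMultiplication : Set (c ⊔ ℓ) where
    field
      program : ∀ n → Program (mat n ⊞ mat n) (mat n)
      correct : ∀ n (A B : Mat n) →
        (λ i j → run (program n) Sum.[ uncurry A , uncurry B ] (i , j)) ≈ᴹ A *ᴹ B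

  -- The recursion as a program; the two matrix products in each step are
  -- done by the given matrix multiplication algorithm.

  module _ (mm : MatrixMultiplication) (m : ℕ) where

    open MatrixMultiplication mm

    M : Shape
    M = mat (m ℕ.* 2)

    -- A  ↦  A , N₁
    initialise : Program M (M ⊞ M)
    initialise = (λ { (inj₁ ij)      → copy ij
                    ; (inj₂ (i , j)) → const ((-ᴹ J m) i j) })
               ⨾ halt

    -- P , x  ↦  P , x + Pᵢᵢ
    addEntry : Fin (m ℕ.* 2) → Reg (M ⊞ scalar) → Op (Reg (M ⊞ scalar))
    addEntry i (inj₁ kl) = copy (inj₁ kl)
    addEntry i (inj₂ tt) = add (inj₂ tt) (inj₁ (i , i))

    -- P  ↦  P , tr P
    trace : Program M (M ⊞ scalar)
    trace = (λ { (inj₁ ij) → copy ij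
               ; (inj₂ tt) → const 0# })
          ⨾ foldr (λ i p → addEntry i ⨾ p) halt (allFin _)

    -- A , Nₖ₊₁  ↦  A , A Nₖ₊₁ , cₖ₊₁
    coefficient : ℕ → Program (M ⊞ M) (M ⊞ M ⊞ scalar)
    coefficient k
      = (λ { (inj₁ ij) → copy (inj₁ ij)
           ; (inj₂ x)  → copy x })
      ⨾ keep (program _)
      then keep trace
      then (λ { (inj₂ (inj₂ tt)) → div (inj₂ (inj₂ tt)) (+ (2 ℕ.* suc k))
              ; x                → copy x })
      ⨾ halt

    -- A , P , x  ↦  A , J P - x J
    next : Program (M ⊞ M ⊞ scalar) (M ⊞ M)
    next
      = loadJ
      ⨾ keep (keep (program _))
      then (λ { (inj₁ ij)        → copy (inj₁ ij)
              ; (inj₂ (inj₁ ij)) → mul (inj₂ (inj₁ (inj₁ tt))) (inj₂ (inj₁ (inj₂ ij)))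
              ; (inj₂ (inj₂ ij)) → copy (inj₂ (inj₂ ij)) })
      ⨾ subtract
      ⨾ halt
      where
      -- A , P , x  ↦  A , (x , J) , (J , P)
      loadJ : Reg (M ⊞ (scalar ⊞ M) ⊞ (M ⊞ M)) → Op (Reg (M ⊞ M ⊞ scalar))
      loadJ (inj₁ ij)                     = copy (inj₁ ij)
      loadJ (inj₂ (inj₁ (inj₁ tt)))       = copy (inj₂ (inj₂ tt))
      loadJ (inj₂ (inj₁ (inj₂ (i , j))))  = const (J m i j)
      loadJ (inj₂ (inj₂ (inj₁ (i , j))))  = const (J m i j)
      loadJ (inj₂ (inj₂ (inj₂ ij)))       = copy (inj₂ (inj₁ ij))

      -- A , X , Y  ↦  A , Y - X
      subtract : Reg (M ⊞ M) → Op (Reg (M ⊞ M ⊞ M))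
      subtract (inj₁ ij) = copy (inj₁ ij)
      subtract (inj₂ ij) = sub (inj₂ (inj₂ ij)) (inj₂ (inj₁ ij))

    -- A , N₁  ↦  A , Nₖ₊₁
    iterate : ℕ → Program (M ⊞ M) (M ⊞ M)
    iterate zero    = halt
    iterate (suc k) = iterate k then coefficient k then next

  -- A  ↦  cₘ
  pfaffianProgram : MatrixMultiplication → ∀ m → Program (mat (m ℕ.* 2)) scalar
  pfaffianProgram mm zero    = (λ _ → const 1#) ⨾ halt
  pfaffianProgram mm (suc k) =
    initialise mm (suc k)
    then iterate mm (suc k) k
    then coefficient mm (suc k) k
    then (λ _ → copy (inj₂ (inj₂ tt)))
    ⨾ halt

------------------------------------------------------------------------
-- Real exponents

-- Real numbers as (located) Dedekind cuts; β ≥ 2 and β + 1 are all that is used.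
record ℝ : Set₁ where
  field
    L U       : ℚ → Set
    L-inhab   : ∃[ q ] L q
    U-inhab   : ∃[ q ] U q
    L-lower   : ∀ {p q} → p ℚ.< q → L q → L p
    L-open    : ∀ {p} → L p → ∃[ q ] p ℚ.< q × L q
    U-upper   : ∀ {p q} → p ℚ.< q → U p → U q
    U-open    : ∀ {q} → U q → ∃[ p ] p ℚ.< q × U p
    disjoint  : ∀ {q} → L q → U q → ⊥
    located   : ∀ {p q} → p ℚ.< q → L p ⊎ U q

_≤ᴿ_ : ℚ → ℝ → Set
p ≤ᴿ x = ∀ {q} → ℝ.U x q → p ℚ.< q

_+1 : ℝ → ℝ
x +1 = record
  { L        = λ q → L (q ℚ.- ℚ.1ℚ)
  ; U        = λ q → U (q ℚ.- ℚ.1ℚ)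
  ; L-inhab  = let (q , l) = L-inhab in q ℚ.+ ℚ.1ℚ , subst L (sym (p+1-1 q)) l
  ; U-inhab  = let (q , u) = U-inhab in q ℚ.+ ℚ.1ℚ , subst U (sym (p+1-1 q)) u
  ; L-lower  = λ p<q → L-lower (shift p<q)
  ; L-open   = λ {p} l → let (q , p-1<q , l′) = L-open l in
      q ℚ.+ ℚ.1ℚ
    , subst (ℚ._< q ℚ.+ ℚ.1ℚ) (p-1+1 p) (ℚ.+-monoˡ-< ℚ.1ℚ p-1<q)
    , subst L (sym (p+1-1 q)) l′
  ; U-upper  = λ p<q → U-upper (shift p<q)
  ; U-open   = λ {q} u → let (p , p<q-1 , u′) = U-open u in
      p ℚ.+ ℚ.1ℚ
    , subst (p ℚ.+ ℚ.1ℚ ℚ.<_) (p-1+1 q) (ℚ.+-monoˡ-< ℚ.1ℚ p<q-1)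
    , subst U (sym (p+1-1 p)) u′
  ; disjoint = disjoint
  ; located  = λ p<q → located (shift p<q)
  }
  where
  open ℝ x
  shift : ∀ {p q} → p ℚ.< q → p ℚ.- ℚ.1ℚ ℚ.< q ℚ.- ℚ.1ℚ
  shift = ℚ.+-monoˡ-< (ℚ.- ℚ.1ℚ)
  p+1-1 : ∀ p → p ℚ.+ ℚ.1ℚ ℚ.- ℚ.1ℚ ≡ p
  p+1-1 p = trans (ℚ.+-assoc p ℚ.1ℚ (ℚ.- ℚ.1ℚ)) (ℚ.+-identityʳ p)
  p-1+1 : ∀ p → p ℚ.- ℚ.1ℚ ℚ.+ ℚ.1ℚ ≡ p
  p-1+1 p = trans (ℚ.+-assoc p (ℚ.- ℚ.1ℚ) ℚ.1ℚ) (ℚ.+-identityʳ p)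

-- f(k) = O(s(k)^β) for an exponent β ≥ 0 and a size function s: since
-- n^β is the infimum of n^(a/b) over the rationals a/b > β, the bound
-- f ≤ C n^β says that f^b ≤ C^b n^a for all of these.
IsO : (f s : ℕ → ℕ) → ℝ → Set
IsO f s β = ∃[ C ] ∃[ n₀ ] ∀ k → n₀ ℕ.≤ s k →
  ∀ a b .{{_ : ℕ.NonZero b}} → ℝ.U β (+ a ℚ./ b) →
  f k ℕ.^ b ℕ.≤ C ℕ.^ b ℕ.* s k ℕ.^ a

------------------------------------------------------------------------
-- Everything over a fixed algebra; names with ᵗ refer to R[t]

module Over (R : CommutativeℚAlgebra c ℓ) where

  open CommutativeℚAlgebra R public using (rawRing; _≈_)
  open Matrix rawRing public
  open Polynomial rawRing public using (R[t]; C; t)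
  open RawRing R[t] public using () renaming (_≈_ to _≈ᵗ_; _*_ to _*ᵗ_)
  open Matrix R[t] public using () renaming
    (_+ᴹ_ to _+ᴹᵗ_; _·ᴹ_ to _·ᴹᵗ_; J to Jᵗ; pf to pfᵗ; _^_ to _^ᵗ_; Σ[_] to Σᵗ[_])
  open Recursion R public
  open Programs R public
  open MatrixMultiplication public using (program)

  Cᴹ : ∀ {n} → Mat n → Matrix.Mat R[t] n
  Cᴹ A i j = C (A i j)

-- Pfaffians are studied as functions of lists of indices. The contraction of such a function G
-- with a covector f, ys ↦ Σₖ (-1)ᵏ f(yₖ) G(ys without yₖ), is anticommutative in f, so that
-- expansion along the first row defines an alternating function Pf. It is the sum over perfect
-- matchings because pairing the first index with the k-th of the others creates k inversions.
-- For B = tJ + A over R[t], alternation gives B · Padj B = pf B · I. Contraction along all pairs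
-- of entries with weights J commutes with contractions; therefore it is the t-derivative of Pf,
-- which gives 2 (pf B)′ = tr (J · Padj B). Let cₖ and Nₖ be the coefficients of t^(m-k) in pf B
-- and in Padj B. Comparison of coefficients yields J Nₖ₊₁ + A Nₖ = cₖ I, and, together with the
-- formula for the derivative, tr (A Nₖ) = 2m cₖ - 2(m-k) cₖ = 2k cₖ. This is the recursion.

module Submission where

open import Defs
open import Algebra.Bundles using (CommutativeRing)
open import Algebra.Morphism.Structures using (module RingMorphisms)
open import Data.Empty using (⊥-elim)
open import Data.Fin.Base as Fin using (Fin; zero; suc; toℕ; punchIn; punchOut)
open import Data.Fin.Properties as Fin using (<-cmp; _≟_; punchIn-punchOut)
open import Data.Integer.Base as ℤ using (ℤ)
import Data.Integer.Properties as ℤ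
open import Data.List.Base as List using (List; []; _∷_; [_]; _++_)
open import Data.List.Membership.Propositional using (_∈_)
open import Data.List.Properties as List using (filter-accept; filter-++; filter-none; map-cong)
open import Data.List.Relation.Unary.All as All using (All; []; _∷_)
import Data.List.Relation.Unary.All.Properties as All
open import Data.Nat.Base as ℕ using (ℕ; zero; suc; NonZero; _∸_; z<s; s<s; s<s⁻¹)
open import Data.Nat.ListAction using (sum)
open import Data.Nat.ListAction.Properties using (sum-++)
import Data.Nat.Properties as ℕ
open import Data.Nat.Solver using (module +-*-Solver)
open import Data.Product.Base using (_×_; _,_; ∃-syntax; uncurry)
open import Data.Rational.Base as ℚ using (1ℚ; 1/_)
open import Data.Rational.Literals using (fromℤ)
import Data.Rational.Properties as ℚ
import Data.Rational.Unnormalised.Base as ℚᵘ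
import Data.Rational.Unnormalised.Properties as ℚᵘ
open import Data.Sum.Base as Sum using (_⊎_; inj₁; inj₂)
open import Data.Unit.Base using (tt)
open import Data.Vec.Base as Vec using (Vec; []; _∷_; lookup; removeAt; toList)
open import Data.Vec.Properties as Vec using (lookup∘tabulate; tabulate-allFin; toList-map; tabulate-cong)
open import Data.Vec.Relation.Unary.All as VecAll using ([]; _∷_)
import Data.Vec.Relation.Unary.All.Properties as VecAll
open import Data.Vec.Relation.Unary.AllPairs using (AllPairs; []; _∷_)
open import Function.Base using (_∘_; id) renaming (const to constantly)
open import Relation.Binary.Bundles using (Setoid)
open import Relation.Binary.Definitions using (tri<; tri≈; tri>)
open import Relation.Binary.PropositionalEquality as ≡ using (_≡_; _≢_; _≗_)
open import Relation.Nullary.Decidable using (yes; no)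
open import Algebra.Properties.CommutativeSemigroup ℕ.+-commutativeSemigroup
  using () renaming (x∙yz≈y∙xz to m+[n+o]≡n+[m+o])

-- On lists, a Pfaffian minor is the same function `Pf B` at a shorter list, so the identities
-- become inductions on lists, without matrices of varying size. These inductions live over an
-- arbitrary commutative ring, where 2 may be a zero divisor; hence vanishing on repetitions is
-- carried along next to the sign change under swaps, and it rests on a zero diagonal. Rational
-- scalars serve to obtain this diagonal from skew-symmetry and to divide by 2k. The recursion
-- descends in powers of t. Since J² = -I, the relation J Nₖ₊₁ + A Nₖ = cₖ I is solved for Nₖ₊₁
-- without dividing by entries of A. At the top, pf J = 1 gives c₀ = 1, and Padj B has degree below
-- m, so the relation for k = 0 reads J N₁ = I, that is N₁ = -J. At the bottom, t = 0, pf B and Padj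
-- B become pf A and Padj A. For the cost, each of the m rounds takes two matrix products and O(n²)
-- further operations; β ≥ 2 absorbs the latter, and the number of rounds accounts for the exponent
-- β + 1.

-- Signed sums over lists and alternating functions.

module AlternatingSums {c ℓ} (S : CommutativeRing c ℓ) where

  open CommutativeRing S hiding (zero)
  open import Algebra.Properties.Ring ring
  open import Algebra.Properties.AbelianGroup +-abelianGroup using (⁻¹-∙-comm)
  open import Algebra.Properties.CommutativeSemigroup +-commutativeSemigroup
    using (interchange; x∙yz≈y∙xz)
  open import Algebra.Properties.CommutativeSemigroup *-commutativeSemigroup
    using () renaming (x∙yz≈y∙xz to x*yz≈y*xz)
  open import Relation.Binary.Reasoning.Setoid setoid

  private
    variable
      X Y : Set

  -[x+y] : ∀ x y → - (x + y) ≈ - x - y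
  -[x+y] x y = sym (⁻¹-∙-comm x y)

  x-[y-z] : ∀ x y z → x - (y - z) ≈ x - y + z
  x-[y-z] x y z = begin
    x - (y - z)       ≈⟨ +-congˡ (-[x+y] y (- z)) ⟩
    x + (- y - - z)   ≈⟨ +-congˡ (+-congˡ (-‿involutive z)) ⟩
    x + (- y + z)     ≈⟨ +-assoc x (- y) z ⟨
    x - y + z         ∎

  x-[x-y] : ∀ x y → x - (x - y) ≈ y
  x-[x-y] x y = begin
    x - (x - y)   ≈⟨ x-[y-z] x x y ⟩
    x - x + y     ≈⟨ +-congʳ (-‿inverseʳ x) ⟩
    0# + y        ≈⟨ +-identityˡ y ⟩
    y             ∎

  x-0# : ∀ x → x - 0# ≈ x
  x-0# x = trans (+-congˡ -0#≈0#) (+-identityʳ x)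

  -- The common step of the sign changes below: `a` and `b` are the two terms that trade places, `u`
  -- and `v` the remainders, whose sign change is already known.
  swap-- : ∀ a b {u v} → u ≈ - v → a - (b - u) ≈ - (b - (a - v))
  swap-- a b {u} {v} u≈-v = begin
    a - (b - u)         ≈⟨ +-congˡ (-‿cong (+-congˡ (-‿cong u≈-v))) ⟩
    a - (b - - v)       ≈⟨ x-[y-z] a b (- v) ⟩
    a - b - v           ≈⟨ +-assoc a (- b) (- v) ⟩
    a + (- b - v)       ≈⟨ x∙yz≈y∙xz a (- b) (- v) ⟩
    - b + (a - v)       ≈⟨ +-congˡ (-‿involutive (a - v)) ⟨
    - b - - (a - v)     ≈⟨ -[x+y] b (- (a - v)) ⟨
    - (b - (a - v))     ∎

  -- `H` receives an entry together with the list without it. Entries already passed are put back by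
  -- extending `H`, and the nested subtractions produce the signs (-1)ᵏ.
  altSum : (X → List X → Carrier) → List X → Carrier
  altSum H []       = 0#
  altSum H (y ∷ ys) = H y ys - altSum (λ z zs → H z (y ∷ zs)) ys

  altSum-cong : {H H′ : X → List X → Carrier} → (∀ z zs → H z zs ≈ H′ z zs) →
                ∀ ys → altSum H ys ≈ altSum H′ ys
  altSum-cong eq []       = refl
  altSum-cong eq (y ∷ ys) =
    +-cong (eq y ys) (-‿cong (altSum-cong (λ z zs → eq z (y ∷ zs)) ys))

  altSum-0 : ∀ (ys : List X) → altSum (λ _ _ → 0#) ys ≈ 0#
  altSum-0 []       = refl
  altSum-0 (y ∷ ys) = trans (+-congˡ (-‿cong (altSum-0 ys))) (x-0# 0#)

  altSum-+ : ∀ (H H′ : X → List X → Carrier) ys →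
             altSum (λ z zs → H z zs + H′ z zs) ys ≈ altSum H ys + altSum H′ ys
  altSum-+ H H′ []       = sym (+-identityˡ 0#)
  altSum-+ H H′ (y ∷ ys) = begin
    H y ys + H′ y ys - altSum (λ z zs → H z (y ∷ zs) + H′ z (y ∷ zs)) ys
      ≈⟨ +-congˡ (-‿cong (altSum-+ _ _ ys)) ⟩
    H y ys + H′ y ys - (altSum _ ys + altSum _ ys)
      ≈⟨ +-congˡ (-[x+y] _ _) ⟩
    H y ys + H′ y ys + (- altSum _ ys - altSum _ ys)
      ≈⟨ interchange _ _ _ _ ⟩
    altSum H (y ∷ ys) + altSum H′ (y ∷ ys) ∎

  altSum-* : ∀ x (H : X → List X → Carrier) ys →
             altSum (λ z zs → x * H z zs) ys ≈ x * altSum H ys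
  altSum-* x H []       = sym (zeroʳ x)
  altSum-* x H (y ∷ ys) = begin
    x * H y ys - altSum (λ z zs → x * H z (y ∷ zs)) ys ≈⟨ +-congˡ (-‿cong (altSum-* x _ ys)) ⟩
    x * H y ys - x * altSum _ ys                       ≈⟨ x[y-z]≈xy-xz x _ _ ⟨
    x * altSum H (y ∷ ys)                              ∎

  altSum-neg : ∀ (H : X → List X → Carrier) ys →
               altSum (λ z zs → - H z zs) ys ≈ - altSum H ys
  altSum-neg H []       = sym -0#≈0#
  altSum-neg H (y ∷ ys) =
    trans (+-congˡ (-‿cong (altSum-neg _ ys))) (sym (-[x+y] _ _))

  altSum-map : ∀ (g : X → Y) (H : Y → List Y → Carrier) ys →
               altSum H (List.map g ys) ≈ altSum (λ z zs → H (g z) (List.map g zs)) ys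
  altSum-map g H []       = refl
  altSum-map g H (y ∷ ys) = +-congˡ (-‿cong (altSum-map g _ ys))

  contract : (X → Carrier) → (List X → Carrier) → List X → Carrier
  contract f G = altSum (λ z zs → f z * G zs)

  contract-cong : ∀ {f f′ : X → Carrier} {G G′ : List X → Carrier} →
                  (∀ z → f z ≈ f′ z) → (∀ zs → G zs ≈ G′ zs) →
                  ∀ ys → contract f G ys ≈ contract f′ G′ ys
  contract-cong f≈ G≈ = altSum-cong (λ z zs → *-cong (f≈ z) (G≈ zs))

  contract-congʳ : ∀ (f : X → Carrier) {G G′ : List X → Carrier} → (∀ zs → G zs ≈ G′ zs) →
                   ∀ ys → contract f G ys ≈ contract f G′ ys
  contract-congʳ f = contract-cong (λ _ → refl)

  contract-+ : ∀ f (G H : List X → Carrier) ys →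
               contract f (λ zs → G zs + H zs) ys ≈ contract f G ys + contract f H ys
  contract-+ f G H ys =
    trans (altSum-cong (λ z zs → distribˡ (f z) (G zs) (H zs)) ys) (altSum-+ _ _ ys)

  contract-neg : ∀ f (G : List X → Carrier) ys →
                 contract f (λ zs → - G zs) ys ≈ - contract f G ys
  contract-neg f G ys =
    trans (altSum-cong (λ z zs → sym (-‿distribʳ-* (f z) (G zs))) ys) (altSum-neg _ ys)

  contract-* : ∀ f x (G : List X → Carrier) ys →
               contract f (λ zs → x * G zs) ys ≈ x * contract f G ys
  contract-* f x G ys =
    trans (altSum-cong (λ z zs → x*yz≈y*xz (f z) x (G zs)) ys) (altSum-* x _ ys)

  contract-0 : ∀ f {G : List X → Carrier} → (∀ zs → G zs ≈ 0#) → ∀ ys → contract f G ys ≈ 0#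
  contract-0 f G≈0 ys =
    trans (altSum-cong (λ z zs → trans (*-congˡ (G≈0 zs)) (zeroʳ (f z))) ys) (altSum-0 ys)

  -- Linearity in exactly the shape that a contraction takes when it is unfolded at a nonempty list.
  contract-*- : ∀ f x (G H : List X → Carrier) ys →
    contract f (λ zs → x * G zs - H zs) ys ≈ x * contract f G ys - contract f H ys
  contract-*- f x G H ys =
    trans (contract-+ f _ _ ys) (+-cong (contract-* f x G ys) (contract-neg f H ys))

  -- Removing the earlier of two entries first moves the later one by one position, removing the
  -- later first moves nothing; so the two orders differ by a sign. The induction distinguishes
  -- whether the head is taken by `f`, by `g` or by neither.
  contract-anticomm : ∀ f g (G : List X → Carrier) ys →
                      contract f (contract g G) ys ≈ - contract g (contract f G) ys
  contract-anticomm f g G []       = sym -0#≈0#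
  contract-anticomm f g G (y ∷ ys) = begin
    f y * contract g G ys - contract f (λ zs → g y * G zs - contract g G′ zs) ys
      ≈⟨ +-congˡ (-‿cong (contract-*- f (g y) G _ ys)) ⟩
    f y * contract g G ys - (g y * contract f G ys - contract f (contract g G′) ys)
      ≈⟨ swap-- _ _ (contract-anticomm f g G′ ys) ⟩
    - (g y * contract f G ys - (f y * contract g G ys - contract g (contract f G′) ys))
      ≈⟨ -‿cong (+-congˡ (-‿cong (contract-*- g (f y) G _ ys))) ⟨
    - (g y * contract f G ys - contract g (λ zs → f y * G zs - contract f G′ zs) ys)
      ∎
    where G′ = λ zs → G (y ∷ zs)

  -- Anticommutativity with `g = f` would only show that twice the value vanishes. Here the two
  -- terms that take the head cancel directly.
  contract-square : ∀ f (G : List X → Carrier) ys → contract f (contract f G) ys ≈ 0#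
  contract-square f G []       = refl
  contract-square f G (y ∷ ys) = begin
    f y * contract f G ys - contract f (λ zs → f y * G zs - contract f G′ zs) ys
      ≈⟨ +-congˡ (-‿cong (contract-*- f (f y) G _ ys)) ⟩
    f y * contract f G ys - (f y * contract f G ys - contract f (contract f G′) ys)
      ≈⟨ x-[x-y] _ _ ⟩
    contract f (contract f G′) ys
      ≈⟨ contract-square f G′ ys ⟩
    0# ∎
    where G′ = λ zs → G (y ∷ zs)

  -- Both laws concern neighbouring entries, which suffices for moving entries around. Over a
  -- general ring `swap` alone yields only that twice the value at a repetition vanishes, whence the
  -- second field.
  record Alternating (G : List X → Carrier) : Set ℓ where
    field
      swap   : ∀ us x y vs → G (us ++ x ∷ y ∷ vs) ≈ - G (us ++ y ∷ x ∷ vs)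
      repeat : ∀ us x vs → G (us ++ x ∷ x ∷ vs) ≈ 0#

  open Alternating

  alternating-∷ : ∀ {G : List X → Carrier} → Alternating G → ∀ u → Alternating (λ zs → G (u ∷ zs))
  alternating-∷ alt u .swap us   = alt .swap (u ∷ us)
  alternating-∷ alt u .repeat us = alt .repeat (u ∷ us)

  -- The terms removing one of the two neighbours are exchanged (or cancel, if the neighbours are
  -- equal), their signs being opposite; all other terms keep both neighbours and inherit the law
  -- from `G`.
  contract-alternating : ∀ f {G : List X → Carrier} → Alternating G → Alternating (contract f G)
  contract-alternating f alt .swap [] x y vs =
    swap-- _ _ (trans (contract-congʳ f (alt .swap [] x y) vs) (contract-neg f _ vs))
  contract-alternating f alt .swap (u ∷ us) x y vs = trans
    (+-cong (trans (*-congˡ (alt .swap us x y vs)) (sym (-‿distribʳ-* _ _)))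
            (-‿cong (contract-alternating f (alternating-∷ alt u) .swap us x y vs)))
    (sym (-[x+y] _ _))
  contract-alternating f alt .repeat [] x vs = trans
    (x-[x-y] _ _) (contract-0 f (alt .repeat [] x) vs)
  contract-alternating f alt .repeat (u ∷ us) x vs = trans
    (+-cong (trans (*-congˡ (alt .repeat us x vs)) (zeroʳ _))
            (-‿cong (contract-alternating f (alternating-∷ alt u) .repeat us x vs)))
    (x-0# 0#)

  -- m counts pairs of indices: the value is 0# on all lists of length other than 2m.

  Pf : (X → X → Carrier) → ℕ → List X → Carrier
  Pf B zero    []       = 1#
  Pf B zero    (x ∷ xs) = 0#
  Pf B (suc m) []       = 0#
  Pf B (suc m) (x ∷ xs) = contract (B x) (Pf B m) xs

  Pf-cong : ∀ {B B′ : X → X → Carrier} → (∀ x y → B x y ≈ B′ x y) →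
            ∀ m xs → Pf B m xs ≈ Pf B′ m xs
  Pf-cong B≈ zero    []       = refl
  Pf-cong B≈ zero    (x ∷ xs) = refl
  Pf-cong B≈ (suc m) []       = refl
  Pf-cong B≈ (suc m) (x ∷ xs) = contract-cong (B≈ x) (Pf-cong B≈ m) xs

  Pf-map : ∀ (B : Y → Y → Carrier) (g : X → Y) m xs →
           Pf B m (List.map g xs) ≈ Pf (λ x y → B (g x) (g y)) m xs
  Pf-map B g zero    []       = refl
  Pf-map B g zero    (x ∷ xs) = refl
  Pf-map B g (suc m) []       = refl
  Pf-map B g (suc m) (x ∷ xs) =
    trans (altSum-map g _ xs) (contract-congʳ (λ z → B (g x) (g z)) (Pf-map B g m) xs)

  module _ {B : X → X → Carrier} (skew : ∀ x y → B y x ≈ - B x y) (diag : ∀ x → B x x ≈ 0#) where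

    -- Behind the first index the laws are inherited by contraction. At the front two rows are
    -- expanded: the term pairing `x` with `y` changes sign by skewness, or vanishes by `diag`, and
    -- the rest is a double contraction, governed by `contract-anticomm` and `contract-square`. For
    -- a single pair this rest is zero, since `Pf B 0` vanishes on nonempty lists.
    Pf-alternating : ∀ m → Alternating (Pf B m)
    Pf-alternating zero .swap []       x y vs = sym -0#≈0#
    Pf-alternating zero .swap (u ∷ us) x y vs = sym -0#≈0#
    Pf-alternating zero .repeat []       x vs = refl
    Pf-alternating zero .repeat (u ∷ us) x vs = refl
    Pf-alternating (suc m) .swap (u ∷ us) = contract-alternating (B u) (Pf-alternating m) .swap us
    Pf-alternating (suc m) .repeat (u ∷ us) = contract-alternating (B u) (Pf-alternating m) .repeat us
    Pf-alternating (suc m) .repeat [] x vs = begin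
      B x x * Pf B m vs - contract (B x) (λ zs → Pf B m (x ∷ zs)) vs
        ≈⟨ +-cong (trans (*-congʳ (diag x)) (zeroˡ _)) (-‿cong (lemma m)) ⟩
      0# - 0#
        ≈⟨ x-0# 0# ⟩
      0# ∎
      where
      lemma : ∀ m → contract (B x) (λ zs → Pf B m (x ∷ zs)) vs ≈ 0#
      lemma zero    = contract-0 (B x) (λ _ → refl) vs
      lemma (suc m) = contract-square (B x) _ vs
    Pf-alternating (suc m) .swap [] x y vs = begin
      B x y * Pf B m vs - contract (B x) (λ zs → Pf B m (y ∷ zs)) vs
        ≈⟨ +-cong (*-congʳ (skew y x)) (-‿cong (lemma m)) ⟩
      - B y x * Pf B m vs - - contract (B y) (λ zs → Pf B m (x ∷ zs)) vs
        ≈⟨ +-congʳ (sym (-‿distribˡ-* _ _)) ⟩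
      - (B y x * Pf B m vs) - - contract (B y) (λ zs → Pf B m (x ∷ zs)) vs
        ≈⟨ -[x+y] _ _ ⟨
      - (B y x * Pf B m vs - contract (B y) (λ zs → Pf B m (x ∷ zs)) vs) ∎
      where
      lemma : ∀ m → contract (B x) (λ zs → Pf B m (y ∷ zs)) vs ≈
                    - contract (B y) (λ zs → Pf B m (x ∷ zs)) vs
      lemma zero    = trans (contract-0 (B x) (λ _ → refl) vs)
                            (sym (trans (-‿cong (contract-0 (B y) (λ _ → refl) vs)) -0#≈0#))
      lemma (suc m) = contract-anticomm (B x) (B y) _ vs

  -- The sum over i < j of (-1)^(j-i-1) E yᵢ yⱼ times `G` at the list without both. The second
  -- summand carries no sign because a pair of removed entries passes the head twice.
  contract₂ : (X → X → Carrier) → (List X → Carrier) → List X → Carrier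
  contract₂ E G []       = 0#
  contract₂ E G (y ∷ ys) = contract (E y) G ys + contract₂ E (λ zs → G (y ∷ zs)) ys

  contract₂-cong : ∀ E {G G′ : List X → Carrier} → (∀ zs → G zs ≈ G′ zs) →
                   ∀ ys → contract₂ E G ys ≈ contract₂ E G′ ys
  contract₂-cong E G≈ []       = refl
  contract₂-cong E G≈ (y ∷ ys) =
    +-cong (contract-congʳ (E y) G≈ ys) (contract₂-cong E (λ zs → G≈ (y ∷ zs)) ys)

  contract₂-0 : ∀ E {G : List X → Carrier} → (∀ zs → G zs ≈ 0#) → ∀ ys → contract₂ E G ys ≈ 0#
  contract₂-0 E G≈0 []       = refl
  contract₂-0 E G≈0 (y ∷ ys) = trans
    (+-cong (contract-0 (E y) G≈0 ys) (contract₂-0 E (λ zs → G≈0 (y ∷ zs)) ys)) (+-identityˡ 0#)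

  contract₂-*- : ∀ E x (G H : List X → Carrier) ys →
    contract₂ E (λ zs → x * G zs - H zs) ys ≈ x * contract₂ E G ys - contract₂ E H ys
  contract₂-*- E x G H []       = sym (trans (x-0# _) (zeroʳ x))
  contract₂-*- E x G H (y ∷ ys) = begin
    contract (E y) (λ zs → x * G zs - H zs) ys
      + contract₂ E (λ zs → x * G (y ∷ zs) - H (y ∷ zs)) ys
      ≈⟨ +-cong (contract-*- (E y) x G H ys) (contract₂-*- E x _ _ ys) ⟩
    (x * contract (E y) G ys - contract (E y) H ys)
      + (x * contract₂ E _ ys - contract₂ E _ ys)
      ≈⟨ interchange _ _ _ _ ⟩
    (x * contract (E y) G ys + x * contract₂ E _ ys)
      + (- contract (E y) H ys - contract₂ E _ ys)
      ≈⟨ +-cong (distribˡ x _ _) (-[x+y] _ _) ⟨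
    x * contract₂ E G (y ∷ ys) - contract₂ E H (y ∷ ys) ∎

  -- Pairs are even, single entries odd. When the head belongs to the pair, anticommutation
  -- contributes a sign that cancels the one with which `contract f` passes the head.
  contract-contract₂ : ∀ f E (G : List X → Carrier) ys →
    contract f (contract₂ E G) ys ≈ contract₂ E (contract f G) ys
  contract-contract₂ f E G []       = refl
  contract-contract₂ f E G (y ∷ ys) = begin
    f y * contract₂ E G ys - contract f (λ zs → contract (E y) G zs + contract₂ E G′ zs) ys
      ≈⟨ +-congˡ (-‿cong (contract-+ f _ _ ys)) ⟩
    f y * contract₂ E G ys - (contract f (contract (E y) G) ys + contract f (contract₂ E G′) ys)
      ≈⟨ +-congˡ (-‿cong (+-cong (contract-anticomm f (E y) G ys) (contract-contract₂ f E G′ ys))) ⟩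
    f y * contract₂ E G ys - (- contract (E y) (contract f G) ys + contract₂ E (contract f G′) ys)
      ≈⟨ +-congˡ (trans (-[x+y] _ _) (+-congʳ (-‿involutive _))) ⟩
    f y * contract₂ E G ys + (contract (E y) (contract f G) ys - contract₂ E (contract f G′) ys)
      ≈⟨ x∙yz≈y∙xz _ _ _ ⟩
    contract (E y) (contract f G) ys + (f y * contract₂ E G ys - contract₂ E (contract f G′) ys)
      ≈⟨ +-congˡ (contract₂-*- E (f y) G _ ys) ⟨
    contract (E y) (contract f G) ys + contract₂ E (λ zs → f y * G zs - contract f G′ zs) ys ∎
    where G′ = λ zs → G (y ∷ zs)

  -- Every pair of entries is met once from either side.
  altSum-contract : ∀ {E : X → X → Carrier} → (∀ x y → E y x ≈ - E x y) →
    ∀ (G : List X → Carrier) ys →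
    altSum (λ z zs → contract (E z) G zs) ys ≈ contract₂ E G ys + contract₂ E G ys
  altSum-contract {E = E} skew G []       = sym (+-identityˡ 0#)
  altSum-contract {E = E} skew G (y ∷ ys) = begin
    u - altSum (λ z zs → E z y * G zs - contract (E z) G′ zs) ys
      ≈⟨ +-congˡ (-‿cong (altSum-+ _ _ ys)) ⟩
    u - (altSum (λ z zs → E z y * G zs) ys + altSum (λ z zs → - contract (E z) G′ zs) ys)
      ≈⟨ +-congˡ (-‿cong (+-cong
           (altSum-cong (λ z zs → trans (*-congʳ (skew y z)) (sym (-‿distribˡ-* _ _))) ys)
           (altSum-neg _ ys))) ⟩
    u - (altSum (λ z zs → - (E y z * G zs)) ys - altSum (λ z zs → contract (E z) G′ zs) ys)
      ≈⟨ +-congˡ (-‿cong (+-cong (altSum-neg _ ys) (-‿cong (altSum-contract skew G′ ys)))) ⟩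
    u - (- u - (v + v))
      ≈⟨ x-[y-z] u (- u) (v + v) ⟩
    u - - u + (v + v)
      ≈⟨ +-congʳ (+-congˡ (-‿involutive u)) ⟩
    u + u + (v + v)
      ≈⟨ interchange _ _ _ _ ⟩
    (u + v) + (u + v) ∎
    where
    G′ = λ zs → G (y ∷ zs)
    u = contract (E y) G ys
    v = contract₂ E G′ ys

-- Deleting entries

-- Index lists are given by functions on `Fin n`, so that deleting an entry is precomposition with
-- `punchIn`.
values : ∀ {X : Set} {n} → (Fin n → X) → List X
values h = toList (Vec.tabulate h)

values-cong : ∀ {X : Set} {n} {h h′ : Fin n → X} → h ≗ h′ → values h ≡ values h′
values-cong h≗h′ = ≡.cong toList (tabulate-cong h≗h′)

values-map : ∀ {X : Set} {n} (h : Fin n → X) → List.map h (values id) ≡ values h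
values-map h = ≡.trans (≡.sym (toList-map h _)) (≡.cong toList (≡.sym (tabulate-allFin h)))

removeAt-tabulate : ∀ {X : Set} {n} (h : Fin (suc n) → X) k →
                    removeAt (Vec.tabulate h) k ≡ Vec.tabulate (h ∘ punchIn k)
removeAt-tabulate         h zero    = ≡.refl
removeAt-tabulate {n = suc n} h (suc k) = ≡.cong (h zero ∷_) (removeAt-tabulate (h ∘ suc) k)

-- Both sides enumerate, in increasing order, the indices other than `k` and `punchIn k l`. `delete`
-- removes the row index first, whereas the expansion along column `k` removes `k` first.
punchIn-swap : ∀ {n} (k : Fin (suc (suc n))) l (j≢k : punchIn k l ≢ k) x →
               punchIn (punchIn k l) (punchIn (punchOut j≢k) x) ≡ punchIn k (punchIn l x)
punchIn-swap zero    l       j≢k x       = ≡.refl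
punchIn-swap (suc k) zero    j≢k x       = ≡.refl
punchIn-swap (suc k) (suc l) j≢k zero    = ≡.refl
punchIn-swap (suc k) (suc l) j≢k (suc x) = ≡.cong suc (punchIn-swap k l (j≢k ∘ ≡.cong suc) x)

toℕ-punchIn-< : ∀ {n} (k : Fin (suc n)) l → punchIn k l Fin.< k → toℕ (punchIn k l) ≡ toℕ l
toℕ-punchIn-< (suc k) zero    _   = ≡.refl
toℕ-punchIn-< (suc k) (suc l) j<k = ≡.cong suc (toℕ-punchIn-< k l (s<s⁻¹ j<k))

toℕ-punchIn-> : ∀ {n} (k : Fin (suc n)) l → k Fin.< punchIn k l → toℕ (punchIn k l) ≡ suc (toℕ l)
toℕ-punchIn-> zero    l       _   = ≡.refl
toℕ-punchIn-> (suc k) (suc l) k<j = ≡.cong suc (toℕ-punchIn-> k l (s<s⁻¹ k<j))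

all-removeAt : ∀ {X : Set} {P : X → Set} {n} {xs : Vec X (suc n)} →
               VecAll.All P xs → ∀ k → VecAll.All P (removeAt xs k)
all-removeAt (p ∷ ps)        zero    = ps
all-removeAt (p ∷ ps@(_ ∷ _)) (suc k) = p ∷ all-removeAt ps k

allPairs-removeAt : ∀ {X : Set} {R : X → X → Set} {n} {xs : Vec X (suc n)} →
                    AllPairs R xs → ∀ k → AllPairs R (removeAt xs k)
allPairs-removeAt (p ∷ ps)        zero    = ps
allPairs-removeAt (p ∷ ps@(_ ∷ _)) (suc k) = all-removeAt p k ∷ allPairs-removeAt ps k

allPairs-tabulate : ∀ {X : Set} {R : X → X → Set} {n} {h : Fin n → X} →
                    (∀ {i j} → i Fin.< j → R (h i) (h j)) → AllPairs R (Vec.tabulate h)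
allPairs-tabulate {n = zero}  mono = []
allPairs-tabulate {n = suc n} mono =
  VecAll.tabulate⁺ (λ j → mono z<s) ∷ allPairs-tabulate (mono ∘ s<s)

-- Counting smaller entries

smaller : ∀ {N} → Fin N → List (Fin N) → ℕ
smaller z ws = List.length (List.filter (Fin._<? z) ws)

smaller-∷ : ∀ {N} (z x : Fin N) ws →
            smaller z (x ∷ ws) ≡ smaller z (x ∷ []) ℕ.+ smaller z ws
smaller-∷ z x ws = ≡.trans
  (≡.cong List.length (filter-++ (Fin._<? z) (x ∷ []) ws))
  (List.length-++ (List.filter (Fin._<? z) (x ∷ [])))

smaller-removeAt : ∀ {N n} (z : Fin N) (xs : Vec (Fin N) (suc n)) k →
  smaller z (toList xs) ≡ smaller z (lookup xs k ∷ toList (removeAt xs k))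
smaller-removeAt z (x ∷ xs)     zero    = ≡.refl
smaller-removeAt z (x ∷ xs@(_ ∷ _)) (suc k) = begin
  smaller z (x ∷ toList xs)
    ≡⟨ smaller-∷ z x _ ⟩
  smaller z (x ∷ []) ℕ.+ smaller z (toList xs)
    ≡⟨ ≡.cong (smaller z (x ∷ []) ℕ.+_) (≡.trans (smaller-removeAt z xs k) (smaller-∷ z _ _)) ⟩
  smaller z (x ∷ []) ℕ.+ (smaller z (lookup xs k ∷ []) ℕ.+ smaller z (toList (removeAt xs k)))
    ≡⟨ m+[n+o]≡n+[m+o] (smaller z (x ∷ [])) (smaller z (lookup xs k ∷ [])) _ ⟩
  smaller z (lookup xs k ∷ []) ℕ.+ (smaller z (x ∷ []) ℕ.+ smaller z (toList (removeAt xs k)))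
    ≡⟨ ≡.cong (smaller z (lookup xs k ∷ []) ℕ.+_) (smaller-∷ z x _) ⟨
  smaller z (lookup xs k ∷ []) ℕ.+ smaller z (x ∷ toList (removeAt xs k))
    ≡⟨ smaller-∷ z _ _ ⟨
  smaller z (lookup xs k ∷ x ∷ toList (removeAt xs k)) ∎
  where open ≡.≡-Reasoning

smaller-none : ∀ {N n} {z : Fin N} {xs : Vec (Fin N) n} →
               VecAll.All (z Fin.<_) xs → smaller z (toList xs) ≡ 0
smaller-none z<xs =
  ≡.cong List.length (filter-none (Fin._<? _) (All.map Fin.<-asym (VecAll.toList⁺ z<xs)))

smaller-index : ∀ {N n} {xs : Vec (Fin N) (suc n)} → AllPairs Fin._<_ xs → ∀ k →
                smaller (lookup xs k) (toList (removeAt xs k)) ≡ toℕ k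
smaller-index (x< ∷ xs<)         zero    = smaller-none x<
smaller-index (x< ∷ xs<@(_ ∷ _)) (suc k) = ≡.trans
  (≡.cong List.length (filter-accept (Fin._<? _) (VecAll.lookup⁺ x< k)))
  (≡.cong suc (smaller-index xs< k))

-- The word of a matching is a rearrangement of `xs`; these counts are all that the sign computation
-- uses of that fact.
smaller-matching : ∀ {N n} (xs : Vec (Fin N) n) →
  All (λ P → ∀ z → smaller z (word P) ≡ smaller z (toList xs)) (matchings xs)
smaller-matching []           = (λ z → ≡.refl) ∷ []
smaller-matching (x ∷ [])     = []
smaller-matching (x ∷ y ∷ zs) = All.concat⁺ (All.map⁺ (All.tabulate⁺ {f = id} λ k →
  All.map⁺ (All.map (λ {P} eq z → begin
    smaller z (x ∷ lookup ys k ∷ word P)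
      ≡⟨ smaller-∷ z x _ ⟩
    smaller z (x ∷ []) ℕ.+ smaller z (lookup ys k ∷ word P)
      ≡⟨ ≡.cong (smaller z (x ∷ []) ℕ.+_) (smaller-∷ z _ _) ⟩
    smaller z (x ∷ []) ℕ.+ (smaller z (lookup ys k ∷ []) ℕ.+ smaller z (word P))
      ≡⟨ ≡.cong (λ c → smaller z (x ∷ []) ℕ.+ (smaller z (lookup ys k ∷ []) ℕ.+ c)) (eq z) ⟩
    smaller z (x ∷ []) ℕ.+ (smaller z (lookup ys k ∷ []) ℕ.+ smaller z (toList (removeAt ys k)))
      ≡⟨ ≡.cong (smaller z (x ∷ []) ℕ.+_) (smaller-∷ z _ _) ⟨
    smaller z (x ∷ []) ℕ.+ smaller z (lookup ys k ∷ toList (removeAt ys k))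
      ≡⟨ ≡.cong (smaller z (x ∷ []) ℕ.+_) (smaller-removeAt z ys k) ⟨
    smaller z (x ∷ []) ℕ.+ smaller z (toList ys)
      ≡⟨ smaller-∷ z x _ ⟨
    smaller z (x ∷ toList ys) ∎)
  (smaller-matching (removeAt ys k)))))
  where
  open ≡.≡-Reasoning
  ys = y ∷ zs

-- Perfect matchings and the Pfaff-adjugate in terms of lists.

module Pfaffians {c ℓ} (S : CommutativeRing c ℓ) where

  open CommutativeRing S hiding (zero)
  open Matrix rawRing
  open AlternatingSums S public
  open import Algebra.Properties.Ring ring
  open import Algebra.Properties.Semiring.Sum semiring
    using (sum-cong-≋; *-distribˡ-sum; sum-remove)
  open import Algebra.Properties.Semiring.Exp semiring using (^-homo-*; ^-congʳ)
  open import Algebra.Properties.CommutativeSemigroup *-commutativeSemigroup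
    using (x∙yz≈y∙xz; interchange)
  open import Relation.Binary.Reasoning.Setoid setoid

  private
    variable
      X : Set
      n : ℕ

  -1^_ : ℕ → Carrier
  -1^ k = (- 1#) ^ k

  -1*-1 : - 1# * - 1# ≈ 1#
  -1*-1 = trans (-1*x≈-x (- 1#)) (-‿involutive 1#)

  -1^k*-1^k : ∀ k x → -1^ k * (-1^ k * x) ≈ x
  -1^k*-1^k zero    x = trans (*-identityˡ _) (*-identityˡ x)
  -1^k*-1^k (suc k) x = begin
    - 1# * -1^ k * (- 1# * -1^ k * x)   ≈⟨ *-assoc _ _ _ ⟨
    - 1# * -1^ k * (- 1# * -1^ k) * x   ≈⟨ *-congʳ (interchange _ _ _ _) ⟩
    - 1# * - 1# * (-1^ k * -1^ k) * x   ≈⟨ *-congʳ (trans (*-congʳ -1*-1) (*-identityˡ _)) ⟩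
    -1^ k * -1^ k * x                   ≈⟨ *-assoc _ _ _ ⟩
    -1^ k * (-1^ k * x)                 ≈⟨ -1^k*-1^k k x ⟩
    x                                   ∎

  sum-neg : ∀ (f : Fin n → Carrier) → - Σ[ f ] ≈ Σ[ (λ k → - f k) ]
  sum-neg f = begin
    - Σ[ f ]                   ≈⟨ -1*x≈-x _ ⟨
    - 1# * Σ[ f ]              ≈⟨ *-distribˡ-sum (- 1#) f ⟩
    Σ[ (λ k → - 1# * f k) ]    ≈⟨ sum-cong-≋ (λ k → -1*x≈-x (f k)) ⟩
    Σ[ (λ k → - f k) ]         ∎

  altSum-toList : ∀ (H : X → List X → Carrier) (ys : Vec X (suc n)) →
    altSum H (toList ys) ≈ Σ[ (λ k → -1^ toℕ k * H (lookup ys k) (toList (removeAt ys k))) ]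
  altSum-toList H (y ∷ [])         =
    trans (x-0# _) (sym (trans (+-identityʳ _) (*-identityˡ _)))
  altSum-toList H (y ∷ ys@(_ ∷ _)) = +-cong (sym (*-identityˡ _)) (begin
    - altSum H′ (toList ys)              ≈⟨ -‿cong (altSum-toList H′ ys) ⟩
    - Σ[ f ]                             ≈⟨ sum-neg f ⟩
    Σ[ (λ k → - f k) ]                   ≈⟨ sum-cong-≋ neg ⟩
    Σ[ (λ k → - 1# * -1^ toℕ k * h k) ]  ∎)
    where
    H′ = λ z zs → H z (y ∷ zs)
    h = λ k → H′ (lookup ys k) (toList (removeAt ys k))
    f = λ k → -1^ toℕ k * h k
    neg : ∀ k → - f k ≈ - 1# * -1^ toℕ k * h k
    neg k = trans (sym (-1*x≈-x (f k))) (sym (*-assoc _ _ _))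

  altSum-values : ∀ (H : X → List X → Carrier) (h : Fin (suc n) → X) →
    altSum H (values h) ≈ Σ[ (λ k → -1^ toℕ k * H (h k) (values (h ∘ punchIn k))) ]
  altSum-values H h = trans (altSum-toList H (Vec.tabulate h)) (sum-cong-≋ entry)
    where
    entry : ∀ k → -1^ toℕ k * H (lookup (Vec.tabulate h) k) (toList (removeAt (Vec.tabulate h) k)) ≈
                  -1^ toℕ k * H (h k) (values (h ∘ punchIn k))
    entry k = *-congˡ
      (reflexive (≡.cong₂ H (lookup∘tabulate h k) (≡.cong toList (removeAt-tabulate h k))))

  listSum : List Carrier → Carrier
  listSum = List.foldr _+_ 0#

  listSum-++ : ∀ xs ys → listSum (xs ++ ys) ≈ listSum xs + listSum ys
  listSum-++ []       ys = sym (+-identityˡ _)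
  listSum-++ (x ∷ xs) ys = trans (+-congˡ (listSum-++ xs ys)) (sym (+-assoc _ _ _))

  listSum-concatMap : ∀ {A B : Set} (g : B → Carrier) (h : A → List B) xs →
    listSum (List.map g (List.concatMap h xs)) ≈ listSum (List.map (λ x → listSum (List.map g (h x))) xs)
  listSum-concatMap g h []       = refl
  listSum-concatMap g h (x ∷ xs) = begin
    listSum (List.map g (h x ++ List.concatMap h xs))
      ≡⟨ ≡.cong listSum (List.map-++ g (h x) _) ⟩
    listSum (List.map g (h x) ++ List.map g (List.concatMap h xs))
      ≈⟨ listSum-++ (List.map g (h x)) _ ⟩
    listSum (List.map g (h x)) + listSum (List.map g (List.concatMap h xs))
      ≈⟨ +-congˡ (listSum-concatMap g h xs) ⟩
    listSum (List.map g (h x)) + listSum (List.map (λ x → listSum (List.map g (h x))) xs) ∎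

  listSum-tabulate : ∀ {A : Set} (φ : A → Carrier) (h : Fin n → A) →
    listSum (List.map φ (List.tabulate h)) ≈ Σ[ (λ k → φ (h k)) ]
  listSum-tabulate {n = zero}  φ h = refl
  listSum-tabulate {n = suc n} φ h = +-congˡ (listSum-tabulate φ (h ∘ suc))

  -- The equation is asked only of the members of `ps`, since `term-∷` is available only for
  -- matchings of the remaining indices.
  listSum-scale : ∀ {A : Set} (x : Carrier) {φ ψ : A → Carrier} {ps} →
    All (λ p → φ p ≈ x * ψ p) ps → listSum (List.map φ ps) ≈ x * listSum (List.map ψ ps)
  listSum-scale x []         = sym (zeroʳ x)
  listSum-scale x (eq ∷ eqs) = trans (+-cong eq (listSum-scale x eqs)) (sym (distribˡ x _ _))

  -- The inversions of x y w that involve x or y: none for x, which is the least entry, and one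
  -- for each entry preceding y in the increasing list.
  term-∷ : ∀ {N} (A : Mat N) {x} {ys : Vec (Fin N) (suc n)} → AllPairs Fin._<_ (x ∷ ys) → ∀ k P →
    (∀ z → smaller z (word P) ≡ smaller z (toList (removeAt ys k))) →
    term A ((x , lookup ys k) ∷ P) ≈ (-1^ toℕ k * A x (lookup ys k)) * term A P
  term-∷ A {x} {ys} (x< ∷ ys<) k P eq = begin
    -1^ inversions (x ∷ y ∷ word P) * (A x y * ∏)
      ≡⟨ ≡.cong (λ i → -1^ i * (A x y * ∏)) count ⟩
    -1^ (toℕ k ℕ.+ inversions (word P)) * (A x y * ∏)
      ≈⟨ *-congʳ (^-homo-* (- 1#) (toℕ k) _) ⟩
    -1^ toℕ k * -1^ inversions (word P) * (A x y * ∏)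
      ≈⟨ interchange _ _ _ _ ⟩
    (-1^ toℕ k * A x y) * (-1^ inversions (word P) * ∏) ∎
    where
    y = lookup ys k
    ∏ = List.foldr _*_ 1# (List.map (uncurry A) P)
    count : inversions (x ∷ y ∷ word P) ≡ toℕ k ℕ.+ inversions (word P)
    count = ≡.cong₂ (λ a b → a ℕ.+ (b ℕ.+ inversions (word P)))
      (≡.trans (smaller-∷ x y _) (≡.trans (≡.cong (smaller x (y ∷ []) ℕ.+_) (eq x))
        (≡.trans (≡.sym (smaller-∷ x y _)) (≡.trans (≡.sym (smaller-removeAt x ys k)) (smaller-none x<)))))
      (≡.trans (eq y) (smaller-index ys< k))

  matchings-Pf : ∀ {N} (A : Mat N) m {xs : Vec (Fin N) (m ℕ.* 2)} → AllPairs Fin._<_ xs →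
    listSum (List.map (term A) (matchings xs)) ≈ Pf A m (toList xs)
  matchings-Pf A zero    {[]}         [] = trans (+-identityʳ _) (*-identityˡ 1#)
  matchings-Pf A (suc m) {x ∷ y ∷ zs} xs<@(x< ∷ ys<) = begin
    listSum (List.map (term A) (matchings (x ∷ ys)))
      ≈⟨ listSum-concatMap (term A) step (List.allFin _) ⟩
    listSum (List.map (λ k → listSum (List.map (term A) (step k))) (List.allFin _))
      ≈⟨ listSum-tabulate (λ k → listSum (List.map (term A) (step k))) id ⟩
    Σ[ (λ k → listSum (List.map (term A) (step k))) ]
      ≈⟨ sum-cong-≋ row ⟩
    Σ[ (λ k → -1^ toℕ k * (A x (lookup ys k) * Pf A m (toList (removeAt ys k)))) ]
      ≈⟨ altSum-toList (λ z zs → A x z * Pf A m zs) ys ⟨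
    contract (A x) (Pf A m) (toList ys) ∎
    where
    ys = y ∷ zs
    step : ∀ k → List _
    step k = List.map ((x , lookup ys k) ∷_) (matchings (removeAt ys k))
    row : ∀ k → listSum (List.map (term A) (step k)) ≈
                -1^ toℕ k * (A x (lookup ys k) * Pf A m (toList (removeAt ys k)))
    row k = begin
      listSum (List.map (term A) (step k))
        ≡⟨ ≡.cong listSum (List.map-∘ (matchings (removeAt ys k))) ⟨
      listSum (List.map (λ P → term A ((x , lookup ys k) ∷ P)) (matchings (removeAt ys k)))
        ≈⟨ listSum-scale _ (All.map (λ {P} → term-∷ A xs< k P) (smaller-matching (removeAt ys k))) ⟩
      (-1^ toℕ k * A x (lookup ys k)) * listSum (List.map (term A) (matchings (removeAt ys k)))
        ≈⟨ *-congˡ (matchings-Pf A m (allPairs-removeAt ys< k)) ⟩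
      (-1^ toℕ k * A x (lookup ys k)) * Pf A m (toList (removeAt ys k))
        ≈⟨ *-assoc _ _ _ ⟩
      -1^ toℕ k * (A x (lookup ys k) * Pf A m (toList (removeAt ys k))) ∎

  pf≈Pf : ∀ m (A : Mat (m ℕ.* 2)) → pf A ≈ Pf A m (values id)
  pf≈Pf m A = matchings-Pf A m (allPairs-tabulate id)

  -- Reindexing trades the submatrix for the full matrix at the list of remaining indices, so all
  -- minors become values of the one function `Pf A m`.
  pf-delete : ∀ m (A : Mat (suc m ℕ.* 2)) k l (j≢k : punchIn k l ≢ k) →
    pf (delete (punchIn k l) k j≢k A) ≈ Pf A m (values (punchIn k ∘ punchIn l))
  pf-delete m A k l j≢k = begin
    pf (delete (punchIn k l) k j≢k A)
      ≈⟨ pf≈Pf m (delete (punchIn k l) k j≢k A) ⟩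
    Pf (λ x y → A (ι x) (ι y)) m (values id)
      ≈⟨ Pf-map A ι m (values id) ⟨
    Pf A m (List.map ι (values id))
      ≡⟨ ≡.cong (Pf A m) (≡.trans (values-map ι) (values-cong (punchIn-swap k l j≢k))) ⟩
    Pf A m (values (punchIn k ∘ punchIn l)) ∎
    where ι = punchIn (punchIn k l) ∘ punchIn (punchOut j≢k)

  -- With `l` the position of the row index after `k` is removed, the two sign rules of `Padj` merge
  -- into (-1)^(k+l): below the diagonal the row index is `l + 1`, and this shift offsets the
  -- additional sign there.
  Padj-punchIn : ∀ m (A : Mat (suc m ℕ.* 2)) k l →
    Padj A (punchIn k l) k ≈ -1^ toℕ k * (-1^ toℕ l * Pf A m (values (punchIn k ∘ punchIn l)))
  Padj-punchIn m A k l with <-cmp (punchIn k l) k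
  ... | tri≈ _ j≡k _ = ⊥-elim (Fin.punchInᵢ≢i k l j≡k)
  ... | tri< j<k j≢k _ = begin
    -1^ (toℕ (punchIn k l) ℕ.+ toℕ k) * pf (delete (punchIn k l) k j≢k A)
      ≈⟨ *-cong (^-congʳ (- 1#) parity) (pf-delete m A k l j≢k) ⟩
    -1^ (toℕ k ℕ.+ toℕ l) * P
      ≈⟨ *-congʳ (^-homo-* (- 1#) (toℕ k) (toℕ l)) ⟩
    -1^ toℕ k * -1^ toℕ l * P
      ≈⟨ *-assoc _ _ _ ⟩
    -1^ toℕ k * (-1^ toℕ l * P) ∎
    where
    P = Pf A m (values (punchIn k ∘ punchIn l))
    parity : toℕ (punchIn k l) ℕ.+ toℕ k ≡ toℕ k ℕ.+ toℕ l
    parity = ≡.trans (ℕ.+-comm (toℕ (punchIn k l)) (toℕ k))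
                     (≡.cong (toℕ k ℕ.+_) (toℕ-punchIn-< k l j<k))
  ... | tri> _ j≢k k<j = begin
    -1^ (toℕ (punchIn k l) ℕ.+ toℕ k ℕ.+ 1) * pf (delete (punchIn k l) k j≢k A)
      ≈⟨ *-cong (^-congʳ (- 1#) parity) (pf-delete m A k l j≢k) ⟩
    - 1# * (- 1# * -1^ (toℕ k ℕ.+ toℕ l)) * P
      ≈⟨ *-congʳ (trans (sym (*-assoc _ _ _)) (trans (*-congʳ -1*-1) (*-identityˡ _))) ⟩
    -1^ (toℕ k ℕ.+ toℕ l) * P
      ≈⟨ *-congʳ (^-homo-* (- 1#) (toℕ k) (toℕ l)) ⟩
    -1^ toℕ k * -1^ toℕ l * P
      ≈⟨ *-assoc _ _ _ ⟩
    -1^ toℕ k * (-1^ toℕ l * P) ∎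
    where
    P = Pf A m (values (punchIn k ∘ punchIn l))
    parity : toℕ (punchIn k l) ℕ.+ toℕ k ℕ.+ 1 ≡ suc (suc (toℕ k ℕ.+ toℕ l))
    parity = ≡.trans (ℕ.+-comm _ 1) (≡.cong suc (≡.trans
      (≡.cong (ℕ._+ toℕ k) (toℕ-punchIn-> k l k<j)) (≡.cong suc (ℕ.+-comm (toℕ l) (toℕ k)))))

  Padj-diag : ∀ m (A : Mat (suc m ℕ.* 2)) k → Padj A k k ≈ 0#
  Padj-diag m A k with <-cmp k k
  ... | tri< _ k≢k _ = ⊥-elim (k≢k ≡.refl)
  ... | tri≈ _ _ _   = refl
  ... | tri> _ k≢k _ = ⊥-elim (k≢k ≡.refl)

  -- A column of the Pfaff-adjugate acts on covectors as a contraction. The covector is left free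
  -- because it will be a row of `A` in the adjugate identity and a row of another matrix in the
  -- trace formula.
  sum-*-Padj : ∀ m (A : Mat (suc m ℕ.* 2)) (f : Fin (suc m ℕ.* 2) → Carrier) k →
    Σ[ (λ j → f j * Padj A j k) ] ≈ -1^ toℕ k * contract f (Pf A m) (values (punchIn k))
  sum-*-Padj m A f k = begin
    Σ[ (λ j → f j * Padj A j k) ]
      ≈⟨ sum-remove {i = k} (λ j → f j * Padj A j k) ⟩
    f k * Padj A k k + Σ[ (λ l → f (punchIn k l) * Padj A (punchIn k l) k) ]
      ≈⟨ +-cong (trans (*-congˡ (Padj-diag m A k)) (zeroʳ _)) (sum-cong-≋ entry) ⟩
    0# + Σ[ (λ l → -1^ toℕ k * g l) ]
      ≈⟨ +-identityˡ _ ⟩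
    Σ[ (λ l → -1^ toℕ k * g l) ]
      ≈⟨ *-distribˡ-sum (-1^ toℕ k) g ⟨
    -1^ toℕ k * Σ[ g ]
      ≈⟨ *-congˡ (altSum-values (λ z zs → f z * Pf A m zs) (punchIn k)) ⟨
    -1^ toℕ k * contract f (Pf A m) (values (punchIn k)) ∎
    where
    g = λ l → -1^ toℕ l * (f (punchIn k l) * Pf A m (values (punchIn k ∘ punchIn l)))
    entry : ∀ l → f (punchIn k l) * Padj A (punchIn k l) k ≈ -1^ toℕ k * g l
    entry l = trans (*-congˡ (Padj-punchIn m A k l))
      (trans (x∙yz≈y∙xz _ _ _) (*-congˡ (x∙yz≈y∙xz _ _ _)))

  alternating-move : ∀ {G : List X → Carrier} → Alternating G → ∀ (h : Fin (suc n) → X) k →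
    G (h k ∷ values (h ∘ punchIn k)) ≈ -1^ toℕ k * G (values h)
  alternating-move alt h zero = sym (*-identityˡ _)
  alternating-move {n = suc n} {G = G} alt h (suc k) = begin
    G (h (suc k) ∷ h zero ∷ values (h ∘ suc ∘ punchIn k))
      ≈⟨ Alternating.swap alt [] _ _ _ ⟩
    - G (h zero ∷ h (suc k) ∷ values (h ∘ suc ∘ punchIn k))
      ≈⟨ -‿cong (alternating-move (alternating-∷ alt (h zero)) (h ∘ suc) k) ⟩
    - (-1^ toℕ k * G (values h))
      ≈⟨ trans (sym (-1*x≈-x _)) (sym (*-assoc _ _ _)) ⟩
    - 1# * -1^ toℕ k * G (values h) ∎

  -- Bringing the entry `h l` of `values h` to the front costs a sign and creates two equal
  -- neighbours.
  alternating-member : ∀ {G : List X → Carrier} → Alternating G → ∀ (h : Fin (suc n) → X) l →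
    G (h l ∷ values h) ≈ 0#
  alternating-member {G = G} alt h l = begin
    G (h l ∷ values h)
      ≈⟨ -1^k*-1^k (toℕ l) _ ⟨
    -1^ toℕ l * (-1^ toℕ l * G (h l ∷ values h))
      ≈⟨ *-congˡ (alternating-move (alternating-∷ alt (h l)) h l) ⟨
    -1^ toℕ l * G (h l ∷ h l ∷ values (h ∘ punchIn l))
      ≈⟨ *-congˡ (Alternating.repeat alt [] _ _) ⟩
    -1^ toℕ l * 0#
      ≈⟨ zeroʳ _ ⟩
    0# ∎

  1ᴹ-diag : ∀ {n} (i : Fin n) → 1ᴹ i i ≈ 1#
  1ᴹ-diag zero    = refl
  1ᴹ-diag (suc i) = 1ᴹ-diag i

  1ᴹ-off : ∀ {n} {i j : Fin n} → i ≢ j → 1ᴹ i j ≈ 0#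
  1ᴹ-off {i = zero}  {zero}  i≢j = ⊥-elim (i≢j ≡.refl)
  1ᴹ-off {i = zero}  {suc j} i≢j = refl
  1ᴹ-off {i = suc i} {zero}  i≢j = refl
  1ᴹ-off {i = suc i} {suc j} i≢j = 1ᴹ-off (i≢j ∘ ≡.cong suc)

  module _ m (A : Mat (suc m ℕ.* 2)) (skew : SkewSymmetric A) (diag : ∀ i → A i i ≈ 0#) where

    -- Up to sign, row `i` against column `k` is `Pf A` at the list in which `k` is replaced by a
    -- leading `i`. For `i = k` moving it back restores all indices in order; otherwise `i` occurs
    -- twice.
    *-Padj : A *ᴹ Padj A ≈ᴹ pf A ·ᴹ 1ᴹ
    *-Padj i k = begin
      Σ[ (λ j → A i j * Padj A j k) ]
        ≈⟨ sum-*-Padj m A (A i) k ⟩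
      -1^ toℕ k * Pf A (suc m) (i ∷ values (punchIn k))
        ≈⟨ entry (i ≟ k) ⟩
      Pf A (suc m) (values id) * 1ᴹ i k
        ≈⟨ *-congʳ (pf≈Pf (suc m) A) ⟨
      pf A * 1ᴹ i k ∎
      where
      alt = Pf-alternating skew diag (suc m)
      entry : _ → -1^ toℕ k * Pf A (suc m) (i ∷ values (punchIn k)) ≈ Pf A (suc m) (values id) * 1ᴹ i k
      entry (yes ≡.refl) = begin
        -1^ toℕ k * Pf A (suc m) (k ∷ values (punchIn k))
          ≈⟨ *-congˡ (alternating-move alt id k) ⟩
        -1^ toℕ k * (-1^ toℕ k * Pf A (suc m) (values id))
          ≈⟨ -1^k*-1^k (toℕ k) _ ⟩
        Pf A (suc m) (values id)
          ≈⟨ *-identityʳ _ ⟨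
        Pf A (suc m) (values id) * 1#
          ≈⟨ *-congˡ (1ᴹ-diag k) ⟨
        Pf A (suc m) (values id) * 1ᴹ k k ∎
      entry (no i≢k) = begin
        -1^ toℕ k * Pf A (suc m) (i ∷ values (punchIn k))
          ≡⟨ ≡.cong (λ i → -1^ toℕ k * Pf A (suc m) (i ∷ values (punchIn k)))
                    (≡.sym (punchIn-punchOut k≢i)) ⟩
        -1^ toℕ k * Pf A (suc m) (punchIn k (punchOut k≢i) ∷ values (punchIn k))
          ≈⟨ *-congˡ (alternating-member alt (punchIn k) (punchOut k≢i)) ⟩
        -1^ toℕ k * 0#
          ≈⟨ trans (zeroʳ _) (sym (zeroʳ _)) ⟩
        Pf A (suc m) (values id) * 0#
          ≈⟨ *-congˡ (1ᴹ-off i≢k) ⟨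
        Pf A (suc m) (values id) * 1ᴹ i k ∎
        where
        k≢i : k ≢ i
        k≢i = i≢k ∘ ≡.sym

  -- Two matrices are kept apart because the formula is applied to the pencil with `E` equal to J,
  -- where each summand on the right becomes the derivative of the Pfaffian.
  tr-*-Padj : ∀ m (A E : Mat (suc m ℕ.* 2)) → SkewSymmetric E →
    tr (E *ᴹ Padj A) ≈ contract₂ E (Pf A m) (values id) + contract₂ E (Pf A m) (values id)
  tr-*-Padj m A E skew = begin
    Σ[ (λ k → Σ[ (λ j → E k j * Padj A j k) ]) ]
      ≈⟨ sum-cong-≋ (λ k → sum-*-Padj m A (E k) k) ⟩
    Σ[ (λ k → -1^ toℕ k * contract (E k) (Pf A m) (values (punchIn k))) ]
      ≈⟨ altSum-values (λ z → contract (E z) (Pf A m)) id ⟨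
    altSum (λ z → contract (E z) (Pf A m)) (values id)
      ≈⟨ altSum-contract skew (Pf A m) (values id) ⟩
    contract₂ E (Pf A m) (values id) + contract₂ E (Pf A m) (values id) ∎

-- The polynomial ring and its formal derivative.

module PolynomialRing {c ℓ} (R : CommutativeRing c ℓ) where

  open CommutativeRing R hiding (zero; _-_)
  open Polynomial rawRing
  open import Algebra.Properties.Ring ring using (-0#≈0#)
  open import Algebra.Properties.CommutativeMonoid.Mult +-commutativeMonoid
    using (×-congʳ; ×-distrib-+) renaming (_×_ to _×ℕ_)
  open import Algebra.Properties.Semiring.Mult semiring using (×-comm-*)
  open import Algebra.Properties.CommutativeSemigroup +-commutativeSemigroup
    using (interchange; x∙yz≈y∙xz)

  infix 4 _≋_

  -- A record, so that both sides of an equation can be inferred from its type.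
  record _≋_ (p q : List Carrier) : Set ℓ where
    constructor coeffwise
    field at : ∀ k → coeff p k ≈ coeff q k

  open _≋_ public

  coeff-+ : ∀ p q k → coeff (addₚ p q) k ≈ coeff p k + coeff q k
  coeff-+ []      q       k       = sym (+-identityˡ _)
  coeff-+ (a ∷ p) []      k       = sym (+-identityʳ _)
  coeff-+ (a ∷ p) (b ∷ q) zero    = refl
  coeff-+ (a ∷ p) (b ∷ q) (suc k) = coeff-+ p q k

  coeff-neg : ∀ p k → coeff (List.map -_ p) k ≈ - coeff p k
  coeff-neg []      k       = sym -0#≈0#
  coeff-neg (a ∷ p) zero    = refl
  coeff-neg (a ∷ p) (suc k) = coeff-neg p k

  coeff-scale : ∀ a p k → coeff (List.map (a *_) p) k ≈ a * coeff p k
  coeff-scale a []      k       = sym (zeroʳ a)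
  coeff-scale a (b ∷ p) zero    = refl
  coeff-scale a (b ∷ p) (suc k) = coeff-scale a p k

  private
    scale : Carrier → List Carrier → List Carrier
    scale a = List.map (a *_)

    shift : List Carrier → List Carrier
    shift p = 0# ∷ p

  ≋-setoid : Setoid c ℓ
  ≋-setoid = record
    { Carrier = List Carrier
    ; _≈_ = _≋_
    ; isEquivalence = record
      { refl  = coeffwise λ k → refl
      ; sym   = λ p → coeffwise λ k → sym (p .at k)
      ; trans = λ p q → coeffwise λ k → trans (p .at k) (q .at k)
      }
    }

  private
    module ≋ = Setoid ≋-setoid

  addₚ-cong : ∀ {p p′ q q′} → p ≋ p′ → q ≋ q′ → addₚ p q ≋ addₚ p′ q′
  addₚ-cong {p} {p′} {q} {q′} eq eq′ .at k =
    trans (coeff-+ p q k) (trans (+-cong (eq .at k) (eq′ .at k)) (sym (coeff-+ p′ q′ k)))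

  addₚ-assoc : ∀ p q r → addₚ (addₚ p q) r ≋ addₚ p (addₚ q r)
  addₚ-assoc p q r .at k = trans
    (trans (coeff-+ (addₚ p q) r k) (+-congʳ (coeff-+ p q k)))
    (trans (+-assoc _ _ _)
      (sym (trans (coeff-+ p (addₚ q r) k) (+-congˡ (coeff-+ q r k)))))

  addₚ-comm : ∀ p q → addₚ p q ≋ addₚ q p
  addₚ-comm p q .at k = trans (coeff-+ p q k) (trans (+-comm _ _) (sym (coeff-+ q p k)))

  addₚ-identityʳ : ∀ p → addₚ p [] ≋ p
  addₚ-identityʳ []      = ≋.refl
  addₚ-identityʳ (a ∷ p) = ≋.refl

  addₚ-interchange : ∀ p q r s → addₚ (addₚ p q) (addₚ r s) ≋ addₚ (addₚ p r) (addₚ q s)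
  addₚ-interchange p q r s .at k = trans
    (trans (coeff-+ (addₚ p q) (addₚ r s) k) (+-cong (coeff-+ p q k) (coeff-+ r s k)))
    (trans (interchange _ _ _ _)
      (sym (trans (coeff-+ (addₚ p r) (addₚ q s) k) (+-cong (coeff-+ p r k) (coeff-+ q s k)))))

  neg-cong : ∀ {p q} → p ≋ q → List.map -_ p ≋ List.map -_ q
  neg-cong {p} {q} eq .at k =
    trans (coeff-neg p k) (trans (-‿cong (eq .at k)) (sym (coeff-neg q k)))

  neg-inverseʳ : ∀ p → addₚ p (List.map -_ p) ≋ []
  neg-inverseʳ p .at k =
    trans (coeff-+ p _ k) (trans (+-congˡ (coeff-neg p k)) (-‿inverseʳ _))

  private
    shift-cong : ∀ {p q} → p ≋ q → shift p ≋ shift q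
    shift-cong eq .at zero    = refl
    shift-cong eq .at (suc k) = eq .at k

    shift-0 : shift [] ≋ []
    shift-0 .at zero    = refl
    shift-0 .at (suc k) = refl

    shift-+ : ∀ p q → shift (addₚ p q) ≋ addₚ (shift p) (shift q)
    shift-+ p q .at zero    = sym (+-identityˡ 0#)
    shift-+ p q .at (suc k) = refl

    scale-cong : ∀ a {p q} → p ≋ q → scale a p ≋ scale a q
    scale-cong a {p} {q} eq .at k =
      trans (coeff-scale a p k) (trans (*-congˡ (eq .at k)) (sym (coeff-scale a q k)))

    scale-shift : ∀ a p → scale a (shift p) ≋ shift (scale a p)
    scale-shift a p .at zero    = zeroʳ a
    scale-shift a p .at (suc k) = refl

    scale-+ : ∀ a p q → scale a (addₚ p q) ≋ addₚ (scale a p) (scale a q)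
    scale-+ a p q .at k = trans
      (trans (coeff-scale a (addₚ p q) k) (trans (*-congˡ (coeff-+ p q k)) (distribˡ a _ _)))
      (sym (trans (coeff-+ (scale a p) _ k) (+-cong (coeff-scale a p k) (coeff-scale a q k))))

    +-scale : ∀ a b p → scale (a + b) p ≋ addₚ (scale a p) (scale b p)
    +-scale a b p .at k = trans
      (trans (coeff-scale _ p k) (distribʳ _ a b))
      (sym (trans (coeff-+ (scale a p) _ k) (+-cong (coeff-scale a p k) (coeff-scale b p k))))

    *-scale : ∀ a b p → scale (a * b) p ≋ scale a (scale b p)
    *-scale a b p .at k = trans
      (trans (coeff-scale _ p k) (*-assoc a b _))
      (sym (trans (coeff-scale a (scale b p) k) (*-congˡ (coeff-scale b p k))))

    0-scale : ∀ p → scale 0# p ≋ []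
    0-scale p .at k = trans (coeff-scale 0# p k) (zeroˡ _)

    mulₚ-congʳ : ∀ p {q q′} → q ≋ q′ → mulₚ p q ≋ mulₚ p q′
    mulₚ-congʳ []      eq = ≋.refl
    mulₚ-congʳ (a ∷ p) eq = addₚ-cong (scale-cong a eq) (shift-cong (mulₚ-congʳ p eq))

    mulₚ-zeroʳ : ∀ p → mulₚ p [] ≋ []
    mulₚ-zeroʳ []      = ≋.refl
    mulₚ-zeroʳ (a ∷ p) = ≋.trans (shift-cong (mulₚ-zeroʳ p)) shift-0

    -- The mirror image of the defining clause of `mulₚ`; commutativity follows from it by
    -- induction.
    mulₚ-∷ : ∀ p b q → mulₚ p (b ∷ q) ≋ addₚ (scale b p) (shift (mulₚ p q))
    mulₚ-∷ []      b q = ≋.sym shift-0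
    mulₚ-∷ (a ∷ p) b q .at zero    = +-congʳ (*-comm a b)
    mulₚ-∷ (a ∷ p) b q .at (suc k) = trans
      (trans (coeff-+ (scale a q) _ k)
        (+-congˡ (trans (mulₚ-∷ p b q .at k) (coeff-+ (scale b p) _ k))))
      (trans (x∙yz≈y∙xz _ _ _)
        (sym (trans (coeff-+ (scale b p) _ k) (+-congˡ (coeff-+ (scale a q) _ k)))))

  mulₚ-comm : ∀ p q → mulₚ p q ≋ mulₚ q p
  mulₚ-comm []      q = ≋.sym (mulₚ-zeroʳ q)
  mulₚ-comm (a ∷ p) q = ≋.trans
    (addₚ-cong ≋.refl (shift-cong (mulₚ-comm p q))) (≋.sym (mulₚ-∷ q a p))

  -- Equal polynomials may be lists of different lengths, which obstructs a recursion on the left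
  -- factor. Commutativity moves the change to the right factor, where `mulₚ-congʳ` applies.
  mulₚ-cong : ∀ {p p′ q q′} → p ≋ p′ → q ≋ q′ → mulₚ p q ≋ mulₚ p′ q′
  mulₚ-cong {p} {p′} {q} {q′} eq eq′ = ≋.trans (mulₚ-congʳ p eq′)
    (≋.trans (mulₚ-comm p q′) (≋.trans (mulₚ-congʳ q′ eq) (mulₚ-comm q′ p′)))

  mulₚ-distribʳ : ∀ r p q → mulₚ (addₚ p q) r ≋ addₚ (mulₚ p r) (mulₚ q r)
  mulₚ-distribʳ r []      q       = ≋.refl
  mulₚ-distribʳ r (a ∷ p) []      = ≋.sym (addₚ-identityʳ _)
  mulₚ-distribʳ r (a ∷ p) (b ∷ q) = ≋.trans
    (addₚ-cong (+-scale a b r) (≋.trans (shift-cong (mulₚ-distribʳ r p q)) (shift-+ (mulₚ p r) (mulₚ q r))))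
    (addₚ-interchange (scale a r) _ _ _)

  mulₚ-distribˡ : ∀ r p q → mulₚ r (addₚ p q) ≋ addₚ (mulₚ r p) (mulₚ r q)
  mulₚ-distribˡ r p q = ≋.trans (mulₚ-comm r _)
    (≋.trans (mulₚ-distribʳ r p q) (addₚ-cong (mulₚ-comm p r) (mulₚ-comm q r)))

  private
    mulₚ-scale : ∀ a p q → mulₚ (scale a p) q ≋ scale a (mulₚ p q)
    mulₚ-scale a []      q = ≋.refl
    mulₚ-scale a (b ∷ p) q = ≋.trans
      (addₚ-cong (*-scale a b q)
        (≋.trans (shift-cong (mulₚ-scale a p q)) (≋.sym (scale-shift a _))))
      (≋.sym (scale-+ a (scale b q) _))

    mulₚ-shift : ∀ p q → mulₚ (shift p) q ≋ shift (mulₚ p q)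
    mulₚ-shift p q = addₚ-cong (0-scale q) ≋.refl

  mulₚ-assoc : ∀ p q r → mulₚ (mulₚ p q) r ≋ mulₚ p (mulₚ q r)
  mulₚ-assoc []      q r = ≋.refl
  mulₚ-assoc (a ∷ p) q r = ≋.trans (mulₚ-distribʳ r (scale a q) _)
    (addₚ-cong (mulₚ-scale a q r)
      (≋.trans (mulₚ-shift (mulₚ p q) r) (shift-cong (mulₚ-assoc p q r))))

  coeff-C* : ∀ a p k → coeff (mulₚ (C a) p) k ≈ a * coeff p k
  coeff-C* a p k = trans (coeff-+ (scale a p) (shift []) k)
    (trans (+-cong (coeff-scale a p k) (shift-0 .at k)) (+-identityʳ _))

  mulₚ-identityˡ : ∀ p → mulₚ [ 1# ] p ≋ p
  mulₚ-identityˡ p .at k = trans (coeff-C* 1# p k) (*-identityˡ _)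

  commutativeRing : CommutativeRing c ℓ
  commutativeRing = record
    { Carrier = List Carrier
    ; _≈_ = _≋_
    ; _+_ = addₚ
    ; _*_ = mulₚ
    ; -_ = List.map (-_)
    ; 0# = []
    ; 1# = [ 1# ]
    ; isCommutativeRing = record
      { isRing = record
        { +-isAbelianGroup = record
          { isGroup = record
            { isMonoid = record
              { isSemigroup = record
                { isMagma = record { isEquivalence = ≋.isEquivalence ; ∙-cong = addₚ-cong }
                ; assoc = addₚ-assoc
                }
              ; identity = (λ p → ≋.refl) , addₚ-identityʳ
              }
            ; inverse = (λ p → ≋.trans (addₚ-comm _ p) (neg-inverseʳ p)) , neg-inverseʳ
            ; ⁻¹-cong = neg-cong
            }
          ; comm = addₚ-comm
          }
        ; *-cong = mulₚ-cong
        ; *-assoc = mulₚ-assoc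
        ; *-identity = mulₚ-identityˡ , (λ p → ≋.trans (mulₚ-comm p _) (mulₚ-identityˡ p))
        ; distrib = mulₚ-distribˡ , mulₚ-distribʳ
        }
      ; *-comm = mulₚ-comm
      }
    }

  C-cong : ∀ {a b} → a ≈ b → C a ≋ C b
  C-cong a≈b .at zero    = a≈b
  C-cong a≈b .at (suc k) = refl

  C-0 : C 0# ≋ []
  C-0 = shift-0

  coeff-t*-zero : ∀ p → coeff (mulₚ t p) zero ≈ 0#
  coeff-t*-zero p = mulₚ-shift [ 1# ] p .at zero

  coeff-t*-suc : ∀ p k → coeff (mulₚ t p) (suc k) ≈ coeff p k
  coeff-t*-suc p k = trans (mulₚ-shift [ 1# ] p .at (suc k)) (mulₚ-identityˡ p .at k)

  -- The formal derivative, by the rule (a + t p)′ = p + t p′, which needs no counter for the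
  -- exponent.
  D : List Carrier → List Carrier
  D []      = []
  D (a ∷ p) = addₚ p (0# ∷ D p)

  coeff-D : ∀ p k → coeff (D p) k ≈ suc k ×ℕ coeff p (suc k)
  coeff-D []      k = sym (×-zero (suc k))
    where
    ×-zero : ∀ n → n ×ℕ 0# ≈ 0#
    ×-zero zero    = refl
    ×-zero (suc n) = trans (+-identityˡ _) (×-zero n)
  coeff-D (a ∷ p) zero    = coeff-+ p _ zero
  coeff-D (a ∷ p) (suc k) = trans (coeff-+ p _ (suc k)) (+-congˡ (coeff-D p k))

  D-cong : ∀ {p q} → p ≋ q → D p ≋ D q
  D-cong {p} {q} eq .at k =
    trans (coeff-D p k) (trans (×-congʳ (suc k) (eq .at (suc k))) (sym (coeff-D q k)))

  D-+ : ∀ p q → D (addₚ p q) ≋ addₚ (D p) (D q)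
  D-+ p q .at k = trans
    (trans (coeff-D (addₚ p q) k) (trans (×-congʳ (suc k) (coeff-+ p q (suc k))) (×-distrib-+ _ _ (suc k))))
    (sym (trans (coeff-+ (D p) _ k) (+-cong (coeff-D p k) (coeff-D q k))))

  -- Together with `D-t*` this replaces the general product rule: an entry of tJ + A is t times a
  -- constant plus a constant.
  D-C* : ∀ a p → D (mulₚ (C a) p) ≋ mulₚ (C a) (D p)
  D-C* a p .at k = trans
    (trans (coeff-D (mulₚ (C a) p) k) (×-congʳ (suc k) (coeff-C* a p (suc k))))
    (trans (sym (×-comm-* (suc k) _ _))
      (sym (trans (coeff-C* a (D p) k) (*-congˡ (coeff-D p k)))))

  D-t* : ∀ p → D (mulₚ t p) ≋ addₚ p (mulₚ t (D p))
  D-t* p .at k = trans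
    (trans (coeff-D (mulₚ t p) k) (×-congʳ (suc k) (coeff-t*-suc p k)))
    (sym (trans (coeff-+ p _ k) (+-congˡ (rest k))))
    where
    rest : ∀ k → coeff (mulₚ t (D p)) k ≈ k ×ℕ coeff p k
    rest zero    = coeff-t*-zero (D p)
    rest (suc k) = trans (coeff-t*-suc (D p) k) (coeff-D p k)

-- Additive maps, such as the derivative or the extraction of a coefficient, and signed sums.

module AdditiveMap
  {c ℓ c′ ℓ′} (S : CommutativeRing c ℓ) (T : CommutativeRing c′ ℓ′)
  (φ : CommutativeRing.Carrier S → CommutativeRing.Carrier T)
  (φ-cong : ∀ {x y} → CommutativeRing._≈_ S x y → CommutativeRing._≈_ T (φ x) (φ y))
  (φ-+ : ∀ x y → CommutativeRing._≈_ T (φ (CommutativeRing._+_ S x y)) (CommutativeRing._+_ T (φ x) (φ y)))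
  where

  private
    module S = CommutativeRing S
    module AS = AlternatingSums S
    module AT = AlternatingSums T
    module MS = Matrix S.rawRing
    module MT = Matrix (CommutativeRing.rawRing T)
  open CommutativeRing T hiding (zero)
  open import Algebra.Properties.Ring ring using (x+x≈x⇒x≈0)
  open import Algebra.Properties.Group +-group using (inverseʳ-unique)

  φ-0 : φ S.0# ≈ 0#
  φ-0 = x+x≈x⇒x≈0 _ (trans (sym (φ-+ _ _)) (φ-cong (S.+-identityˡ _)))

  φ-neg : ∀ x → φ (S.- x) ≈ - φ x
  φ-neg x = inverseʳ-unique _ _
    (trans (sym (φ-+ _ _)) (trans (φ-cong (S.-‿inverseʳ x)) φ-0))

  φ-altSum : ∀ {X : Set} (H : X → List X → S.Carrier) xs →
             φ (AS.altSum H xs) ≈ AT.altSum (λ z zs → φ (H z zs)) xs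
  φ-altSum H []       = φ-0
  φ-altSum H (x ∷ xs) =
    trans (φ-+ _ _) (+-congˡ (trans (φ-neg _) (-‿cong (φ-altSum _ xs))))

  φ-sum : ∀ {n} (f : Fin n → S.Carrier) → φ MS.Σ[ f ] ≈ MT.Σ[ φ ∘ f ]
  φ-sum {zero}  f = φ-0
  φ-sum {suc n} f = trans (φ-+ _ _) (+-congˡ (φ-sum (f ∘ suc)))

-- The standard form J: its square and its Pfaffian.

module StandardForm {c ℓ} (S : CommutativeRing c ℓ) where

  open CommutativeRing S hiding (zero)
  open Matrix rawRing
  open Pfaffians S
  open import Algebra.Properties.Ring ring
  open import Algebra.Properties.Semiring.Sum semiring using (sum-cong-≋; sum-replicate-zero)
  open import Relation.Binary.Reasoning.Setoid setoid

  J-diag : ∀ m i → J m i i ≈ 0#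
  J-diag (suc m) zero          = refl
  J-diag (suc m) (suc zero)    = refl
  J-diag (suc m) (suc (suc i)) = J-diag m i

  J-skew : ∀ m → SkewSymmetric (J m)
  J-skew (suc m) zero          zero          = sym -0#≈0#
  J-skew (suc m) zero          (suc zero)    = refl
  J-skew (suc m) zero          (suc (suc j)) = sym -0#≈0#
  J-skew (suc m) (suc zero)    zero          = sym (-‿involutive 1#)
  J-skew (suc m) (suc zero)    (suc zero)    = sym -0#≈0#
  J-skew (suc m) (suc zero)    (suc (suc j)) = sym -0#≈0#
  J-skew (suc m) (suc (suc i)) zero          = sym -0#≈0#
  J-skew (suc m) (suc (suc i)) (suc zero)    = sym -0#≈0#
  J-skew (suc m) (suc (suc i)) (suc (suc j)) = J-skew m i j

  sum-0* : ∀ {n} (f : Fin n → Carrier) → Σ[ (λ i → 0# * f i) ] ≈ 0#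
  sum-0* {n} f = trans (sum-cong-≋ (λ i → zeroˡ (f i))) (sum-replicate-zero n)

  module _ m (f : Fin (suc m ℕ.* 2) → Carrier) where

    J-row₀ : Σ[ (λ j → J (suc m) zero j * f j) ] ≈ f (suc zero)
    J-row₀ = begin
      0# * f zero + (1# * f (suc zero) + Σ[ (λ j → 0# * f (suc (suc j))) ])
        ≈⟨ +-cong (zeroˡ _) (+-cong (*-identityˡ _) (sum-0* (λ j → f (suc (suc j))))) ⟩
      0# + (f (suc zero) + 0#)
        ≈⟨ trans (+-identityˡ _) (+-identityʳ _) ⟩
      f (suc zero) ∎

    J-row₁ : Σ[ (λ j → J (suc m) (suc zero) j * f j) ] ≈ - f zero
    J-row₁ = begin
      - 1# * f zero + (0# * f (suc zero) + Σ[ (λ j → 0# * f (suc (suc j))) ])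
        ≈⟨ +-cong (-1*x≈-x _) (+-cong (zeroˡ _) (sum-0* (λ j → f (suc (suc j))))) ⟩
      - f zero + (0# + 0#)
        ≈⟨ trans (+-congˡ (+-identityˡ 0#)) (+-identityʳ _) ⟩
      - f zero ∎

    J-row₂ : ∀ i → Σ[ (λ j → J (suc m) (suc (suc i)) j * f j) ] ≈ Σ[ (λ j → J m i j * f (suc (suc j))) ]
    J-row₂ i = begin
      0# * f zero + (0# * f (suc zero) + Σ[ (λ j → J m i j * f (suc (suc j))) ])
        ≈⟨ +-cong (zeroˡ _) (+-congʳ (zeroˡ _)) ⟩
      0# + (0# + Σ[ (λ j → J m i j * f (suc (suc j))) ])
        ≈⟨ trans (+-identityˡ _) (+-identityˡ _) ⟩
      Σ[ (λ j → J m i j * f (suc (suc j))) ] ∎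

  -- The relation J² = -I applied to a vector. It makes -J the inverse of J, by which the
  -- coefficient identity is solved for the next matrix.
  J² : ∀ m f i → Σ[ (λ j → J m i j * Σ[ (λ l → J m j l * f l) ]) ] ≈ - f i
  J² (suc m) f zero =
    trans (J-row₀ m (λ j → Σ[ (λ l → J (suc m) j l * f l) ])) (J-row₁ m f)
  J² (suc m) f (suc zero) =
    trans (J-row₁ m (λ j → Σ[ (λ l → J (suc m) j l * f l) ])) (-‿cong (J-row₀ m f))
  J² (suc m) f (suc (suc i)) = trans
    (J-row₂ m (λ j → Σ[ (λ l → J (suc m) j l * f l) ]) i)
    (trans (sum-cong-≋ entry) (J² m (λ l → f (suc (suc l))) i))
    where
    entry : ∀ j → J m i j * Σ[ (λ l → J (suc m) (suc (suc j)) l * f l) ] ≈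
                  J m i j * Σ[ (λ l → J m j l * f (suc (suc l))) ]
    entry j = *-congˡ (J-row₂ m f j)

  -- The first row has its only nonzero entry at the second index, so the expansion has one term and
  -- reduces to the remaining blocks. This is the source of c₀ = 1.
  Pf-J : ∀ m → Pf (J m) m (values id) ≈ 1#
  Pf-J zero    = refl
  Pf-J (suc m) = begin
    1# * Pf (J (suc m)) m (values ι) - altSum H (values ι)
      ≡⟨ ≡.cong (λ xs → 1# * Pf (J (suc m)) m xs - altSum H xs) (≡.sym (values-map ι)) ⟩
    1# * Pf (J (suc m)) m (List.map ι (values id)) - altSum H (List.map ι (values id))
      ≈⟨ +-cong (trans (*-identityˡ _) (Pf-map (J (suc m)) ι m (values id)))
                (-‿cong (trans (altSum-map ι H (values id))
                  (trans (altSum-cong (λ z zs → zeroˡ (Pf (J (suc m)) m (suc zero ∷ List.map ι zs))) (values id))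
                         (altSum-0 (values {n = m ℕ.* 2} id))))) ⟩
    Pf (J m) m (values id) - 0#
      ≈⟨ trans (x-0# _) (Pf-J m) ⟩
    1# ∎
    where
    ι : Fin (m ℕ.* 2) → Fin (suc m ℕ.* 2)
    ι i = suc (suc i)
    H = λ z zs → J (suc m) zero z * Pf (J (suc m)) m (suc zero ∷ zs)

-- The pencil tJ + A: coefficients of its Pfaffian and of its Pfaff-adjugate.

module Pencil {c ℓ} (R : CommutativeRing c ℓ) where

  open CommutativeRing R hiding (zero; _-_)
  open Matrix rawRing
  open Polynomial rawRing
  private
    module ℙ = PolynomialRing R
    module T = CommutativeRing ℙ.commutativeRing
    module Mᵗ = Matrix T.rawRing
    module A = Pfaffians R
    module Aᵗ = Pfaffians ℙ.commutativeRing
    module J = StandardForm R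
    module Jᵗ = StandardForm ℙ.commutativeRing
  open ℙ using (at; _≋_; coeff-+; coeff-C*; coeff-t*-zero; coeff-t*-suc; D; D-cong; D-+)
  open import Algebra.Properties.Semiring.Sum semiring using (sum-cong-≋; ∑-distrib-+)
  open import Algebra.Properties.Semiring.Mult semiring using () renaming (_×_ to _×ℕ_)
  import Algebra.Properties.Ring T.ring as T-Ring
  open import Relation.Binary.Reasoning.Setoid setoid

  private
    module Coeff k = AdditiveMap ℙ.commutativeRing R (λ p → coeff p k) (λ eq → eq .at k) (λ p q → coeff-+ p q k)
    module Deriv = AdditiveMap ℙ.commutativeRing ℙ.commutativeRing D D-cong D-+

  Jᵗ≋J : ∀ m i j → Mᵗ.J m i j ≋ C (J m i j)
  Jᵗ≋J (suc m) zero          zero          = T.sym ℙ.C-0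
  Jᵗ≋J (suc m) zero          (suc zero)    = T.refl
  Jᵗ≋J (suc m) zero          (suc (suc j)) = T.sym ℙ.C-0
  Jᵗ≋J (suc m) (suc zero)    zero          = T.refl
  Jᵗ≋J (suc m) (suc zero)    (suc zero)    = T.sym ℙ.C-0
  Jᵗ≋J (suc m) (suc zero)    (suc (suc j)) = T.sym ℙ.C-0
  Jᵗ≋J (suc m) (suc (suc i)) zero          = T.sym ℙ.C-0
  Jᵗ≋J (suc m) (suc (suc i)) (suc zero)    = T.sym ℙ.C-0
  Jᵗ≋J (suc m) (suc (suc i)) (suc (suc j)) = Jᵗ≋J m i j

  1ᴹᵗ≋1ᴹ : ∀ {n} (i j : Fin n) → Mᵗ.1ᴹ i j ≋ C (1ᴹ i j)
  1ᴹᵗ≋1ᴹ zero    zero    = T.refl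
  1ᴹᵗ≋1ᴹ zero    (suc j) = T.sym ℙ.C-0
  1ᴹᵗ≋1ᴹ (suc i) zero    = T.sym ℙ.C-0
  1ᴹᵗ≋1ᴹ (suc i) (suc j) = 1ᴹᵗ≋1ᴹ i j

  coeff-J* : ∀ m i j p k → coeff (Mᵗ.J m i j T.* p) k ≈ J m i j * coeff p k
  coeff-J* m i j p k = trans (T.*-congʳ {p} (Jᵗ≋J m i j) .at k) (coeff-C* (J m i j) p k)

  coeff-sign : ∀ e p k → coeff ((Aᵗ.-1^ e) T.* p) k ≈ (A.-1^ e) * coeff p k
  coeff-sign zero    p k = coeff-C* 1# p k
  coeff-sign (suc e) p k = begin
    coeff (T.- T.1# T.* (Aᵗ.-1^ e) T.* p) k   ≈⟨ T.*-assoc (T.- T.1#) (Aᵗ.-1^ e) p .at k ⟩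
    coeff (T.- T.1# T.* ((Aᵗ.-1^ e) T.* p)) k ≈⟨ coeff-C* (- 1#) ((Aᵗ.-1^ e) T.* p) k ⟩
    - 1# * coeff ((Aᵗ.-1^ e) T.* p) k         ≈⟨ *-congˡ (coeff-sign e p k) ⟩
    - 1# * ((A.-1^ e) * coeff p k)            ≈⟨ *-assoc _ _ _ ⟨
    (A.-1^ suc e) * coeff p k                 ∎

  module _ (n : ℕ) (A : Mat (n ℕ.* 2)) where

    pencil : Mᵗ.Mat (n ℕ.* 2)
    pencil = (t Mᵗ.·ᴹ Mᵗ.J n) Mᵗ.+ᴹ (λ i j → C (A i j))

    private
      Jₙ = J n
      Jₙᵗ = Mᵗ.J n
      B = pencil

    pencil-* : ∀ i j p → B i j T.* p ≋ t T.* (Jₙᵗ i j T.* p) T.+ C (A i j) T.* p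
    pencil-* i j p = T.trans (T.distribʳ p (t T.* Jₙᵗ i j) (C (A i j)))
                             (T.+-congʳ {C (A i j) T.* p} (T.*-assoc t (Jₙᵗ i j) p))

    coeff-pencil-*-zero : ∀ i j p → coeff (B i j T.* p) 0 ≈ A i j * coeff p 0
    coeff-pencil-*-zero i j p = begin
      coeff (B i j T.* p) 0                                            ≈⟨ pencil-* i j p .at 0 ⟩
      coeff (t T.* (Jₙᵗ i j T.* p) T.+ C (A i j) T.* p) 0              ≈⟨ coeff-+ (t T.* (Jₙᵗ i j T.* p)) _ 0 ⟩
      coeff (t T.* (Jₙᵗ i j T.* p)) 0 + coeff (C (A i j) T.* p) 0
        ≈⟨ +-cong (coeff-t*-zero (Jₙᵗ i j T.* p)) (coeff-C* (A i j) p 0) ⟩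
      0# + A i j * coeff p 0                                           ≈⟨ +-identityˡ _ ⟩
      A i j * coeff p 0                                                ∎

    coeff-pencil-*-suc : ∀ i j p k →
      coeff (B i j T.* p) (suc k) ≈ Jₙ i j * coeff p k + A i j * coeff p (suc k)
    coeff-pencil-*-suc i j p k = begin
      coeff (B i j T.* p) (suc k)                                               ≈⟨ pencil-* i j p .at (suc k) ⟩
      coeff (t T.* (Jₙᵗ i j T.* p) T.+ C (A i j) T.* p) (suc k)
        ≈⟨ coeff-+ (t T.* (Jₙᵗ i j T.* p)) _ (suc k) ⟩
      coeff (t T.* (Jₙᵗ i j T.* p)) (suc k) + coeff (C (A i j) T.* p) (suc k)
        ≈⟨ +-cong (trans (coeff-t*-suc (Jₙᵗ i j T.* p) k) (coeff-J* n i j p k)) (coeff-C* (A i j) p (suc k)) ⟩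
      Jₙ i j * coeff p k + A i j * coeff p (suc k)                              ∎

    D-pencil-* : ∀ i j p → D (B i j T.* p) ≋ Jₙᵗ i j T.* p T.+ B i j T.* D p
    D-pencil-* i j p = T.trans (T.trans (D-cong (pencil-* i j p)) (T.trans (D-+ (t T.* (Jₙᵗ i j T.* p)) (C (A i j) T.* p))
      (T.+-cong (T.trans (ℙ.D-t* (Jₙᵗ i j T.* p)) (T.+-congˡ {Jₙᵗ i j T.* p} (T.*-congˡ {t} D-J)))
                (ℙ.D-C* (A i j) p))))
      (T.trans (T.+-assoc (Jₙᵗ i j T.* p) _ _) (T.+-congˡ {Jₙᵗ i j T.* p} (T.sym (pencil-* i j (D p)))))
      where
      D-J : D (Jₙᵗ i j T.* p) ≋ Jₙᵗ i j T.* D p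
      D-J = T.trans (D-cong (T.*-congʳ {p} (Jᵗ≋J n i j)))
        (T.trans (ℙ.D-C* (Jₙ i j) p) (T.*-congʳ {D p} (T.sym (Jᵗ≋J n i j))))

    Pfᵗ = Aᵗ.Pf B

    coeff-Pf-zero : ∀ m xs → coeff (Pfᵗ m xs) 0 ≈ A.Pf A m xs
    coeff-Pf-zero zero    []       = refl
    coeff-Pf-zero zero    (x ∷ xs) = refl
    coeff-Pf-zero (suc m) []       = refl
    coeff-Pf-zero (suc m) (x ∷ xs) = trans
      (Coeff.φ-altSum 0 (λ z zs → B x z T.* Pfᵗ m zs) xs)
      (A.altSum-cong (λ z zs → trans (coeff-pencil-*-zero x z (Pfᵗ m zs))
                                     (*-congˡ (coeff-Pf-zero m zs))) xs)

    -- Degree bound (`k > 0`) and leading coefficient (`k = 0`) share one induction: each factor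
    -- raises the degree by one through J, while its `A` part meets a coefficient beyond the degree
    -- of the smaller Pfaffian, zero by the claim for `suc k`.
    coeff-Pf-top : ∀ m xs k → coeff (Pfᵗ m xs) (m ℕ.+ k) ≈ coeff (C (A.Pf Jₙ m xs)) k
    coeff-Pf-top zero    []       k = refl
    coeff-Pf-top zero    (x ∷ xs) k = sym (ℙ.C-0 .at k)
    coeff-Pf-top (suc m) []       k = sym (ℙ.C-0 .at k)
    coeff-Pf-top (suc m) (x ∷ xs) k = trans
      (Coeff.φ-altSum (suc m ℕ.+ k) (λ z zs → B x z T.* Pfᵗ m zs) xs)
      (trans (A.altSum-cong entry xs) (sym (coeff-C-altSum k)))
      where
      H : _ → _ → Carrier
      H z zs = Jₙ x z * A.Pf Jₙ m zs
      coeff-C-altSum : ∀ k → coeff (C (A.altSum H xs)) k ≈ A.altSum (λ z zs → coeff (C (H z zs)) k) xs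
      coeff-C-altSum zero    = refl
      coeff-C-altSum (suc k) = sym (A.altSum-0 xs)
      coeff-C-* : ∀ a b k → a * coeff (C b) k ≈ coeff (C (a * b)) k
      coeff-C-* a b zero    = refl
      coeff-C-* a b (suc k) = zeroʳ a
      entry : ∀ z zs → coeff (B x z T.* Pfᵗ m zs) (suc m ℕ.+ k) ≈ coeff (C (H z zs)) k
      entry z zs = begin
        coeff (B x z T.* Pfᵗ m zs) (suc (m ℕ.+ k))
          ≈⟨ coeff-pencil-*-suc x z (Pfᵗ m zs) (m ℕ.+ k) ⟩
        Jₙ x z * coeff (Pfᵗ m zs) (m ℕ.+ k) + A x z * coeff (Pfᵗ m zs) (suc (m ℕ.+ k))
          ≈⟨ +-cong (*-congˡ (coeff-Pf-top m zs k))
                    (*-congˡ (trans (reflexive (≡.cong (coeff (Pfᵗ m zs)) (≡.sym (ℕ.+-suc m k))))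
                                    (coeff-Pf-top m zs (suc k)))) ⟩
        Jₙ x z * coeff (C (A.Pf Jₙ m zs)) k + A x z * 0#
          ≈⟨ trans (+-congˡ (zeroʳ _)) (+-identityʳ _) ⟩
        Jₙ x z * coeff (C (A.Pf Jₙ m zs)) k
          ≈⟨ coeff-C-* (Jₙ x z) (A.Pf Jₙ m zs) k ⟩
        coeff (C (H z zs)) k ∎

    -- In the product rule for the expansion along `x`, differentiating the row gives the pairs
    -- containing `x`. Differentiating the minors gives, by induction, a `contract₂` inside a
    -- contraction; exchanging the two turns it into the pairs avoiding `x`.
    D-Pf : ∀ m xs → D (Pfᵗ (suc m) xs) ≋ Aᵗ.contract₂ Jₙᵗ (Pfᵗ m) xs
    D-Pf m []       = T.refl
    D-Pf m (x ∷ xs) = T.trans (Deriv.φ-altSum (λ z zs → B x z T.* Pfᵗ m zs) xs)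
      (T.trans (Aᵗ.altSum-cong (λ z zs → D-pencil-* x z (Pfᵗ m zs)) xs)
        (T.trans (Aᵗ.altSum-+ (λ z zs → Jₙᵗ x z T.* Pfᵗ m zs) (λ z zs → B x z T.* D (Pfᵗ m zs)) xs)
                 (T.+-congˡ {Aᵗ.contract (Jₙᵗ x) (Pfᵗ m) xs} (rest m))))
      where
      rest : ∀ m → Aᵗ.contract (B x) (λ zs → D (Pfᵗ m zs)) xs ≋
                   Aᵗ.contract₂ Jₙᵗ (λ zs → Pfᵗ m (x ∷ zs)) xs
      rest zero    = T.trans (Aᵗ.contract-0 (B x) D-Pf₀ xs)
                             (T.sym (Aᵗ.contract₂-0 Jₙᵗ (λ _ → T.refl) xs))
        where
        D-Pf₀ : ∀ zs → D (Pfᵗ 0 zs) ≋ []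
        D-Pf₀ []       = ℙ.C-0
        D-Pf₀ (z ∷ zs) = T.refl
      rest (suc m) = T.trans (Aᵗ.contract-congʳ (B x) (D-Pf m) xs)
                             (Aᵗ.contract-contract₂ (B x) Jₙᵗ (Pfᵗ m) xs)

  module _ (m : ℕ) (A : Mat (suc m ℕ.* 2)) (skew : SkewSymmetric A) (diag : ∀ i → A i i ≈ 0#) where

    private
      n = suc m
      B = pencil n A

    pfᶜ : ℕ → Carrier
    pfᶜ k = coeff (Mᵗ.pf B) k

    Padjᶜ : ℕ → Mat (n ℕ.* 2)
    Padjᶜ k i j = coeff (Mᵗ.Padj B i j) k

    pencil-skew : Mᵗ.SkewSymmetric B
    pencil-skew i j = T.trans
      (T.+-cong (T.trans (T.*-congˡ {t} (Jᵗ.J-skew n i j)) (T.sym (T-Ring.-‿distribʳ-* t (Mᵗ.J n i j))))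
                (ℙ.C-cong (skew i j)))
      (T-Ring.-‿+-comm (t T.* Mᵗ.J n i j) (C (A i j)))

    pencil-diag : ∀ i → B i i ≋ []
    pencil-diag i = T.+-cong (T.trans (T.*-congˡ {t} (Jᵗ.J-diag n i)) (T.zeroʳ t))
                             (T.trans (ℙ.C-cong (diag i)) ℙ.C-0)

    pfᶜ-zero : pfᶜ 0 ≈ pf A
    pfᶜ-zero = begin
      coeff (Mᵗ.pf B) 0               ≈⟨ Aᵗ.pf≈Pf n B .at 0 ⟩
      coeff (Pfᵗ n A n (values id)) 0 ≈⟨ coeff-Pf-zero n A n (values id) ⟩
      A.Pf A n (values id)            ≈⟨ A.pf≈Pf n A ⟨
      pf A                            ∎

    pfᶜ-top : ∀ k → pfᶜ (n ℕ.+ k) ≈ coeff (C 1#) k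
    pfᶜ-top k = begin
      coeff (Mᵗ.pf B) (n ℕ.+ k)               ≈⟨ Aᵗ.pf≈Pf n B .at (n ℕ.+ k) ⟩
      coeff (Pfᵗ n A n (values id)) (n ℕ.+ k) ≈⟨ coeff-Pf-top n A n (values id) k ⟩
      coeff (C (A.Pf (J n) n (values id))) k  ≈⟨ ℙ.C-cong (J.Pf-J n) .at k ⟩
      coeff (C 1#) k                          ∎

    Padjᶜ-punchIn : ∀ k l j → Padjᶜ j (punchIn k l) k ≈
      (A.-1^ toℕ k) * ((A.-1^ toℕ l) * coeff (Pfᵗ n A m (values (punchIn k ∘ punchIn l))) j)
    Padjᶜ-punchIn k l j = begin
      coeff (Mᵗ.Padj B (punchIn k l) k) j
        ≈⟨ Aᵗ.Padj-punchIn m B k l .at j ⟩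
      coeff ((Aᵗ.-1^ toℕ k) T.* ((Aᵗ.-1^ toℕ l) T.* P)) j
        ≈⟨ coeff-sign (toℕ k) ((Aᵗ.-1^ toℕ l) T.* P) j ⟩
      (A.-1^ toℕ k) * coeff ((Aᵗ.-1^ toℕ l) T.* P) j
        ≈⟨ *-congˡ (coeff-sign (toℕ l) P j) ⟩
      (A.-1^ toℕ k) * ((A.-1^ toℕ l) * coeff P j) ∎
      where P = Pfᵗ n A m (values (punchIn k ∘ punchIn l))

    private
      offDiagonal : ∀ {P : (i k : Fin (n ℕ.* 2)) → Set ℓ} →
        (∀ k → P k k) → (∀ k l → P (punchIn k l) k) → ∀ i k → P i k
      offDiagonal {P} p q i k with k ≟ i
      ... | yes ≡.refl = p k
      ... | no k≢i     = ≡.subst (λ i → P i k) (punchIn-punchOut k≢i) (q k (punchOut k≢i))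

    Padjᶜ-zero : Padjᶜ 0 ≈ᴹ Padj A
    Padjᶜ-zero = offDiagonal
      (λ k → trans (Aᵗ.Padj-diag m B k .at 0) (sym (A.Padj-diag m A k)))
      (λ k l → trans (Padjᶜ-punchIn k l 0)
        (trans (*-congˡ (*-congˡ (coeff-Pf-zero n A m (values (punchIn k ∘ punchIn l)))))
               (sym (A.Padj-punchIn m A k l))))

    -- The minors have only `m = n - 1` pairs, hence degree at most `m`. This vanishing is what
    -- starts the recursion.
    Padjᶜ-top : Padjᶜ n ≈ᴹ 0ᴹ
    Padjᶜ-top = offDiagonal
      (λ k → Aᵗ.Padj-diag m B k .at n)
      (λ k l → trans (Padjᶜ-punchIn k l n)
        (trans (*-congˡ (trans (*-congˡ (vanish (values (punchIn k ∘ punchIn l)))) (zeroʳ _))) (zeroʳ _)))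
      where
      vanish : ∀ xs → coeff (Pfᵗ n A m xs) n ≈ 0#
      vanish xs = trans (reflexive (≡.cong (coeff (Pfᵗ n A m xs)) (ℕ.+-comm 1 m)))
                        (coeff-Pf-top n A m xs 1)

    private
      coeff-scalar : ∀ (i j : Fin (n ℕ.* 2)) k → coeff ((Mᵗ.pf B Mᵗ.·ᴹ Mᵗ.1ᴹ) i j) k ≈ pfᶜ k * 1ᴹ i j
      coeff-scalar i j k = begin
        coeff (Mᵗ.pf B T.* Mᵗ.1ᴹ i j) k
          ≈⟨ T.trans (T.*-congˡ {Mᵗ.pf B} (1ᴹᵗ≋1ᴹ i j)) (T.*-comm (Mᵗ.pf B) _) .at k ⟩
        coeff (C (1ᴹ i j) T.* Mᵗ.pf B) k
          ≈⟨ coeff-C* (1ᴹ i j) (Mᵗ.pf B) k ⟩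
        1ᴹ i j * pfᶜ k
          ≈⟨ *-comm _ _ ⟩
        pfᶜ k * 1ᴹ i j ∎

    *-Padjᶜ-zero : A *ᴹ Padjᶜ 0 ≈ᴹ pfᶜ 0 ·ᴹ 1ᴹ
    *-Padjᶜ-zero i k = begin
      Σ[ (λ j → A i j * Padjᶜ 0 j k) ]
        ≈⟨ sum-cong-≋ (λ j → coeff-pencil-*-zero n A i j (Mᵗ.Padj B j k)) ⟨
      Σ[ (λ j → coeff (B i j T.* Mᵗ.Padj B j k) 0) ]
        ≈⟨ Coeff.φ-sum 0 (λ j → B i j T.* Mᵗ.Padj B j k) ⟨
      coeff ((B Mᵗ.*ᴹ Mᵗ.Padj B) i k) 0
        ≈⟨ Aᵗ.*-Padj m B pencil-skew pencil-diag i k .at 0 ⟩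
      coeff ((Mᵗ.pf B Mᵗ.·ᴹ Mᵗ.1ᴹ) i k) 0
        ≈⟨ coeff-scalar i k 0 ⟩
      pfᶜ 0 * 1ᴹ i k ∎

    *-Padjᶜ-suc : ∀ j → J n *ᴹ Padjᶜ j +ᴹ A *ᴹ Padjᶜ (suc j) ≈ᴹ pfᶜ (suc j) ·ᴹ 1ᴹ
    *-Padjᶜ-suc d i k = begin
      Σ[ f ] + Σ[ g ]
        ≈⟨ ∑-distrib-+ f g ⟨
      Σ[ (λ j → f j + g j) ]
        ≈⟨ sum-cong-≋ (λ j → coeff-pencil-*-suc n A i j (Mᵗ.Padj B j k) d) ⟨
      Σ[ (λ j → coeff (B i j T.* Mᵗ.Padj B j k) (suc d)) ]
        ≈⟨ Coeff.φ-sum (suc d) (λ j → B i j T.* Mᵗ.Padj B j k) ⟨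
      coeff ((B Mᵗ.*ᴹ Mᵗ.Padj B) i k) (suc d)
        ≈⟨ Aᵗ.*-Padj m B pencil-skew pencil-diag i k .at (suc d) ⟩
      coeff ((Mᵗ.pf B Mᵗ.·ᴹ Mᵗ.1ᴹ) i k) (suc d)
        ≈⟨ coeff-scalar i k (suc d) ⟩
      pfᶜ (suc d) * 1ᴹ i k ∎
      where
      f = λ j → J n i j * Padjᶜ d j k
      g = λ j → A i j * Padjᶜ (suc d) j k

    tr-J*Padjᶜ : ∀ j → tr (J n *ᴹ Padjᶜ j) ≈ suc j ×ℕ pfᶜ (suc j) + suc j ×ℕ pfᶜ (suc j)
    tr-J*Padjᶜ d = begin
      Σ[ (λ i → Σ[ (λ j → J n i j * Padjᶜ d j i) ]) ]
        ≈⟨ sum-cong-≋ entry ⟨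
      Σ[ (λ i → coeff ((Mᵗ.J n Mᵗ.*ᴹ Mᵗ.Padj B) i i) d) ]
        ≈⟨ Coeff.φ-sum d (λ i → (Mᵗ.J n Mᵗ.*ᴹ Mᵗ.Padj B) i i) ⟨
      coeff (Mᵗ.tr (Mᵗ.J n Mᵗ.*ᴹ Mᵗ.Padj B)) d
        ≈⟨ Aᵗ.tr-*-Padj m B (Mᵗ.J n) (Jᵗ.J-skew n) .at d ⟩
      coeff (E T.+ E) d
        ≈⟨ coeff-+ E E d ⟩
      coeff E d + coeff E d
        ≈⟨ +-cong half half ⟩
      suc d ×ℕ pfᶜ (suc d) + suc d ×ℕ pfᶜ (suc d) ∎
      where
      E = Aᵗ.contract₂ (Mᵗ.J n) (Pfᵗ n A m) (values id)
      half : coeff E d ≈ suc d ×ℕ pfᶜ (suc d)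
      half = trans (sym (T.trans (D-cong (Aᵗ.pf≈Pf n B)) (D-Pf n A m (values id)) .at d))
                   (ℙ.coeff-D (Mᵗ.pf B) d)
      entry : ∀ i → coeff ((Mᵗ.J n Mᵗ.*ᴹ Mᵗ.Padj B) i i) d ≈ Σ[ (λ j → J n i j * Padjᶜ d j i) ]
      entry i = trans (Coeff.φ-sum d (λ j → Mᵗ.J n i j T.* Mᵗ.Padj B j i))
                      (sum-cong-≋ (λ j → coeff-J* n i j (Mᵗ.Padj B j i) d))

-- Used to identify the image of an integer in the algebra with a repeated sum of `1#`, and thereby
-- to cancel rational division against the multiples coming from traces and derivatives.
fromℤ-suc : ∀ k → fromℤ (ℤ.+ suc k) ≡ 1ℚ ℚ.+ fromℤ (ℤ.+ k)
fromℤ-suc k = ℚ.toℚᵘ-injective (ℚᵘ.≃-trans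
  (ℚᵘ.*≡* (≡.cong (λ z → (ℤ.+ 1 ℤ.+ z) ℤ.* ℤ.+ 1) (≡.sym (ℤ.*-identityʳ (ℤ.+ k)))))
  (ℚᵘ.≃-sym (ℚ.toℚᵘ-homo-+ 1ℚ (fromℤ (ℤ.+ k)))))

-- Polynomials as sums of powers of t.

module PowerSum {c ℓ} (R : CommutativeRing c ℓ) where

  open CommutativeRing R hiding (zero)
  open Polynomial rawRing
  private
    module ℙ = PolynomialRing R
    module T = CommutativeRing ℙ.commutativeRing
    module Mᵗ = Matrix T.rawRing
  open ℙ using (at; _≋_)
  import Algebra.Properties.Semiring.Sum T.semiring as T-Sum
  import Algebra.Properties.CommutativeSemigroup T.*-commutativeSemigroup as T*

  -- Horner's scheme: the constant term is split off, t is factored out of the rest, and both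
  -- sequences are shifted by one.
  coeff-∑tʲ : ∀ N (h f : ℕ → Carrier) → (∀ k → k ℕ.< N → f k ≈ h k) → (∀ k → f (N ℕ.+ k) ≈ 0#) →
    ∀ k → f k ≈ coeff Mᵗ.Σ[ (λ (j : Fin N) → C (h (toℕ j)) T.* t Mᵗ.^ toℕ j) ] k
  coeff-∑tʲ zero    h f low high k = high k
  coeff-∑tʲ (suc N) h f low high = λ where
      zero → trans (low 0 z<s) (sym (trans (split .at 0) (trans (ℙ.coeff-+ (C (h 0)) (t T.* S) 0)
        (trans (+-congˡ (ℙ.coeff-t*-zero S)) (+-identityʳ _)))))
      (suc k) → trans (coeff-∑tʲ N (h ∘ suc) (f ∘ suc) (λ k k<N → low (suc k) (s<s k<N)) high k)
        (sym (trans (split .at (suc k)) (trans (ℙ.coeff-+ (C (h 0)) (t T.* S) (suc k))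
          (trans (+-identityˡ _) (ℙ.coeff-t*-suc S k)))))
    where
    g : Fin N → List Carrier
    g j = C (h (suc (toℕ j))) T.* t Mᵗ.^ toℕ j
    S = Mᵗ.Σ[ g ]
    entry : ∀ j → C (h (suc (toℕ j))) T.* (t T.* t Mᵗ.^ toℕ j) ≋ t T.* g j
    entry j = T*.x∙yz≈y∙xz (C (h (suc (toℕ j)))) t (t Mᵗ.^ toℕ j)
    split : Mᵗ.Σ[ (λ (j : Fin (suc N)) → C (h (toℕ j)) T.* t Mᵗ.^ toℕ j) ] ≋ C (h 0) T.+ t T.* S
    split = T.+-cong (T.*-identityʳ (C (h 0)))
      (T.trans (T-Sum.sum-cong-≋ entry) (T.sym (T-Sum.*-distribˡ-sum t g)))

-- The two raw rings of polynomials differ only in their equality, which the stuck applications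
-- of _^_ and J nevertheless mention.
module SameOperations {c ℓ} (R : CommutativeRing c ℓ) where

  open CommutativeRing R using (rawRing)
  open Polynomial rawRing
  private
    module ℙ = PolynomialRing R
    module T = CommutativeRing ℙ.commutativeRing
    module Mᵗ = Matrix T.rawRing
    module M = Matrix R[t]

  ^-≡ : ∀ p k → p M.^ k ≡ p Mᵗ.^ k
  ^-≡ p zero    = ≡.refl
  ^-≡ p (suc k) = ≡.cong (mulₚ p) (^-≡ p k)

  J-≡ : ∀ m i j → M.J m i j ≡ Mᵗ.J m i j
  J-≡ (suc m) zero          zero          = ≡.refl
  J-≡ (suc m) zero          (suc zero)    = ≡.refl
  J-≡ (suc m) zero          (suc (suc j)) = ≡.refl
  J-≡ (suc m) (suc zero)    zero          = ≡.refl
  J-≡ (suc m) (suc zero)    (suc zero)    = ≡.refl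
  J-≡ (suc m) (suc zero)    (suc (suc j)) = ≡.refl
  J-≡ (suc m) (suc (suc i)) zero          = ≡.refl
  J-≡ (suc m) (suc (suc i)) (suc zero)    = ≡.refl
  J-≡ (suc m) (suc (suc i)) (suc (suc j)) = J-≡ m i j

  pf-≡ : ∀ {n} {B B′ : M.Mat n} → (∀ i j → B i j ≡ B′ i j) → M.pf B ≡ Mᵗ.pf B′
  pf-≡ B≡B′ = ≡.cong (List.foldr addₚ []) (map-cong
    (λ P → ≡.cong₂ mulₚ (^-≡ _ (inversions (word P)))
      (≡.cong (List.foldr mulₚ [ _ ]) (map-cong (λ (i , j) → B≡B′ i j) P)))
    (matchings (Vec.allFin _)))

-- The recursion computes the coefficients of the pencil.

module RecursionCorrect {c ℓ} (R : CommutativeℚAlgebra c ℓ) where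

  open import Data.Integer.Base using (+_)
  open CommutativeℚAlgebra R hiding (zero)
  open Matrix rawRing
  open Recursion R
  open StandardForm commutativeRing using (J²)
  private
    module P = Pencil commutativeRing
    module F = Pfaffians commutativeRing
  open import Algebra.Properties.Ring ring
  open import Algebra.Properties.Semiring.Sum semiring
    using (sum-cong-≋; *-distribˡ-sum; ∑-distrib-+; sum-replicate; sum-replicate-zero; sum-remove)
  open import Algebra.Properties.Semiring.Mult semiring
    renaming (_×_ to _×ℕ_) using (×-assoc-*; ×-homo-+; ×-congʳ; ×-congˡ)
  open import Algebra.Properties.CommutativeSemigroup *-commutativeSemigroup using (x∙yz≈y∙xz)
  open import Relation.Binary.Reasoning.Setoid setoid
  open RingMorphisms.IsRingHomomorphism isRingHomomorphism

  fromℚ-ℕ : ∀ k → fromℚ (fromℤ (+ k)) ≈ k ×ℕ 1#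
  fromℚ-ℕ zero    = 0#-homo
  fromℚ-ℕ (suc k) = begin
    fromℚ (fromℤ (+ suc k))               ≡⟨ ≡.cong fromℚ (fromℤ-suc k) ⟩
    fromℚ (1ℚ ℚ.+ fromℤ (+ k))            ≈⟨ +-homo 1ℚ (fromℤ (+ k)) ⟩
    fromℚ 1ℚ + fromℚ (fromℤ (+ k))        ≈⟨ +-cong 1#-homo (fromℚ-ℕ k) ⟩
    1# + k ×ℕ 1#                          ∎

  ÷-cong : ∀ {x y} d .{{_ : ℤ.NonZero d}} → x ≈ y → x ÷ d ≈ y ÷ d
  ÷-cong d x≈y = *-congˡ x≈y

  ×-÷ : ∀ k x → (suc k ×ℕ x) ÷ + suc k ≈ x
  ×-÷ k x = begin
    fromℚ (1/ d) * (suc k ×ℕ x)           ≈⟨ *-congˡ (×-congʳ (suc k) (*-identityˡ x)) ⟨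
    fromℚ (1/ d) * (suc k ×ℕ (1# * x))    ≈⟨ *-congˡ (×-assoc-* (suc k) 1# x) ⟨
    fromℚ (1/ d) * ((suc k ×ℕ 1#) * x)    ≈⟨ *-congˡ (*-congʳ (fromℚ-ℕ (suc k))) ⟨
    fromℚ (1/ d) * (fromℚ d * x)          ≈⟨ *-assoc _ _ _ ⟨
    fromℚ (1/ d) * fromℚ d * x            ≈⟨ *-congʳ (*-homo (1/ d) d) ⟨
    fromℚ (1/ d ℚ.* d) * x                ≡⟨ ≡.cong (λ q → fromℚ q * x) (ℚ.*-inverseˡ d) ⟩
    fromℚ 1ℚ * x                          ≈⟨ trans (*-congʳ 1#-homo) (*-identityˡ x) ⟩
    x                                     ∎
    where d = fromℤ (+ suc k)

  -- Division by two makes the diagonal of a skew-symmetric matrix vanish, as alternation requires.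
  x≈-x⇒x≈0 : ∀ {x} → x ≈ - x → x ≈ 0#
  x≈-x⇒x≈0 {x} x≈-x = begin
    x                   ≈⟨ ×-÷ 1 x ⟨
    (2 ×ℕ x) ÷ + 2      ≈⟨ ÷-cong (+ 2) (trans (+-congˡ (trans (+-identityʳ x) x≈-x)) (-‿inverseʳ x)) ⟩
    0# ÷ + 2            ≈⟨ zeroʳ _ ⟩
    0#                  ∎

  module _ (m : ℕ) (A : Mat (suc m ℕ.* 2)) (skew : SkewSymmetric A) where

    private
      n = suc m
      diag : ∀ i → A i i ≈ 0#
      diag i = x≈-x⇒x≈0 (skew i i)
      pfᶜ = P.pfᶜ m A skew diag
      Padjᶜ = P.Padjᶜ m A skew diag

    private
      sum-*-1ᴹ : ∀ i k → Σ[ (λ l → J n i l * 1ᴹ l k) ] ≈ J n i k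
      sum-*-1ᴹ i k = begin
        Σ[ (λ l → J n i l * 1ᴹ l k) ]
          ≈⟨ sum-remove {i = k} (λ l → J n i l * 1ᴹ l k) ⟩
        J n i k * 1ᴹ k k + Σ[ (λ l → f l * 1ᴹ (Fin.punchIn k l) k) ]
          ≈⟨ +-cong (trans (*-congˡ (F.1ᴹ-diag k)) (*-identityʳ _)) (trans (sum-cong-≋ off) zeros) ⟩
        J n i k + 0#
          ≈⟨ +-identityʳ _ ⟩
        J n i k ∎
        where
        f : Fin (suc (m ℕ.* 2)) → Carrier
        f l = J n i (Fin.punchIn k l)
        off : ∀ l → f l * 1ᴹ (Fin.punchIn k l) k ≈ 0#
        off l = trans (*-congˡ (F.1ᴹ-off (Fin.punchInᵢ≢i k l))) (zeroʳ _)
        zeros : Σ[ (λ (_ : Fin (suc (m ℕ.* 2))) → 0#) ] ≈ 0#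
        zeros = sum-replicate-zero (suc (m ℕ.* 2))

    -- The coefficient identity `P.*-Padjᶜ-suc`, multiplied from the left by -J, the inverse of J.
    -- Lower powers of t are thus obtained from higher ones.
    Padjᶜ-step : ∀ j i k → Padjᶜ j i k ≈ (J n *ᴹ (A *ᴹ Padjᶜ (suc j)) -ᴹ pfᶜ (suc j) ·ᴹ J n) i k
    Padjᶜ-step d i k = begin
      X i k                                            ≈⟨ -‿involutive _ ⟨
      - - X i k                                        ≈⟨ -‿cong (J² n (λ l → X l k) i) ⟨
      - Σ[ (λ l → J n i l * (J n *ᴹ X) l k) ]          ≈⟨ F.sum-neg (λ l → J n i l * (J n *ᴹ X) l k) ⟩
      Σ[ (λ l → - (J n i l * (J n *ᴹ X) l k)) ]        ≈⟨ sum-cong-≋ entry ⟩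
      Σ[ (λ l → u l + - p * v l) ]                     ≈⟨ ∑-distrib-+ u (λ l → - p * v l) ⟩
      Σ[ u ] + Σ[ (λ l → - p * v l) ]                  ≈⟨ +-congˡ (*-distribˡ-sum (- p) v) ⟨
      Σ[ u ] + - p * Σ[ v ]                            ≈⟨ +-congˡ (*-congˡ (sum-*-1ᴹ i k)) ⟩
      Σ[ u ] + - p * J n i k                           ≈⟨ +-congˡ (-‿distribˡ-* p _) ⟨
      Σ[ u ] + - (p * J n i k)                         ∎
      where
      X = Padjᶜ d
      Y = A *ᴹ Padjᶜ (suc d)
      p = pfᶜ (suc d)
      u = λ l → J n i l * Y l k
      v = λ l → J n i l * 1ᴹ l k
      entry : ∀ l → - (J n i l * (J n *ᴹ X) l k) ≈ u l + - p * v l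
      entry l = begin
        - (J n i l * JX)                       ≈⟨ -‿distribʳ-* _ _ ⟩
        J n i l * - JX                         ≈⟨ *-congˡ rearranged ⟩
        J n i l * (Y l k + - p * 1ᴹ l k)       ≈⟨ distribˡ _ _ _ ⟩
        u l + J n i l * (- p * 1ᴹ l k)         ≈⟨ +-congˡ (x∙yz≈y∙xz _ _ _) ⟩
        u l + - p * v l                        ∎
        where
        JX = (J n *ᴹ X) l k
        rearranged : - JX ≈ Y l k + - p * 1ᴹ l k
        rearranged = begin
          - JX                               ≈⟨ +-identityˡ _ ⟨
          0# - JX                            ≈⟨ +-congʳ (-‿inverseʳ (Y l k)) ⟨
          Y l k - Y l k - JX                 ≈⟨ +-assoc _ _ _ ⟩
          Y l k + (- Y l k - JX)             ≈⟨ +-congˡ (+-comm _ _) ⟩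
          Y l k + (- JX - Y l k)             ≈⟨ +-congˡ (-‿+-comm _ _) ⟩
          Y l k - (JX + Y l k)               ≈⟨ +-congˡ (-‿cong (P.*-Padjᶜ-suc m A skew diag d l k)) ⟩
          Y l k - p * 1ᴹ l k                 ≈⟨ +-congˡ (-‿distribˡ-* _ _) ⟩
          Y l k + - p * 1ᴹ l k               ∎

    private
      tr-scalar : ∀ x → tr (x ·ᴹ 1ᴹ {n ℕ.* 2}) ≈ (n ℕ.* 2) ×ℕ x
      tr-scalar x = trans (sum-cong-≋ entry) (sum-replicate (n ℕ.* 2))
        where
        entry : ∀ (i : Fin (n ℕ.* 2)) → x * 1ᴹ i i ≈ x
        entry i = trans (*-congˡ (F.1ᴹ-diag i)) (*-identityʳ x)

      -- The trace of the coefficient identity, with the J part evaluated by the derivative formula.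
      -- At `j = 0` there is no lower coefficient, and the J part is an empty multiple.
      tr-A*Padjᶜ : ∀ j → (j ℕ.+ j) ×ℕ pfᶜ j + tr (A *ᴹ Padjᶜ j) ≈ (n ℕ.* 2) ×ℕ pfᶜ j
      tr-A*Padjᶜ zero = begin
        0# + tr (A *ᴹ Padjᶜ 0)   ≈⟨ +-identityˡ _ ⟩
        tr (A *ᴹ Padjᶜ 0)        ≈⟨ sum-cong-≋ (λ i → P.*-Padjᶜ-zero m A skew diag i i) ⟩
        tr (pfᶜ 0 ·ᴹ 1ᴹ {n ℕ.* 2})         ≈⟨ tr-scalar (pfᶜ 0) ⟩
        (n ℕ.* 2) ×ℕ pfᶜ 0       ∎
      tr-A*Padjᶜ (suc d) = begin
        (suc d ℕ.+ suc d) ×ℕ p + tr (A *ᴹ Padjᶜ (suc d))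
          ≈⟨ +-congʳ (×-homo-+ p (suc d) (suc d)) ⟩
        suc d ×ℕ p + suc d ×ℕ p + tr (A *ᴹ Padjᶜ (suc d))
          ≈⟨ +-congʳ (P.tr-J*Padjᶜ m A skew diag d) ⟨
        tr (J n *ᴹ Padjᶜ d) + tr (A *ᴹ Padjᶜ (suc d))
          ≈⟨ ∑-distrib-+ (λ i → (J n *ᴹ Padjᶜ d) i i) (λ i → (A *ᴹ Padjᶜ (suc d)) i i) ⟨
        tr (J n *ᴹ Padjᶜ d +ᴹ A *ᴹ Padjᶜ (suc d))
          ≈⟨ sum-cong-≋ (λ i → P.*-Padjᶜ-suc m A skew diag d i i) ⟩
        tr (p ·ᴹ 1ᴹ {n ℕ.* 2})
          ≈⟨ tr-scalar p ⟩
        (n ℕ.* 2) ×ℕ p ∎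
        where p = pfᶜ (suc d)

      -- Of the 2n copies of the coefficient, the 2j on the left are cancelled; 2k remain, which
      -- explains the divisor in the recursion.
      tr-A*Padjᶜ′ : ∀ k j → k ℕ.+ j ≡ n → tr (A *ᴹ Padjᶜ j) ≈ (2 ℕ.* k) ×ℕ pfᶜ j
      tr-A*Padjᶜ′ k j k+j≡n = +-cancelˡ ((j ℕ.+ j) ×ℕ p) _ _ (begin
        (j ℕ.+ j) ×ℕ p + tr (A *ᴹ Padjᶜ j)    ≈⟨ tr-A*Padjᶜ j ⟩
        (n ℕ.* 2) ×ℕ p                        ≈⟨ ×-congˡ {p} count ⟩
        (j ℕ.+ j ℕ.+ 2 ℕ.* k) ×ℕ p            ≈⟨ ×-homo-+ p (j ℕ.+ j) (2 ℕ.* k) ⟩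
        (j ℕ.+ j) ×ℕ p + (2 ℕ.* k) ×ℕ p       ∎)
        where
        p = pfᶜ j
        count : n ℕ.* 2 ≡ j ℕ.+ j ℕ.+ 2 ℕ.* k
        count = ≡.trans (≡.cong (ℕ._* 2) (≡.sym k+j≡n)) (solve 2
          (λ k j → (k :+ j) :* con 2 := j :+ j :+ con 2 :* k) ≡.refl k j)
          where open import Data.Nat.Solver using (module +-*-Solver)
                open +-*-Solver

      *ᴹ-congˡ : ∀ {n} (X : Mat n) {Y Z : Mat n} → Y ≈ᴹ Z → X *ᴹ Y ≈ᴹ X *ᴹ Z
      *ᴹ-congˡ X Y≈Z i k = sum-cong-≋ (λ j → *-congˡ (Y≈Z j k))

    mutual
      -- The two claims follow the mutual recursion of `N` and `coef`. The exponent `j` complements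
      -- the step number to `n`, written as an equation to avoid truncated subtraction.
      N≈Padjᶜ : ∀ k j → suc k ℕ.+ j ≡ n → N n A (suc k) ≈ᴹ Padjᶜ j
      -- Here `j` is `m`. In the step formula the adjugate coefficient at `n` vanishes and the
      -- Pfaffian coefficient at `n` is 1, which leaves -J.
      N≈Padjᶜ zero j ≡.refl i l = sym (begin
        Padjᶜ m i l
          ≈⟨ Padjᶜ-step m i l ⟩
        (J n *ᴹ (A *ᴹ Padjᶜ n)) i l - pfᶜ n * J n i l
          ≈⟨ +-cong (vanish i l) (-‿cong (*-congʳ (coef≈pfᶜ 0 n ≡.refl))) ⟨
        0# - 1# * J n i l
          ≈⟨ trans (+-identityˡ _) (-‿cong (*-identityˡ _)) ⟩
        - J n i l ∎)
        where
        0*ᴹ : ∀ (X : Mat (n ℕ.* 2)) {Y} → Y ≈ᴹ 0ᴹ → 0ᴹ ≈ᴹ X *ᴹ Y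
        0*ᴹ X Y≈0 i k = sym (trans (sum-cong-≋ (λ j → trans (*-congˡ (Y≈0 j k)) (zeroʳ (X i j))))
          (sum-replicate-zero (n ℕ.* 2)))
        vanish : 0ᴹ ≈ᴹ J n *ᴹ (A *ᴹ Padjᶜ n)
        vanish = 0*ᴹ (J n) (λ i k → sym (0*ᴹ A (P.Padjᶜ-top m A skew diag) i k))
      N≈Padjᶜ (suc k) j eq i l = sym (begin
        Padjᶜ j i l
          ≈⟨ Padjᶜ-step j i l ⟩
        (J n *ᴹ (A *ᴹ Padjᶜ (suc j))) i l - pfᶜ (suc j) * J n i l
          ≈⟨ +-cong (*ᴹ-congˡ (J n) (*ᴹ-congˡ A (N≈Padjᶜ k (suc j) eq′)) i l)
                    (-‿cong (*-congʳ (coef≈pfᶜ (suc k) (suc j) eq′))) ⟨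
        (J n *ᴹ (A *ᴹ N n A (suc k))) i l - coef n A (suc k) * J n i l ∎)
        where
        eq′ : suc k ℕ.+ suc j ≡ n
        eq′ = ≡.trans (ℕ.+-suc (suc k) j) eq

      coef≈pfᶜ : ∀ k j → k ℕ.+ j ≡ n → coef n A k ≈ pfᶜ j
      coef≈pfᶜ zero    j ≡.refl = sym (trans
        (reflexive (≡.cong pfᶜ (≡.sym (ℕ.+-identityʳ n)))) (P.pfᶜ-top m A skew diag 0))
      coef≈pfᶜ (suc k) j eq = begin
        tr (A *ᴹ N n A (suc k)) ÷ + (2 ℕ.* suc k)
          ≈⟨ ÷-cong (+ (2 ℕ.* suc k)) (sum-cong-≋ (λ i → *ᴹ-congˡ A (N≈Padjᶜ k j eq) i i)) ⟩
        tr (A *ᴹ Padjᶜ j) ÷ + (2 ℕ.* suc k)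
          ≈⟨ ÷-cong (+ (2 ℕ.* suc k)) (tr-A*Padjᶜ′ (suc k) j eq) ⟩
        ((2 ℕ.* suc k) ×ℕ pfᶜ j) ÷ + (2 ℕ.* suc k)
          ≈⟨ ×-÷ _ (pfᶜ j) ⟩
        pfᶜ j ∎

    coef-pf : coef n A n ≈ pf A
    coef-pf = trans (coef≈pfᶜ n 0 (ℕ.+-identityʳ n)) (P.pfᶜ-zero m A skew diag)

    N-Padj : N n A n ≈ᴹ Padj A
    N-Padj i j = trans (N≈Padjᶜ m 0 (ℕ.+-identityʳ n) i j) (P.Padjᶜ-zero m A skew diag i j)

    A*N : A *ᴹ N n A n ≈ᴹ pf A ·ᴹ 1ᴹ
    A*N i k = trans (*ᴹ-congˡ A N-Padj i k) (F.*-Padj m A skew diag i k)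

    open Over R using (t; C; _≈ᵗ_; _*ᵗ_; _^ᵗ_; _·ᴹᵗ_; _+ᴹᵗ_; Jᵗ; pfᵗ; Σᵗ[_]; Cᴹ)

    pf-pencil : pfᵗ (t ·ᴹᵗ Jᵗ n +ᴹᵗ Cᴹ A)
      ≈ᵗ Σᵗ[ (λ (j : Fin (suc n)) → C (coef n A (n ∸ toℕ j)) *ᵗ t ^ᵗ toℕ j) ]
    pf-pencil k = begin
      coeff (pfᵗ (t ·ᴹᵗ Jᵗ n +ᴹᵗ Cᴹ A)) k
        ≡⟨ ≡.cong (λ p → coeff p k) (pf-≡ λ i j → ≡.cong (λ p → addₚ (mulₚ t p) (C (A i j))) (J-≡ n i j)) ⟩
      pfᶜ k
        ≈⟨ PowerSum.coeff-∑tʲ commutativeRing (suc n) (λ j → coef n A (n ∸ j)) pfᶜ low high k ⟩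
      coeff (Σᵗ[ (λ j → cᵗ j *ᵗ t Mᵗ.^ toℕ j) ]) k
        ≡⟨ ≡.cong (λ p → coeff p k) (sum-cong-≗ {suc n} λ j → ≡.cong (mulₚ (cᵗ j)) (^-≡ t (toℕ j))) ⟨
      coeff (Σᵗ[ (λ j → cᵗ j *ᵗ t ^ᵗ toℕ j) ]) k ∎
      where
      open Polynomial rawRing using (coeff; addₚ; mulₚ)
      open SameOperations commutativeRing
      module T = CommutativeRing (PolynomialRing.commutativeRing commutativeRing)
      module Mᵗ = Matrix T.rawRing
      open import Algebra.Properties.Semiring.Sum T.semiring using (sum-cong-≗)
      cᵗ : Fin (suc n) → List Carrier
      cᵗ j = C (coef n A (n ∸ toℕ j))
      low : ∀ j → j ℕ.< suc n → pfᶜ j ≈ coef n A (n ∸ j)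
      low j (ℕ.s≤s j≤n) = sym (coef≈pfᶜ (n ∸ j) j (ℕ.m∸n+n≡m j≤n))
      high : ∀ j → pfᶜ (suc n ℕ.+ j) ≈ 0#
      high j = trans (reflexive (≡.cong pfᶜ (≡.sym (ℕ.+-suc n j)))) (P.pfᶜ-top m A skew diag (suc j))

-- Correctness of the straight-line program.

module ProgramCorrect {c ℓ} (R : CommutativeℚAlgebra c ℓ) where

  open import Data.Integer.Base using (+_)
  open CommutativeℚAlgebra R hiding (zero)
  open Matrix rawRing
  open Recursion R
  open Programs R
  open import Relation.Binary.Reasoning.Setoid setoid

  infix 4 _≃_

  _≃_ : ∀ {I : Set} → (I → Carrier) → (I → Carrier) → Set ℓ
  ρ ≃ σ = ∀ x → ρ x ≈ σ x

  eval-cong : ∀ {I : Set} {ρ σ : I → Carrier} → ρ ≃ σ → ∀ o → eval ρ o ≈ eval σ o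
  eval-cong ρ≃σ (copy x)  = ρ≃σ x
  eval-cong ρ≃σ (const r) = refl
  eval-cong ρ≃σ (add x y) = +-cong (ρ≃σ x) (ρ≃σ y)
  eval-cong ρ≃σ (sub x y) = +-cong (ρ≃σ x) (-‿cong (ρ≃σ y))
  eval-cong ρ≃σ (mul x y) = *-cong (ρ≃σ x) (ρ≃σ y)
  eval-cong ρ≃σ (div x d) = *-congˡ (ρ≃σ x)

  run-cong : ∀ {s t} (p : Program s t) {ρ σ : Reg s → Carrier} → ρ ≃ σ → run p ρ ≃ run p σ
  run-cong halt    ρ≃σ = ρ≃σ
  run-cong (f ⨾ p) ρ≃σ = run-cong p (λ x → eval-cong ρ≃σ (f x))

  run-then : ∀ {s t u} (p : Program s t) (q : Program t u) ρ → run (p then q) ρ ≡ run q (run p ρ)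
  run-then halt    q ρ = ≡.refl
  run-then (f ⨾ p) q ρ = run-then p q _

  -- After each stage the actual registers are replaced by the matrices and scalars they represent,
  -- so the next stage can be analysed by itself.
  run-then-≃ : ∀ {s t u} (p : Program s t) (q : Program t u) {ρ σ} →
               run p ρ ≃ σ → run (p then q) ρ ≃ run q σ
  run-then-≃ p q {ρ} eq x =
    trans (reflexive (≡.cong (λ τ → τ x) (run-then p q ρ))) (run-cong q eq x)

  eval-weaken : ∀ {I K : Set} (ρ : K ⊎ I → Carrier) o → eval ρ (weaken o) ≈ eval (ρ ∘ inj₂) o
  eval-weaken ρ (copy x)  = refl
  eval-weaken ρ (const r) = refl
  eval-weaken ρ (add x y) = refl
  eval-weaken ρ (sub x y) = refl
  eval-weaken ρ (mul x y) = refl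
  eval-weaken ρ (div x d) = refl

  run-keep : ∀ {r s t} (p : Program s t) (ρ : Reg (r ⊞ s) → Carrier) →
             run (keep {r = r} p) ρ ≃ Sum.[ ρ ∘ inj₁ , run p (ρ ∘ inj₂) ]
  run-keep         halt    ρ (inj₁ x) = refl
  run-keep         halt    ρ (inj₂ y) = refl
  run-keep {r = r} (f ⨾ p) ρ (inj₁ x) = run-keep {r = r} p _ (inj₁ x)
  run-keep {r = r} (f ⨾ p) ρ (inj₂ y) =
    trans (run-keep {r = r} p _ (inj₂ y)) (run-cong p (λ x → eval-weaken ρ (f x)) y)

  module _ (mm : MatrixMultiplication) (m : ℕ) where

    open MatrixMultiplication mm

    run-keep-program : ∀ {r} (ρ : Reg (r ⊞ M mm m ⊞ M mm m) → Carrier) {P Q : Mat (m ℕ.* 2)} →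
      ρ ∘ inj₂ ≃ Sum.[ uncurry P , uncurry Q ] →
      run (keep {r = r} (program (m ℕ.* 2))) ρ ≃ Sum.[ ρ ∘ inj₁ , uncurry (P *ᴹ Q) ]
    run-keep-program {r} ρ ρ≃ (inj₁ x)       = run-keep {r = r} (program _) ρ (inj₁ x)
    run-keep-program {r} ρ {P} {Q} ρ≃ (inj₂ (i , j)) = begin
      run (keep {r = r} (program _)) ρ (inj₂ (i , j))       ≈⟨ run-keep {r = r} (program _) ρ (inj₂ (i , j)) ⟩
      run (program _) (ρ ∘ inj₂) (i , j)                    ≈⟨ run-cong (program _) ρ≃ (i , j) ⟩
      run (program _) Sum.[ uncurry P , uncurry Q ] (i , j) ≈⟨ correct _ P Q i j ⟩
      (P *ᴹ Q) i j                                          ∎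

    addEntries : List (Fin (m ℕ.* 2)) → Program (M mm m ⊞ scalar) (M mm m ⊞ scalar)
    addEntries = List.foldr (λ i p → addEntry mm m i ⨾ p) halt

    -- Stated for any enumeration `h` and any initial value of the accumulator, because the
    -- induction shifts the one and changes the other.
    run-addEntries : ∀ {n} (h : Fin n → Fin (m ℕ.* 2)) (ρ : Reg (M mm m ⊞ scalar) → Carrier) →
      run (addEntries (List.tabulate h)) ρ ≃
      Sum.[ ρ ∘ inj₁ , (λ _ → ρ (inj₂ tt) + Σ[ (λ i → ρ (inj₁ (h i , h i))) ]) ]
    run-addEntries {zero}  h ρ (inj₁ x)  = refl
    run-addEntries {zero}  h ρ (inj₂ tt) = sym (+-identityʳ _)
    run-addEntries {suc n} h ρ (inj₁ x)  =
      run-addEntries (h ∘ suc) (eval ρ ∘ addEntry mm m (h zero)) (inj₁ x)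
    run-addEntries {suc n} h ρ (inj₂ tt) = trans
      (run-addEntries (h ∘ suc) (eval ρ ∘ addEntry mm m (h zero)) (inj₂ tt)) (+-assoc _ _ _)

    run-trace : ∀ P → run (trace mm m) (uncurry P) ≃ Sum.[ uncurry P , constantly (tr P) ]
    run-trace P (inj₁ x)  = run-addEntries id _ (inj₁ x)
    run-trace P (inj₂ tt) = trans (run-addEntries id _ (inj₂ tt)) (+-identityˡ _)

    module _ (A : Mat (m ℕ.* 2)) where

      run-coefficient : ∀ k X {ρ} → ρ ≃ Sum.[ uncurry A , uncurry X ] →
        run (coefficient mm m k) ρ ≃
        Sum.[ uncurry A , Sum.[ uncurry (A *ᴹ X) , constantly (tr (A *ᴹ X) ÷ + (2 ℕ.* suc k)) ] ]
      run-coefficient k X {ρ} ρ≃ = λ where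
          (inj₁ x)         → trans (first _ (inj₁ x)) (second _ (inj₁ x))
          (inj₂ (inj₁ x))  → trans (first _ (inj₂ (inj₁ x))) (second _ (inj₂ (inj₁ x)))
          (inj₂ (inj₂ tt)) → trans (first _ (inj₂ (inj₂ tt))) (second _ (inj₂ (inj₂ tt)))
        where
        product : run (keep {r = M mm m} (program (m ℕ.* 2))) _ ≃
                  Sum.[ uncurry A , uncurry (A *ᴹ X) ]
        product (inj₁ x) = trans
          (run-keep-program _ {A} {X} (λ { (inj₁ x) → ρ≃ (inj₁ x) ; (inj₂ x) → ρ≃ (inj₂ x) }) (inj₁ x))
          (ρ≃ (inj₁ x))
        product (inj₂ x) =
          run-keep-program _ {A} {X} (λ { (inj₁ x) → ρ≃ (inj₁ x) ; (inj₂ x) → ρ≃ (inj₂ x) }) (inj₂ x)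
        traced : run (keep {r = M mm m} (trace mm m)) Sum.[ uncurry A , uncurry (A *ᴹ X) ] ≃
                 Sum.[ uncurry A , Sum.[ uncurry (A *ᴹ X) , constantly (tr (A *ᴹ X)) ] ]
        traced (inj₁ x) = run-keep {r = M mm m} (trace mm m) _ (inj₁ x)
        traced (inj₂ y) =
          trans (run-keep {r = M mm m} (trace mm m) _ (inj₂ y)) (run-trace (A *ᴹ X) y)
        first : ∀ {u} (q : Program _ u) → _
        first q = run-then-≃ (keep (program _)) q product
        second : ∀ {u} (q : Program _ u) → _
        second q = run-then-≃ (keep (trace mm m)) q traced

      run-next : ∀ P x {ρ} → ρ ≃ Sum.[ uncurry A , Sum.[ uncurry P , constantly x ] ] →
        run (next mm m) ρ ≃ Sum.[ uncurry A , uncurry (J m *ᴹ P -ᴹ x ·ᴹ J m) ]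
      run-next P x {ρ} ρ≃ = λ where
          (inj₁ y)       → trans (first _ (inj₁ y)) (ρ≃ (inj₁ y))
          (inj₂ (i , j)) → trans (first _ (inj₂ (i , j))) (+-congˡ (-‿cong (*-congʳ (ρ≃ (inj₂ (inj₂ tt))))))
        where
        σ : Reg (M mm m ⊞ (scalar ⊞ M mm m) ⊞ M mm m) → Carrier
        σ = Sum.[ ρ ∘ inj₁ , Sum.[ Sum.[ constantly (ρ (inj₂ (inj₂ tt))) , uncurry (J m) ] , uncurry (J m *ᴹ P) ] ]
        product : run (keep {r = M mm m} (keep {r = scalar ⊞ M mm m} (program (m ℕ.* 2)))) _ ≃ σ
        product (inj₁ y) = run-keep {r = M mm m} (keep (program _)) _ (inj₁ y)
        product (inj₂ (inj₁ (inj₁ tt))) = trans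
          (run-keep {r = M mm m} (keep (program _)) _ (inj₂ (inj₁ (inj₁ tt))))
          (run-keep {r = scalar ⊞ M mm m} (program _) _ (inj₁ (inj₁ tt)))
        product (inj₂ (inj₁ (inj₂ y))) = trans
          (run-keep {r = M mm m} (keep (program _)) _ (inj₂ (inj₁ (inj₂ y))))
          (run-keep {r = scalar ⊞ M mm m} (program _) _ (inj₁ (inj₂ y)))
        product (inj₂ (inj₂ y)) = trans
          (run-keep {r = M mm m} (keep (program _)) _ (inj₂ (inj₂ y)))
          (run-keep-program {scalar ⊞ M mm m} _ {J m} {P}
            (λ { (inj₁ _) → refl ; (inj₂ z) → ρ≃ (inj₂ (inj₁ z)) }) (inj₂ y))
        first : ∀ {u} (q : Program _ u) → _
        first q = run-then-≃ (keep {r = M mm m} (keep {r = scalar ⊞ M mm m} (program _))) q product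

      run-iterate : ∀ k {ρ} → ρ ≃ Sum.[ uncurry A , uncurry (N m A 1) ] →
        run (iterate mm m k) ρ ≃ Sum.[ uncurry A , uncurry (N m A (suc k)) ]
      run-iterate zero    ρ≃ = ρ≃
      run-iterate (suc k) ρ≃ x = trans
        (run-then-≃ (iterate mm m k) _ (run-iterate k ρ≃) x)
        (trans (run-then-≃ (coefficient mm m k) (next mm m) (run-coefficient k (N m A (suc k)) (λ _ → refl)) x)
          (trans (run-next (A *ᴹ N m A (suc k)) (coef m A (suc k)) (λ _ → refl) x) (reflexive (result x))))
        where
        result : ∀ x → Sum.[ uncurry A , uncurry (J m *ᴹ (A *ᴹ N m A (suc k)) -ᴹ coef m A (suc k) ·ᴹ J m) ] x ≡
                       Sum.[ uncurry A , uncurry (N m A (suc (suc k))) ] x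
        result (inj₁ x) = ≡.refl
        result (inj₂ x) = ≡.refl

  run-pfaffianProgram : ∀ mm m (A : Mat (m ℕ.* 2)) →
    run (pfaffianProgram mm m) (uncurry A) tt ≈ coef m A m
  run-pfaffianProgram mm zero    A = refl
  run-pfaffianProgram mm (suc k) A = trans
    (run-then-≃ (initialise mm m) rest₁ {σ = Sum.[ uncurry A , uncurry (N m A 1) ]}
      (λ { (inj₁ x) → refl ; (inj₂ x) → refl }) tt)
    (trans (run-then-≃ (iterate mm m k) rest₂ (run-iterate mm m A k (λ _ → refl)) tt)
      (run-then-≃ (coefficient mm m k) rest₃ (run-coefficient mm m A k (N m A m) (λ _ → refl)) tt))
    where
    m = suc k
    rest₃ : Program (M mm m ⊞ M mm m ⊞ scalar) scalar
    rest₃ = (λ _ → copy (inj₂ (inj₂ tt))) ⨾ halt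
    rest₂ = coefficient mm m k then rest₃
    rest₁ = iterate mm m k then rest₂

-- Cost and divisors of the program.

module ProgramCost {c ℓ} (R : CommutativeℚAlgebra c ℓ) where

  open import Data.List.Base using (length; map; concatMap; cartesianProduct; allFin)
  open import Data.Nat.Base using (_+_; _*_; _≤_; _<_; z≤n; s≤s)
  open Programs R

  total : ∀ {s} → (Reg s → ℕ) → ℕ
  total {s} g = sum (map g (registers s))

  total-⊞ : ∀ {s t} (g : Reg (s ⊞ t) → ℕ) → total {s ⊞ t} g ≡ total {s} (g ∘ inj₁) + total {t} (g ∘ inj₂)
  total-⊞ {s} {t} g = begin
    sum (map g (map inj₁ (registers s) ++ map inj₂ (registers t)))
      ≡⟨ ≡.cong sum (List.map-++ g (map inj₁ (registers s)) _) ⟩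
    sum (map g (map inj₁ (registers s)) ++ map g (map inj₂ (registers t)))
      ≡⟨ sum-++ (map g (map inj₁ (registers s))) _ ⟩
    sum (map g (map inj₁ (registers s))) + sum (map g (map inj₂ (registers t)))
      ≡⟨ ≡.cong₂ (λ xs ys → sum xs + sum ys) (List.map-∘ (registers s)) (List.map-∘ (registers t)) ⟨
    total {s} (g ∘ inj₁) + total {t} (g ∘ inj₂) ∎
    where open ≡.≡-Reasoning

  sum-bound : ∀ {A : Set} (g : A → ℕ) b → (∀ x → g x ≤ b) → ∀ xs → sum (map g xs) ≤ length xs * b
  sum-bound g b g≤b []       = z≤n
  sum-bound g b g≤b (x ∷ xs) = ℕ.+-mono-≤ (g≤b x) (sum-bound g b g≤b xs)

  total-0 : ∀ {s} {g : Reg s → ℕ} → (∀ x → g x ≤ 0) → total {s} g ≡ 0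
  total-0 {s} {g} g≤0 = ℕ.n≤0⇒n≡0
    (ℕ.≤-trans (sum-bound g 0 g≤0 (registers s)) (ℕ.≤-reflexive (ℕ.*-zeroʳ (length (registers s)))))

  length-product : ∀ {A B : Set} (xs : List A) (ys : List B) →
                   length (cartesianProduct xs ys) ≡ length xs * length ys
  length-product []       ys = ≡.refl
  length-product (x ∷ xs) ys = ≡.trans (List.length-++ (map (x ,_) ys))
    (≡.cong₂ _+_ (List.length-map (x ,_) ys) (length-product xs ys))

  total-mat : ∀ {n} {g : Reg (mat n) → ℕ} → (∀ x → g x ≤ 1) → total {mat n} g ≤ n * n
  total-mat {n} {g} g≤1 = begin
    total {mat n} g                          ≤⟨ sum-bound g 1 g≤1 (registers (mat n)) ⟩
    length (registers (mat n)) * 1           ≡⟨ ℕ.*-identityʳ _ ⟩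
    length (registers (mat n))               ≡⟨ length-product (allFin n) (allFin n) ⟩
    length (allFin n) * length (allFin n)    ≡⟨ ≡.cong (λ l → l * l) (List.length-tabulate {n = n} id) ⟩
    n * n                                    ∎
    where open ℕ.≤-Reasoning

  opCost-weaken : ∀ {I K : Set} (o : Op I) → opCost (weaken {K = K} o) ≡ opCost o
  opCost-weaken (copy x)  = ≡.refl
  opCost-weaken (const r) = ≡.refl
  opCost-weaken (add x y) = ≡.refl
  opCost-weaken (sub x y) = ≡.refl
  opCost-weaken (mul x y) = ≡.refl
  opCost-weaken (div x d) = ≡.refl

  -- Records, so that the layer or program can be inferred.

  record LayerCosts {I : Set} {s} (f : Reg s → Op I) (b : ℕ) : Set where
    constructor layerCosts
    field layerBound : total {s} (opCost ∘ f) ≤ b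

  record Costs {s t} (p : Program s t) (b : ℕ) : Set where
    constructor costs
    field bound : cost p ≤ b

  open Costs public

  layer-free : ∀ {I s} {f : Reg s → Op I} → (∀ x → opCost (f x) ≤ 0) → LayerCosts {s = s} f 0
  layer-free {s = s} free = layerCosts (ℕ.≤-reflexive (total-0 {s} free))

  layer-scalar : ∀ {I} {f : Reg scalar → Op I} → opCost (f tt) ≤ 1 → LayerCosts {s = scalar} f 1
  layer-scalar o≤1 = layerCosts (ℕ.≤-trans (ℕ.≤-reflexive (ℕ.+-identityʳ _)) o≤1)

  layer-mat : ∀ {I n} {f : Reg (mat n) → Op I} → (∀ x → opCost (f x) ≤ 1) → LayerCosts {s = mat n} f (n * n)
  layer-mat {n = n} o≤1 = layerCosts (total-mat {n} o≤1)

  layer-⊞ : ∀ {I s t} {f : Reg (s ⊞ t) → Op I} {a b} →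
            LayerCosts {s = s} (f ∘ inj₁) a → LayerCosts {s = t} (f ∘ inj₂) b →
            LayerCosts {s = s ⊞ t} f (a + b)
  layer-⊞ {s = s} {t} (layerCosts a) (layerCosts b) =
    layerCosts (ℕ.≤-trans (ℕ.≤-reflexive (total-⊞ {s} {t} _)) (ℕ.+-mono-≤ a b))

  costs-halt : ∀ {s} → Costs (halt {s}) 0
  costs-halt = costs z≤n

  costs-⨾ : ∀ {s t u} {f : Reg t → Op (Reg s)} {p : Program t u} {a b} →
            LayerCosts {s = t} f a → Costs p b → Costs (f ⨾ p) (a + b)
  costs-⨾ (layerCosts a) (costs b) = costs (ℕ.+-mono-≤ a b)

  costs-then : ∀ {s t u} (p : Program s t) {q : Program t u} {a b} →
               Costs p a → Costs q b → Costs (p then q) (a + b)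
  costs-then p {q} (costs a) (costs b) =
    costs (ℕ.≤-trans (ℕ.≤-reflexive (cost-then p q)) (ℕ.+-mono-≤ a b))
    where
    cost-then : ∀ {s t u} (p : Program s t) (q : Program t u) → cost (p then q) ≡ cost p + cost q
    cost-then halt                    q = ≡.refl
    cost-then (_⨾_ {t = t} f p) q = ≡.trans (≡.cong (total {t} (opCost ∘ f) +_) (cost-then p q))
      (≡.sym (ℕ.+-assoc (total {t} (opCost ∘ f)) (cost p) (cost q)))

  cost-keep : ∀ {r s t} (p : Program s t) → cost (keep {r = r} p) ≡ cost p
  cost-keep halt = ≡.refl
  cost-keep {r} (_⨾_ {t = t} f p) = ≡.cong₂ _+_
    (≡.trans (total-⊞ {r} {t} _)
      (≡.cong₂ _+_ (total-0 {r} (λ _ → z≤n)) (≡.cong sum (List.map-cong (opCost-weaken ∘ f) (registers t)))))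
    (cost-keep p)

  costs-keep : ∀ {r s t} {p : Program s t} {b} → Costs p b → Costs (keep {r = r} p) b
  costs-keep {r} {p = p} (costs b) = costs (ℕ.≤-trans (ℕ.≤-reflexive (cost-keep {r} p)) b)

  costs-≤ : ∀ {s t} {p : Program s t} {a b} → a ≤ b → Costs p a → Costs p b
  costs-≤ a≤b (costs a) = costs (ℕ.≤-trans a a≤b)

  opDivisors-weaken : ∀ {I K : Set} (o : Op I) → opDivisors (weaken {K = K} o) ≡ opDivisors o
  opDivisors-weaken (copy x)  = ≡.refl
  opDivisors-weaken (const r) = ≡.refl
  opDivisors-weaken (add x y) = ≡.refl
  opDivisors-weaken (sub x y) = ≡.refl
  opDivisors-weaken (mul x y) = ≡.refl
  opDivisors-weaken (div x d) = ≡.refl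

  concatMap-[] : ∀ {A B : Set} (xs : List A) → concatMap (λ _ → List.[] {A = B}) xs ≡ []
  concatMap-[] []       = ≡.refl
  concatMap-[] (x ∷ xs) = concatMap-[] xs

  divisors-keep : ∀ {r s t} (p : Program s t) → divisors (keep {r = r} p) ≡ divisors p
  divisors-keep halt = ≡.refl
  divisors-keep {r} (_⨾_ {t = t} f p) = ≡.cong₂ _++_ layer (divisors-keep p)
    where
    open ≡.≡-Reasoning
    g : Reg (r ⊞ t) → List ℤ
    g = opDivisors ∘ Sum.[ (λ x → copy (inj₁ x)) , (λ y → weaken (f y)) ]
    layer : concatMap g (registers (r ⊞ t)) ≡ concatMap (opDivisors ∘ f) (registers t)
    layer = begin
      concatMap g (map inj₁ (registers r) ++ map inj₂ (registers t))
        ≡⟨ List.concatMap-++ g (map inj₁ (registers r)) _ ⟩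
      concatMap g (map inj₁ (registers r)) ++ concatMap g (map inj₂ (registers t))
        ≡⟨ ≡.cong₂ _++_ (List.concatMap-map g inj₁ (registers r)) (List.concatMap-map g inj₂ (registers t)) ⟩
      concatMap (λ _ → []) (registers r) ++ concatMap (opDivisors ∘ weaken ∘ f) (registers t)
        ≡⟨ ≡.cong₂ _++_ (concatMap-[] (registers r)) (List.concatMap-cong (opDivisors-weaken ∘ f) (registers t)) ⟩
      concatMap (opDivisors ∘ f) (registers t) ∎

  divisors-then : ∀ {s t u} (p : Program s t) (q : Program t u) →
                  divisors (p then q) ≡ divisors p ++ divisors q
  divisors-then halt    q = ≡.refl
  divisors-then (_⨾_ {t = t} f p) q = ≡.trans (≡.cong (layer ++_) (divisors-then p q))
                                              (≡.sym (List.++-assoc layer (divisors p) (divisors q)))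
    where layer = concatMap (opDivisors ∘ f) (registers t)

  -- A record, so that the program can be inferred.
  record DividesOnlyBy (Q : ℤ → Set) {s t} (p : Program s t) : Set where
    constructor divisorsIn
    field allDivisors : All Q (divisors p)

  open DividesOnlyBy public

  module _ {Q : ℤ → Set} where

    only-halt : ∀ {s} → DividesOnlyBy Q (halt {s})
    only-halt = divisorsIn []

    only-⨾ : ∀ {s t u} {f : Reg t → Op (Reg s)} {p : Program t u} →
             (∀ x → All Q (opDivisors (f x))) → DividesOnlyBy Q p → DividesOnlyBy Q (f ⨾ p)
    only-⨾ {t = t} Qf (divisorsIn Qp) =
      divisorsIn (All.++⁺ (All.concat⁺ (All.map⁺ (All.universal Qf (registers t)))) Qp)

    only-then : ∀ {s t u} (p : Program s t) {q : Program t u} →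
                DividesOnlyBy Q p → DividesOnlyBy Q q → DividesOnlyBy Q (p then q)
    only-then p {q} (divisorsIn Qp) (divisorsIn Qq) =
      divisorsIn (≡.subst (All Q) (≡.sym (divisors-then p q)) (All.++⁺ Qp Qq))

    only-keep : ∀ {r s t} {p : Program s t} → DividesOnlyBy Q p → DividesOnlyBy Q (keep {r = r} p)
    only-keep {p = p} (divisorsIn Qp) = divisorsIn (≡.subst (All Q) (≡.sym (divisors-keep p)) Qp)

  module _ (mm : MatrixMultiplication) (m : ℕ) where

    open MatrixMultiplication mm

    n = m * 2
    μ = cost (program n)

    costs-trace : Costs (trace mm m) n
    costs-trace = costs-≤ (ℕ.≤-reflexive (List.length-tabulate {n = n} id))
      (costs-⨾ (layer-free (λ { (inj₁ _) → z≤n ; (inj₂ _) → z≤n })) (addEntries (allFin n)))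
      where
      addEntries : ∀ is → Costs (List.foldr (λ i p → addEntry mm m i ⨾ p) halt is) (length is)
      addEntries []       = costs-halt
      addEntries (i ∷ is) = costs-⨾ {f = addEntry mm m i}
        (layer-⊞ (layer-free (λ _ → z≤n)) (layer-scalar ℕ.≤-refl)) (addEntries is)

    costs-coefficient : ∀ k → Costs (coefficient mm m k) (μ + (n + 1))
    costs-coefficient k =
      costs-⨾ (layer-free (λ { (inj₁ _) → z≤n ; (inj₂ _) → z≤n }))
        (costs-then (keep (program n)) (costs-keep (costs ℕ.≤-refl))
          (costs-then (keep (trace mm m)) (costs-keep costs-trace)
            (costs-⨾ (layer-⊞ (layer-free (λ _ → z≤n))
                              (layer-⊞ (layer-free (λ _ → z≤n)) (layer-scalar ℕ.≤-refl)))
              costs-halt)))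

    costs-next : Costs (next mm m) (μ + (n * n + n * n))
    costs-next = costs-≤
      (ℕ.≤-reflexive (≡.cong (μ +_) (≡.cong₂ _+_ (ℕ.+-identityʳ (n * n)) (ℕ.+-identityʳ (n * n)))))
      (costs-⨾ (layer-free (λ { (inj₁ _) → z≤n ; (inj₂ (inj₁ (inj₁ tt))) → z≤n
                              ; (inj₂ (inj₁ (inj₂ _))) → z≤n ; (inj₂ (inj₂ (inj₁ _))) → z≤n
                              ; (inj₂ (inj₂ (inj₂ _))) → z≤n }))
        (costs-then (keep (keep (program n))) (costs-keep (costs-keep (costs ℕ.≤-refl)))
          (costs-⨾ (layer-⊞ (layer-free (λ _ → z≤n))
                            (layer-⊞ (layer-mat (λ _ → ℕ.≤-refl)) (layer-free (λ _ → z≤n))))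
            (costs-⨾ (layer-⊞ (layer-free (λ _ → z≤n)) (layer-mat (λ _ → ℕ.≤-refl)))
              costs-halt))))

    -- One round: a product, `n` additions for the trace and one division; then a second product,
    -- `n * n` multiplications for the multiple of J and `n * n` subtractions.
    stepCost = (μ + (n + 1)) + (μ + (n * n + n * n))

    costs-iterate : ∀ k → Costs (iterate mm m k) (k * stepCost)
    costs-iterate zero    = costs-halt
    costs-iterate (suc k) = costs-≤ (ℕ.≤-reflexive (ℕ.+-comm (k * stepCost) stepCost))
      (costs-then (iterate mm m k) (costs-iterate k)
        (costs-then (coefficient mm m k) (costs-coefficient k) costs-next))

  costs-pfaffianProgram : ∀ mm m → Costs (pfaffianProgram mm m) (m * stepCost mm m)
  costs-pfaffianProgram mm zero    = costs-⨾ (layer-free (λ _ → z≤n)) costs-halt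
  costs-pfaffianProgram mm (suc k) = costs-≤ enough
    (costs-then (initialise mm m)
      (costs-⨾ (layer-free (λ { (inj₁ _) → z≤n ; (inj₂ _) → z≤n })) costs-halt)
      (costs-then (iterate mm m k) (costs-iterate mm m k)
        (costs-then (coefficient mm m k) (costs-coefficient mm m k)
          (costs-⨾ (layer-free (λ _ → z≤n)) costs-halt))))
    where
    m = suc k
    -- The last round stops after its coefficient; it is charged as a full one.
    enough : k * stepCost mm m + (μ mm m + (n mm m + 1) + 0) ≤ m * stepCost mm m
    enough = ℕ.≤-trans
      (ℕ.+-monoʳ-≤ (k * stepCost mm m)
        (ℕ.≤-trans (ℕ.≤-reflexive (ℕ.+-identityʳ _)) (ℕ.m≤m+n (μ mm m + (n mm m + 1)) _)))
      (ℕ.≤-reflexive (ℕ.+-comm (k * stepCost mm m) (stepCost mm m)))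

  module _ (mm : MatrixMultiplication) (m : ℕ) where

    open MatrixMultiplication mm

    AllowedDivisor : ℤ → Set
    AllowedDivisor d = (∃[ k ] 1 ≤ k × k ≤ m × d ≡ ℤ.+ (2 * k)) ⊎ d ∈ divisors (program (m * 2))

    allowed-program : ∀ {r} → DividesOnlyBy AllowedDivisor (keep {r = r} (program (m * 2)))
    allowed-program = only-keep (divisorsIn (All.tabulate inj₂))

    allowed-trace : DividesOnlyBy AllowedDivisor (trace mm m)
    allowed-trace = only-⨾ (λ { (inj₁ _) → [] ; (inj₂ tt) → [] }) (addEntries (allFin _))
      where
      addEntries : ∀ is → DividesOnlyBy AllowedDivisor (List.foldr (λ i p → addEntry mm m i ⨾ p) halt is)
      addEntries []       = only-halt
      addEntries (i ∷ is) = only-⨾ {f = addEntry mm m i} (λ { (inj₁ _) → [] ; (inj₂ tt) → [] }) (addEntries is)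

    -- Indices are shifted: `coefficient mm m k` produces the coefficient number `suc k` and divides
    -- by `2 * suc k`, so `k < m` keeps the divisor in range.
    allowed-coefficient : ∀ k → k < m → DividesOnlyBy AllowedDivisor (coefficient mm m k)
    allowed-coefficient k k<m =
      only-⨾ (λ { (inj₁ _) → [] ; (inj₂ _) → [] })
        (only-then (keep (program (m * 2))) allowed-program
          (only-then (keep (trace mm m)) (only-keep allowed-trace)
            (only-⨾ (λ { (inj₁ _) → [] ; (inj₂ (inj₁ _)) → []
                      ; (inj₂ (inj₂ tt)) → inj₁ (suc k , s≤s z≤n , k<m , ≡.refl) ∷ [] }) only-halt)))

    allowed-next : DividesOnlyBy AllowedDivisor (next mm m)
    allowed-next =
      only-⨾ (λ { (inj₁ _) → [] ; (inj₂ (inj₁ (inj₁ tt))) → [] ; (inj₂ (inj₁ (inj₂ _))) → []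
               ; (inj₂ (inj₂ (inj₁ _))) → [] ; (inj₂ (inj₂ (inj₂ _))) → [] })
        (only-then (keep (keep (program (m * 2)))) (only-keep allowed-program)
          (only-⨾ (λ { (inj₁ _) → [] ; (inj₂ (inj₁ _)) → [] ; (inj₂ (inj₂ _)) → [] })
            (only-⨾ (λ { (inj₁ _) → [] ; (inj₂ _) → [] }) only-halt)))

    allowed-iterate : ∀ k → k ≤ m → DividesOnlyBy AllowedDivisor (iterate mm m k)
    allowed-iterate zero    _   = only-halt
    allowed-iterate (suc k) k<m = only-then (iterate mm m k) (allowed-iterate k (ℕ.<⇒≤ k<m))
      (only-then (coefficient mm m k) (allowed-coefficient k k<m) allowed-next)

  allowed-pfaffianProgram : ∀ mm m → DividesOnlyBy (AllowedDivisor mm m) (pfaffianProgram mm m)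
  allowed-pfaffianProgram mm zero    = only-⨾ (λ _ → []) only-halt
  allowed-pfaffianProgram mm (suc k) =
    only-then (initialise mm m) (only-⨾ (λ { (inj₁ _) → [] ; (inj₂ _) → [] }) only-halt)
      (only-then (iterate mm m k) (allowed-iterate mm m k (ℕ.n≤1+n k))
        (only-then (coefficient mm m k) (allowed-coefficient mm m k ℕ.≤-refl) (only-⨾ (λ _ → []) only-halt)))
    where m = suc k

open import Data.Nat.Base using (_+_; _*_; _≤_; _<_; _^_; _⊔_; z≤n; s≤s)

-- Real exponents

-- The normalised fraction is in lowest terms; passing to unnormalised rationals keeps the
-- denominator `suc b` visible.
/-1 : ∀ a b → ℚ.toℚᵘ (ℤ.+ a ℚ./ suc b ℚ.- 1ℚ) ℚᵘ.≃ ℚᵘ.mkℚᵘ (a ℤ.⊖ suc b) b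
/-1 a b = begin
  ℚ.toℚᵘ (ℤ.+ a ℚ./ suc b ℚ.- 1ℚ)
    ≈⟨ ℚ.toℚᵘ-homo-+ (ℤ.+ a ℚ./ suc b) (ℚ.- 1ℚ) ⟩
  ℚ.toℚᵘ (ℤ.+ a ℚ./ suc b) ℚᵘ.+ ℚᵘ.mkℚᵘ ℤ.-[1+ 0 ] 0
    ≈⟨ ℚᵘ.+-congˡ _ (ℚ.toℚᵘ-fromℚᵘ (ℚᵘ.mkℚᵘ (ℤ.+ a) b)) ⟩
  ℚᵘ.mkℚᵘ (ℤ.+ a) b ℚᵘ.+ ℚᵘ.mkℚᵘ ℤ.-[1+ 0 ] 0
    ≈⟨ ℚᵘ.*≡* (≡.cong₂ ℤ._*_ numerator (≡.cong (λ d → ℤ.+ suc d) (≡.sym (ℕ.*-identityʳ b)))) ⟩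
  ℚᵘ.mkℚᵘ (a ℤ.⊖ suc b) b ∎
  where
  open ℚᵘ.≃-Reasoning
  numerator : ℤ.+ a ℤ.* ℤ.+ 1 ℤ.+ ℤ.-[1+ 0 ] ℤ.* ℤ.+ suc b ≡ a ℤ.⊖ suc b
  numerator = ≡.trans
    (≡.cong₂ ℤ._+_ (ℤ.*-identityʳ (ℤ.+ a)) (ℤ.-1*i≡-i (ℤ.+ suc b)))
    (ℤ.m-n≡m⊖n a (suc b))

-- With d the denominator `suc b`, the second part makes a - d an honest natural exponent, and the
-- first bounds n² by n^((a-d)/d) for n ≥ 1.
2</-1 : ∀ a b → (ℤ.+ 2 ℚ./ 1) ℚ.< (ℤ.+ a ℚ./ suc b ℚ.- 1ℚ) → 2 * suc b < a ∸ suc b × suc b ≤ a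
2</-1 a b 2<q = ℤ.drop‿+<+ (≡.subst (ℤ.+ (2 * suc b) ℤ.<_) (ℤ.⊖-≥ b<a) lt) , b<a
  where
  lt : ℤ.+ (2 * suc b) ℤ.< a ℤ.⊖ suc b
  lt = ≡.subst₂ ℤ._<_ (≡.sym (ℤ.pos-* 2 (suc b))) (ℤ.*-identityʳ _)
    (ℚᵘ.drop-*<* (ℚᵘ.<-respʳ-≃ (/-1 a b) (ℚ.toℚᵘ-mono-< 2<q)))
  b<a : suc b ≤ a
  b<a = ℕ.≤-trans (ℕ.m≤m+n (suc b) _)
    (ℕ.<⇒≤ (ℤ.drop‿+<+ (ℤ.<-≤-trans lt (ℤ.m⊖n≤m a (suc b)))))

-- Brings the lowered exponent into the form of a fraction of naturals, at which the hypothesis on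
-- `μ` can be instantiated.
/-1-≡ : ∀ {a b} → suc b ≤ a → ℤ.+ a ℚ./ suc b ℚ.- 1ℚ ≡ ℤ.+ (a ∸ suc b) ℚ./ suc b
/-1-≡ {a} {b} b<a = ℚ.toℚᵘ-injective (ℚᵘ.≃-trans
  (≡.subst (λ z → ℚ.toℚᵘ (ℤ.+ a ℚ./ suc b ℚ.- 1ℚ) ℚᵘ.≃ ℚᵘ.mkℚᵘ z b) (ℤ.⊖-≥ b<a) (/-1 a b))
  (ℚᵘ.≃-sym (ℚ.toℚᵘ-fromℚᵘ (ℚᵘ.mkℚᵘ (ℤ.+ (a ∸ suc b)) b))))

^-distribʳ-* : ∀ b x y → (x * y) ^ b ≡ x ^ b * y ^ b
^-distribʳ-* zero    x y = ≡.refl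
^-distribʳ-* (suc b) x y =
  ≡.trans (≡.cong (x * y *_) (^-distribʳ-* b x y)) (interchange x y (x ^ b) (y ^ b))
  where open import Algebra.Properties.CommutativeSemigroup ℕ.*-commutativeSemigroup using (interchange)

-- β ≥ 2 lets the terms of order n² be absorbed into the bound for μ.
module _ {β : ℝ} (2≤β : (ℤ.+ 2 ℚ./ 1) ≤ᴿ β) {μ : ℕ → ℕ} (f s : ℕ → ℕ)
  (f≤ : ∀ m → f m ≤ s m * ((μ (s m) + (s m + 1)) + (μ (s m) + (s m * s m + s m * s m)))) where

  isO-step : IsO μ id β → IsO f s (β +1)
  -- Six is the number of summands in the cost of a round, each at most the maximum of `μ n` and
  -- `n * n`. Taking `suc C` keeps the factor at least 1 when `n * n` is the larger, and `suc n₀`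
  -- ensures `n ≥ 1`.
  isO-step (C , n₀ , μ≤) = 6 * suc C , suc n₀ , bound
    where
    bound : ∀ m → suc n₀ ≤ s m → ∀ a b .{{_ : NonZero b}} → ℝ.U (β +1) (ℤ.+ a ℚ./ b) →
            f m ^ b ≤ (6 * suc C) ^ b * s m ^ a
    -- By definition of `β +1`, `u` says that β lies below a/b - 1, so `2≤β` applies to it directly.
    bound m n₀<n a b@(suc b-1) u with 2</-1 a b-1 (2≤β u)
    ... | 2b<a′ , b≤a = begin
      f m ^ b                              ≤⟨ ℕ.^-monoˡ-≤ b (ℕ.≤-trans (f≤ m) (ℕ.*-monoʳ-≤ n step≤)) ⟩
      (n * (6 * X)) ^ b                    ≡⟨ ≡.trans (^-distribʳ-* b n (6 * X)) (≡.cong (n ^ b *_) (^-distribʳ-* b 6 X)) ⟩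
      n ^ b * (6 ^ b * X ^ b)              ≤⟨ ℕ.*-monoʳ-≤ (n ^ b) (ℕ.*-monoʳ-≤ (6 ^ b) (X^b≤ (ℕ.≤-total (μ n) (n * n)))) ⟩
      n ^ b * (6 ^ b * (suc C ^ b * n ^ a′))
        ≡⟨ ≡.cong (n ^ b *_) (≡.trans (≡.cong (_* n ^ a′) (^-distribʳ-* b 6 (suc C))) (ℕ.*-assoc (6 ^ b) (suc C ^ b) (n ^ a′))) ⟨
      n ^ b * ((6 * suc C) ^ b * n ^ a′)   ≡⟨ x∙yz≈y∙xz (n ^ b) ((6 * suc C) ^ b) (n ^ a′) ⟩
      (6 * suc C) ^ b * (n ^ b * n ^ a′)   ≡⟨ ≡.cong ((6 * suc C) ^ b *_) (ℕ.^-distribˡ-+-* n b a′) ⟨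
      -- The factor `n ^ b`, which stems from the number of rounds, raises the exponent from `a ∸ b`
      -- back to `a`.
      (6 * suc C) ^ b * n ^ (b + a′)       ≡⟨ ≡.cong (λ e → (6 * suc C) ^ b * n ^ e) (ℕ.m+[n∸m]≡n b≤a) ⟩
      (6 * suc C) ^ b * n ^ a              ∎
      where
      open ℕ.≤-Reasoning
      open import Algebra.Properties.CommutativeSemigroup ℕ.*-commutativeSemigroup using (x∙yz≈y∙xz)
      n = s m
      a′ = a ∸ b
      X = μ n ⊔ n * n
      instance
        n≢0 : NonZero n
        n≢0 = ℕ.>-nonZero (ℕ.≤-trans (s≤s z≤n) n₀<n)
      n≤X : n ≤ X
      n≤X = ℕ.≤-trans (ℕ.m≤m*n n n) (ℕ.m≤n⊔m (μ n) (n * n))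
      step≤ : (μ n + (n + 1)) + (μ n + (n * n + n * n)) ≤ 6 * X
      step≤ = ℕ.≤-trans
        (ℕ.+-mono-≤ (ℕ.+-mono-≤ (ℕ.m≤m⊔n (μ n) _) (ℕ.+-mono-≤ n≤X (ℕ.≤-trans (ℕ.>-nonZero⁻¹ n) n≤X)))
          (ℕ.+-mono-≤ (ℕ.m≤m⊔n (μ n) _) (ℕ.+-mono-≤ (ℕ.m≤n⊔m (μ n) _) (ℕ.m≤n⊔m (μ n) _))))
        (ℕ.≤-reflexive (solve 1 (λ X → (X :+ (X :+ X)) :+ (X :+ (X :+ X)) := con 6 :* X) ≡.refl X))
        where open +-*-Solver
      μ^b≤ : μ n ^ b ≤ C ^ b * n ^ a′
      μ^b≤ = μ≤ n (ℕ.<⇒≤ n₀<n) a′ b (≡.subst (ℝ.U β) (/-1-≡ b≤a) u)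
      X^b≤ : μ n ≤ n * n ⊎ n * n ≤ μ n → X ^ b ≤ suc C ^ b * n ^ a′
      X^b≤ (inj₁ μ≤n²) = begin
        X ^ b                  ≡⟨ ≡.cong (_^ b) (ℕ.m≤n⇒m⊔n≡n μ≤n²) ⟩
        (n * n) ^ b            ≡⟨ ≡.trans (^-distribʳ-* b n n) (≡.sym (ℕ.^-distribˡ-+-* n b b)) ⟩
        n ^ (b + b)            ≤⟨ ℕ.^-monoʳ-≤ n (ℕ.≤-trans (ℕ.≤-reflexive (≡.cong (b +_) (≡.sym (ℕ.+-identityʳ b)))) (ℕ.<⇒≤ 2b<a′)) ⟩
        n ^ a′                 ≤⟨ ℕ.m≤n*m (n ^ a′) (suc C ^ b) {{ℕ.m^n≢0 (suc C) b}} ⟩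
        suc C ^ b * n ^ a′     ∎
      X^b≤ (inj₂ n²≤μ) = begin
        X ^ b                  ≡⟨ ≡.cong (_^ b) (ℕ.m≥n⇒m⊔n≡m n²≤μ) ⟩
        μ n ^ b                ≤⟨ μ^b≤ ⟩
        C ^ b * n ^ a′         ≤⟨ ℕ.*-monoˡ-≤ (n ^ a′) (ℕ.^-monoˡ-≤ b (ℕ.n≤1+n C)) ⟩
        suc C ^ b * n ^ a′     ∎

open import Data.Integer.Base using (+_)
open import Data.Rational.Base using (_/_)

mainTheorem1 :
  ∀ {c ℓ} (R : CommutativeℚAlgebra c ℓ) →
  let open Over R in
  (∀ m .{{_ : NonZero m}} (A : Mat (m * 2)) → SkewSymmetric A →
      (pfᵗ (t ·ᴹᵗ Jᵗ m +ᴹᵗ Cᴹ A)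
        ≈ᵗ Σᵗ[ (λ (j : Fin (suc m)) → C (coef m A (m ∸ toℕ j)) *ᵗ t ^ᵗ toℕ j) ])
    × (coef m A m ≈ pf A)
    × (N m A m ≈ᴹ Padj A)
    × (A *ᴹ N m A m ≈ᴹ pf A ·ᴹ 1ᴹ))
  ×
  (∀ (β : ℝ) → (+ 2 / 1) ≤ᴿ β →
   (mm : MatrixMultiplication) → IsO (λ n → cost (program mm n)) id β →
      (∀ m .{{_ : NonZero m}} (A : Mat (m * 2)) → SkewSymmetric A →
         run (pfaffianProgram mm m) (uncurry A) tt ≈ pf A)
    × IsO (λ m → cost (pfaffianProgram mm m)) (λ m → m * 2) (β +1)
    × (∀ m {d} → d ∈ divisors (pfaffianProgram mm m) →
         (∃[ k ] 1 ≤ k × k ≤ m × d ≡ + (2 * k)) ⊎ d ∈ divisors (program mm (m * 2))))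
mainTheorem1 R =
    (λ { (suc m) A skew → pf-pencil m A skew , coef-pf m A skew , N-Padj m A skew , A*N m A skew })
  , λ β 2≤β mm μ≤ →
    (λ { (suc m) A skew → trans (run-pfaffianProgram mm (suc m) A) (coef-pf m A skew) })
  , isO-step {β} 2≤β {λ n → cost (program mm n)} (λ m → cost (pfaffianProgram mm m)) (_* 2) (cost≤ mm) μ≤
  , λ m → All.lookup (allDivisors (allowed-pfaffianProgram mm m))
  where
  open Over R
  open CommutativeℚAlgebra R using (trans)
  open RecursionCorrect R
  open ProgramCorrect R
  open ProgramCost R
  -- The `m` rounds are estimated by the matrix size `m * 2`, since `isO-step` measures everything
  -- in that size.
  cost≤ : ∀ mm m → cost (pfaffianProgram mm m) ≤ m * 2 * stepCost mm m
  cost≤ mm m = ℕ.≤-trans (bound (costs-pfaffianProgram mm m)) (ℕ.*-monoˡ-≤ (stepCost mm m) (ℕ.m≤m*n m 2))
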